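{- Fix integers $q\ge 1$ and $b\in\mathbb{Z}$. Suppose $m$ is a positive integer and $k>0$ is a real number satisfying $$\sum_{\substack{1\le i\le m-1\\ i\equiv b \bmod q}} i^k = m^k,$$ and assume $b\equiv m-r \bmod q$ with $r\in\{1,2,\dots,q\}$. Then $$k = c_1 m + c_2 + O_q(1/m),$$ where $c_1$ is the real solution of $e^{ -c_1 q}+e^{ -c_1 r}=1$, and $$c_2 = -\frac{c_1}{2}\cdot \frac{\dfrac{r^2}{1-e^{ -c_1 q}}+\dfrac{2rq\,e^{ -c_1 q}}{(1-e^{ -c_1 q})^2}+\dfrac{q^2 e^{ -c_1 q}(1+e^{ -c_1 q})}{(1-e^{ -c_1 q})^3}}{\dfrac{r}{1-e^{ -c_1 q}}+\dfrac{q\,e^{ -c_1 q}}{(1-e^{ -c_1 q})^2}}.$$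
   Context: The notation $O_q(1/m)$ means a quantity bounded in absolute value by $C/m$, where the constant $C$ depends only on $q$; the expansion is asymptotic as $m\to\infty$. The numbers $c_1,c_2$ depend on $q$ and on $r$, where $r$ is the element of $\{1,\dots,q\}$ congruent to $m-b$ modulo $q$. -}

module Defs where

open import Data.Nat as ℕ using (ℕ; zero; suc)
import Data.Nat.Properties as ℕₚ
open import Data.Integer as ℤ using (ℤ; +_)
import Data.Integer.Properties as ℤₚ
import Data.Integer.Divisibility.Signed as ℤ∣
open import Data.Rational as ℚ using (ℚ; 0ℚ; 1ℚ; ½)
import Data.Rational.Properties as ℚₚ
import Data.Rational.Unnormalised as ℚᵘ
import Data.Rational.Unnormalised.Properties as ℚᵘₚ
open import Data.Rational.Solver using (module +-*-Solver)
open import Data.Integer.Solver renaming (module +-*-Solver to +-*-ℤSolver)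
open import Data.List using (foldr; map; filter; upTo)
open import Data.Product using (∃-syntax; _×_; _,_; proj₁; proj₂)
open import Data.Sum using (inj₁; inj₂)
open import Relation.Nullary using (Dec)
open import Relation.Binary.PropositionalEquality
  using (_≡_; refl; sym; trans; cong; cong₂; subst; subst₂; module ≡-Reasoning)

fromℕℚ : ℕ → ℚ
fromℕℚ n = + n ℚ./ 1

1/suc : ℕ → ℚ
1/suc n = + 1 ℚ./ suc n

IsCauchy : (ℕ → ℚ) → Set
IsCauchy s = ∀ ε → 0ℚ ℚ.< ε →
  ∃[ N ] ∀ m n → N ℕ.≤ m → N ℕ.≤ n → ℚ.∣ s m ℚ.- s n ∣ ℚ.≤ ε

module RationalLemmas where
  open import Data.Rational using (_+_; _*_; _-_; -_; ∣_∣; _≤_; _<_; _⊔_; 1/_)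
  open ℚₚ using (≤-trans; ≤-refl; ≤-reflexive; <⇒≤)

  *-monoˡ : ∀ {p q} r → 0ℚ ≤ r → p ≤ q → r * p ≤ r * q
  *-monoˡ r 0≤r = ℚₚ.*-monoˡ-≤-nonNeg r {{ℚ.nonNegative 0≤r}}

  *-monoʳ : ∀ {p q} r → 0ℚ ≤ r → p ≤ q → p * r ≤ q * r
  *-monoʳ r 0≤r = ℚₚ.*-monoʳ-≤-nonNeg r {{ℚ.nonNegative 0≤r}}

  *-mono : ∀ {p q r s} → 0ℚ ≤ r → 0ℚ ≤ q → p ≤ q → r ≤ s → p * r ≤ q * s
  *-mono {p} {q} {r} 0≤r 0≤q p≤q r≤s = ≤-trans (*-monoʳ r 0≤r p≤q) (*-monoˡ q 0≤q r≤s)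

  *-cancelˡ : ∀ {p q} r → 0ℚ < r → r * p ≤ r * q → p ≤ q
  *-cancelˡ r 0<r = ℚₚ.*-cancelˡ-≤-pos r {{ℚ.positive 0<r}}

  *-cancelʳ : ∀ {p q} r → 0ℚ < r → p * r ≤ q * r → p ≤ q
  *-cancelʳ r 0<r = ℚₚ.*-cancelʳ-≤-pos r {{ℚ.positive 0<r}}

  0≤* : ∀ {p q} → 0ℚ ≤ p → 0ℚ ≤ q → 0ℚ ≤ p * q
  0≤* {p} {q} 0≤p 0≤q = subst (_≤ p * q) (ℚₚ.*-zeroʳ p) (*-monoˡ p 0≤p 0≤q)

  0<* : ∀ {p q} → 0ℚ < p → 0ℚ < q → 0ℚ < p * q
  0<* {p} {q} 0<p 0<q = subst (_< p * q) (ℚₚ.*-zeroʳ p)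
    (ℚₚ.*-monoʳ-<-pos p {{ℚ.positive 0<p}} 0<q)

  0≤+ : ∀ {p q} → 0ℚ ≤ p → 0ℚ ≤ q → 0ℚ ≤ p + q
  0≤+ = ℚₚ.+-mono-≤

  p≤p+q : ∀ {p q} → 0ℚ ≤ q → p ≤ p + q
  p≤p+q {p} {q} 0≤q = subst (_≤ p + q) (ℚₚ.+-identityʳ p) (ℚₚ.+-monoʳ-≤ p 0≤q)

  ∣-∣-sym : ∀ p q → ∣ p - q ∣ ≡ ∣ q - p ∣
  ∣-∣-sym p q = trans (cong ∣_∣ (solve 2 (λ p q → p :- q := :- (q :- p)) refl p q))
                      (ℚₚ.∣-p∣≡∣p∣ (q - p))
    where open +-*-Solver

  ∣∣≤ : ∀ {p q} → p ≤ q → - p ≤ q → ∣ p ∣ ≤ q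
  ∣∣≤ {p} p≤q -p≤q with ℚₚ.∣p∣≡p∨∣p∣≡-p p
  ... | inj₁ eq = subst (_≤ _) (sym eq) p≤q
  ... | inj₂ eq = subst (_≤ _) (sym eq) -p≤q

  ∣∣p∣-∣q∣∣≤∣p-q∣ : ∀ p q → ∣ ∣ p ∣ - ∣ q ∣ ∣ ≤ ∣ p - q ∣
  ∣∣p∣-∣q∣∣≤∣p-q∣ p q = ∣∣≤ (one p q)
    (subst₂ _≤_ (solve 2 (λ x y → y :- x := :- (x :- y)) refl ∣ p ∣ ∣ q ∣) (∣-∣-sym q p) (one q p))
    where
    open +-*-Solver
    one : ∀ p q → ∣ p ∣ - ∣ q ∣ ≤ ∣ p - q ∣
    one p q = subst (∣ p ∣ - ∣ q ∣ ≤_)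
      (solve 2 (λ x y → (x :+ y) :- y := x) refl ∣ p - q ∣ ∣ q ∣)
      (ℚₚ.+-monoˡ-≤ (- ∣ q ∣)
        (subst (λ z → ∣ z ∣ ≤ ∣ p - q ∣ + ∣ q ∣)
          (solve 2 (λ x y → (x :- y) :+ y := x) refl p q)
          (ℚₚ.∣p+q∣≤∣p∣+∣q∣ (p - q) q)))

  triangle : ∀ p q r → ∣ p - r ∣ ≤ ∣ p - q ∣ + ∣ q - r ∣
  triangle p q r = subst (λ z → ∣ z ∣ ≤ ∣ p - q ∣ + ∣ q - r ∣)
    (solve 3 (λ p q r → (p :- q) :+ (q :- r) := p :- r) refl p q r)
    (ℚₚ.∣p+q∣≤∣p∣+∣q∣ (p - q) (q - r))
    where open +-*-Solver

  p≤q+r⇒p-q≤r : ∀ {p q r} → p ≤ q + r → p - q ≤ r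
  p≤q+r⇒p-q≤r {p} {q} {r} h = subst (p - q ≤_)
    (solve 2 (λ q r → (q :+ r) :- q := r) refl q r) (ℚₚ.+-monoˡ-≤ (- q) h)
    where open +-*-Solver

  p≤q⇒0≤q-p : ∀ {p q} → p ≤ q → 0ℚ ≤ q - p
  p≤q⇒0≤q-p {p} {q} h = subst (_≤ q - p) (ℚₚ.+-inverseʳ p) (ℚₚ.+-monoˡ-≤ (- p) h)

  0<½ : 0ℚ < ½
  0<½ = ℚₚ.positive⁻¹ ½

  0<half : ∀ {ε} → 0ℚ < ε → 0ℚ < ½ * ε
  0<half = 0<* 0<½

  half+half : ∀ ε → ½ * ε + ½ * ε ≡ ε
  half+half = solve 1 (λ e → con ½ :* e :+ con ½ :* e := e) refl
    where open +-*-Solver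

  scale : ∀ A ε → 0ℚ ≤ A → 0ℚ < ε → ∃[ δ ] (0ℚ < δ × A * δ ≤ ε)
  scale A ε 0≤A 0<ε = r * ε , 0<* 0<r 0<ε ,
    ≤-trans (*-monoʳ (r * ε) (<⇒≤ (0<* 0<r 0<ε)) A≤1+A)
      (≤-reflexive (trans (sym (ℚₚ.*-assoc (1ℚ + A) r ε))
        (trans (cong (_* ε) (ℚₚ.*-inverseʳ (1ℚ + A) {{nz}})) (ℚₚ.*-identityˡ ε))))
    where
    0<1+A : 0ℚ < 1ℚ + A
    0<1+A = ℚₚ.+-mono-<-≤ (ℚₚ.positive⁻¹ 1ℚ) 0≤A
    nz = ℚ.>-nonZero 0<1+A
    r = (1/ (1ℚ + A)) {{nz}}
    0<r : 0ℚ < r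
    0<r = ℚₚ.positive⁻¹ r {{ℚₚ.1/pos⇒pos (1ℚ + A) {{ℚ.positive 0<1+A}}}}
    A≤1+A : A ≤ 1ℚ + A
    A≤1+A = subst (A ≤_) (ℚₚ.+-comm A 1ℚ) (p≤p+q (<⇒≤ (ℚₚ.positive⁻¹ 1ℚ)))

  fromℕℚ-suc : ∀ n → fromℕℚ (suc n) ≡ 1ℚ + fromℕℚ n
  fromℕℚ-suc n = ℚₚ.toℚᵘ-injective (begin
    ℚ.toℚᵘ (fromℕℚ (suc n))             ≈⟨ ℚₚ.toℚᵘ-fromℚᵘ (ℚᵘ.mkℚᵘ (+ suc n) 0) ⟩
    ℚᵘ.mkℚᵘ (+ suc n) 0                 ≈⟨ ℚᵘ.*≡* (lem (+ n)) ⟩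
    ℚᵘ.1ℚᵘ ℚᵘ.+ ℚᵘ.mkℚᵘ (+ n) 0         ≈⟨ ℚᵘₚ.+-congʳ ℚᵘ.1ℚᵘ (ℚₚ.toℚᵘ-fromℚᵘ (ℚᵘ.mkℚᵘ (+ n) 0)) ⟨
    ℚᵘ.1ℚᵘ ℚᵘ.+ ℚ.toℚᵘ (fromℕℚ n)       ≈⟨ ℚₚ.toℚᵘ-homo-+ 1ℚ (fromℕℚ n) ⟨
    ℚ.toℚᵘ (1ℚ + fromℕℚ n)              ∎)
    where
    open ℚᵘₚ.≃-Reasoning
    open +-*-ℤSolver
    lem : ∀ i → (+ 1 ℤ.+ i) ℤ.* + 1 ≡ (+ 1 ℤ.* + 1 ℤ.+ i ℤ.* + 1) ℤ.* + 1
    lem = solve 1 (λ i → (con (+ 1) :+ i) :* con (+ 1)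
                      := (con (+ 1) :* con (+ 1) :+ i :* con (+ 1)) :* con (+ 1)) refl

  fromℕℚ-+ : ∀ m n → fromℕℚ (m ℕ.+ n) ≡ fromℕℚ m + fromℕℚ n
  fromℕℚ-+ zero n = sym (ℚₚ.+-identityˡ (fromℕℚ n))
  fromℕℚ-+ (suc m) n = begin
    fromℕℚ (suc (m ℕ.+ n))         ≡⟨ fromℕℚ-suc (m ℕ.+ n) ⟩
    1ℚ + fromℕℚ (m ℕ.+ n)          ≡⟨ cong (λ z → 1ℚ + z) (fromℕℚ-+ m n) ⟩
    1ℚ + (fromℕℚ m + fromℕℚ n)     ≡⟨ ℚₚ.+-assoc 1ℚ (fromℕℚ m) (fromℕℚ n) ⟨
    (1ℚ + fromℕℚ m) + fromℕℚ n     ≡⟨ cong (_+ fromℕℚ n) (fromℕℚ-suc m) ⟨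
    fromℕℚ (suc m) + fromℕℚ n      ∎
    where open ≡-Reasoning

  fromℕℚ-* : ∀ m n → fromℕℚ (m ℕ.* n) ≡ fromℕℚ m * fromℕℚ n
  fromℕℚ-* zero n = sym (ℚₚ.*-zeroˡ (fromℕℚ n))
  fromℕℚ-* (suc m) n = begin
    fromℕℚ (n ℕ.+ m ℕ.* n)              ≡⟨ fromℕℚ-+ n (m ℕ.* n) ⟩
    fromℕℚ n + fromℕℚ (m ℕ.* n)         ≡⟨ cong (λ z → fromℕℚ n + z) (fromℕℚ-* m n) ⟩
    fromℕℚ n + fromℕℚ m * fromℕℚ n      ≡⟨ solve 2 (λ x y → y :+ x :* y := (con 1ℚ :+ x) :* y) refl (fromℕℚ m) (fromℕℚ n) ⟩
    (1ℚ + fromℕℚ m) * fromℕℚ n          ≡⟨ cong (_* fromℕℚ n) (fromℕℚ-suc m) ⟨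
    fromℕℚ (suc m) * fromℕℚ n           ∎
    where open ≡-Reasoning
          open +-*-Solver

  0≤fromℕℚ : ∀ n → 0ℚ ≤ fromℕℚ n
  0≤fromℕℚ n = ℚₚ.nonNegative⁻¹ (fromℕℚ n) {{ℚₚ.normalize-nonNeg n 1}}

  0<fromℕℚ-suc : ∀ n → 0ℚ < fromℕℚ (suc n)
  0<fromℕℚ-suc n = ℚₚ.positive⁻¹ (fromℕℚ (suc n)) {{ℚₚ.normalize-pos (suc n) 1}}

  0<1/suc : ∀ n → 0ℚ < 1/suc n
  0<1/suc n = ℚₚ.positive⁻¹ (1/suc n) {{ℚₚ.normalize-pos 1 (suc n)}}

  fromℕℚ-mono : ∀ {m n} → m ℕ.≤ n → fromℕℚ m ≤ fromℕℚ n
  fromℕℚ-mono {m} m≤n with ℕₚ.m≤n⇒∃[o]m+o≡n m≤n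
  ... | (d , refl) = subst (fromℕℚ m ≤_) (sym (fromℕℚ-+ m d)) (p≤p+q (0≤fromℕℚ d))

  suc*1/suc : ∀ n → fromℕℚ (suc n) * 1/suc n ≡ 1ℚ
  suc*1/suc n = ℚₚ.toℚᵘ-injective (begin
    ℚ.toℚᵘ (fromℕℚ (suc n) * 1/suc n)           ≈⟨ ℚₚ.toℚᵘ-homo-* (fromℕℚ (suc n)) (1/suc n) ⟩
    ℚ.toℚᵘ (fromℕℚ (suc n)) ℚᵘ.* ℚ.toℚᵘ (1/suc n)
      ≈⟨ ℚᵘₚ.*-cong (ℚₚ.toℚᵘ-fromℚᵘ (ℚᵘ.mkℚᵘ (+ suc n) 0)) (ℚₚ.toℚᵘ-fromℚᵘ (ℚᵘ.mkℚᵘ (+ 1) n)) ⟩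
    ℚᵘ.mkℚᵘ (+ suc n) 0 ℚᵘ.* ℚᵘ.mkℚᵘ (+ 1) n    ≈⟨ ℚᵘ.*≡* (lem (+ suc n)) ⟩
    ℚᵘ.1ℚᵘ                                      ∎)
    where
    open ℚᵘₚ.≃-Reasoning
    open +-*-ℤSolver
    lem : ∀ i → (i ℤ.* + 1) ℤ.* + 1 ≡ + 1 ℤ.* (+ 1 ℤ.* i)
    lem = solve 1 (λ i → (i :* con (+ 1)) :* con (+ 1) := con (+ 1) :* (con (+ 1) :* i)) refl

  archimedean : ∀ p → ∃[ n ] p ≤ fromℕℚ n
  archimedean p@(ℚ.mkℚ i d _) = ℤ.∣ i ∣ , ℚₚ.toℚᵘ-cancel-≤
    (ℚᵘₚ.≤-respʳ-≃ (ℚᵘₚ.≃-sym (ℚₚ.toℚᵘ-fromℚᵘ (ℚᵘ.mkℚᵘ (+ ℤ.∣ i ∣) 0)))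
      (ℚᵘ.*≤* (ℤₚ.≤-trans (ℤₚ.≤-reflexive (ℤₚ.*-identityʳ i)) (bound i))))
    where
    bound : ∀ j → j ℤ.≤ + ℤ.∣ j ∣ ℤ.* + suc d
    bound (+ n) = ℤₚ.≤-trans (ℤ.+≤+ (ℕₚ.m≤m*n n (suc d))) (ℤₚ.≤-reflexive (ℤₚ.pos-* n (suc d)))
    bound (ℤ.-[1+ n ]) = ℤ.-≤+

  archimedean⁻¹ : ∀ A ε → 0ℚ < ε → ∃[ n ] A ≤ fromℕℚ (suc n) * ε
  archimedean⁻¹ A ε 0<ε = n , ≤-trans (≤-trans (≤-reflexive A≡A/ε*ε) (*-monoʳ ε (<⇒≤ 0<ε) h))
                                      (*-monoʳ ε (<⇒≤ 0<ε) (fromℕℚ-mono (ℕₚ.n≤1+n n)))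
    where
    r = (1/ ε) {{ℚ.>-nonZero 0<ε}}
    n = proj₁ (archimedean (A * r))
    h = proj₂ (archimedean (A * r))
    A≡A/ε*ε : A ≡ A * r * ε
    A≡A/ε*ε = sym (trans (ℚₚ.*-assoc A r ε)
      (trans (cong (A *_) (ℚₚ.*-inverseˡ ε {{ℚ.>-nonZero 0<ε}})) (ℚₚ.*-identityʳ A)))

  cauchy-from-ordered : ∀ s →
    (∀ ε → 0ℚ < ε → ∃[ N ] ∀ n m → N ℕ.≤ n → n ℕ.≤ m → ∣ s m - s n ∣ ≤ ε) → IsCauchy s
  cauchy-from-ordered s h ε 0<ε with h ε 0<ε
  ... | N , f = N , g
    where
    g : ∀ m n → N ℕ.≤ m → N ℕ.≤ n → ∣ s m - s n ∣ ≤ ε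
    g m n N≤m N≤n with ℕₚ.≤-total n m
    ... | inj₁ n≤m = f n m N≤n n≤m
    ... | inj₂ m≤n = subst (_≤ ε) (∣-∣-sym (s n) (s m)) (f m n N≤m m≤n)

  increasing : ∀ (s : ℕ → ℚ) {J} → (∀ n → J ℕ.≤ n → s n ≤ s (suc n)) →
    ∀ {n m} → J ℕ.≤ n → n ℕ.≤ m → s n ≤ s m
  increasing s {J} step {n} J≤n n≤m = go (ℕₚ.≤⇒≤′ n≤m)
    where
    go : ∀ {m} → n ℕ.≤′ m → s n ≤ s m
    go (ℕ.≤′-reflexive refl) = ≤-refl
    go (ℕ.≤′-step n≤′m) = ≤-trans (go n≤′m) (step _ (ℕₚ.≤-trans J≤n (ℕₚ.≤′⇒≤ n≤′m)))

  decreasing : ∀ (s : ℕ → ℚ) {J} → (∀ n → J ℕ.≤ n → s (suc n) ≤ s n) →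
    ∀ {n m} → J ℕ.≤ n → n ℕ.≤ m → s m ≤ s n
  decreasing s {J} step {n} J≤n n≤m = go (ℕₚ.≤⇒≤′ n≤m)
    where
    go : ∀ {m} → n ℕ.≤′ m → s m ≤ s n
    go (ℕ.≤′-reflexive refl) = ≤-refl
    go (ℕ.≤′-step n≤′m) = ≤-trans (step _ (ℕₚ.≤-trans J≤n (ℕₚ.≤′⇒≤ n≤′m))) (go n≤′m)

  cauchy-bounded : ∀ s → IsCauchy s → ∃[ K ] ∃[ N ] ∀ n → N ℕ.≤ n → ∣ s n ∣ ≤ fromℕℚ K
  cauchy-bounded s c with c 1ℚ (ℚₚ.positive⁻¹ 1ℚ)
  ... | N , f with archimedean (1ℚ + ∣ s N ∣)
  ... | K , h = K , N , λ n N≤n → ≤-trans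
    (subst (λ z → ∣ z ∣ ≤ 1ℚ + ∣ s N ∣) (solve 2 (λ p q → (p :- q) :+ q := p) refl (s n) (s N))
      (≤-trans (ℚₚ.∣p+q∣≤∣p∣+∣q∣ (s n - s N) (s N))
        (ℚₚ.+-monoˡ-≤ ∣ s N ∣ (f n N N≤n ℕₚ.≤-refl))))
    h
    where open +-*-Solver

  const-cauchy : ∀ p → IsCauchy (λ _ → p)
  const-cauchy p ε 0<ε = 0 , λ _ _ _ _ →
    subst (_≤ ε) (cong ∣_∣ (sym (ℚₚ.+-inverseʳ p))) (<⇒≤ 0<ε)

  +-cauchy : ∀ s t → IsCauchy s → IsCauchy t → IsCauchy (λ n → s n + t n)
  +-cauchy s t cs ct ε 0<ε with cs (½ * ε) (0<half 0<ε) | ct (½ * ε) (0<half 0<ε)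
  ... | N , f | M , g = N ℕ.⊔ M , λ m n N≤m N≤n →
    subst (λ z → ∣ z ∣ ≤ ε)
      (solve 4 (λ a b c d → (a :- b) :+ (c :- d) := (a :+ c) :- (b :+ d)) refl (s m) (s n) (t m) (t n))
      (≤-trans (ℚₚ.∣p+q∣≤∣p∣+∣q∣ (s m - s n) (t m - t n))
        (≤-trans (ℚₚ.+-mono-≤ (f m n (ℕₚ.m⊔n≤o⇒m≤o N M N≤m) (ℕₚ.m⊔n≤o⇒m≤o N M N≤n))
                              (g m n (ℕₚ.m⊔n≤o⇒n≤o N M N≤m) (ℕₚ.m⊔n≤o⇒n≤o N M N≤n)))
          (≤-reflexive (half+half ε))))
    where open +-*-Solver

  neg-cauchy : ∀ s → IsCauchy s → IsCauchy (λ n → - s n)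
  neg-cauchy s c ε 0<ε with c ε 0<ε
  ... | N , f = N , λ m n N≤m N≤n → subst (λ z → ∣ z ∣ ≤ ε)
    (solve 2 (λ a b → b :- a := :- a :- :- b) refl (s m) (s n)) (f n m N≤n N≤m)
    where open +-*-Solver

  abs-cauchy : ∀ s → IsCauchy s → IsCauchy (λ n → ∣ s n ∣)
  abs-cauchy s c ε 0<ε with c ε 0<ε
  ... | N , f = N , λ m n N≤m N≤n → ≤-trans (∣∣p∣-∣q∣∣≤∣p-q∣ (s m) (s n)) (f m n N≤m N≤n)

  ∣ac-bd∣≤ : ∀ a b c d {K L δ} → 0ℚ ≤ K → 0ℚ ≤ δ → ∣ a ∣ ≤ K → ∣ d ∣ ≤ L →
    ∣ a - b ∣ ≤ δ → ∣ c - d ∣ ≤ δ → ∣ a * c - b * d ∣ ≤ (K + L) * δ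
  ∣ac-bd∣≤ a b c d {K} {L} {δ} 0≤K 0≤δ a≤K d≤L ab cd = begin
    ∣ a * c - b * d ∣                      ≡⟨ cong ∣_∣ (solve 4 (λ a b c d → a :* c :- b :* d := a :* (c :- d) :+ (a :- b) :* d) refl a b c d) ⟩
    ∣ a * (c - d) + (a - b) * d ∣          ≤⟨ ℚₚ.∣p+q∣≤∣p∣+∣q∣ (a * (c - d)) ((a - b) * d) ⟩
    ∣ a * (c - d) ∣ + ∣ (a - b) * d ∣      ≡⟨ cong₂ _+_ (ℚₚ.∣p*q∣≡∣p∣*∣q∣ a (c - d)) (ℚₚ.∣p*q∣≡∣p∣*∣q∣ (a - b) d) ⟩
    ∣ a ∣ * ∣ c - d ∣ + ∣ a - b ∣ * ∣ d ∣  ≤⟨ ℚₚ.+-mono-≤ (*-mono (ℚₚ.0≤∣p∣ (c - d)) 0≤K a≤K cd) (*-mono (ℚₚ.0≤∣p∣ d) 0≤δ ab d≤L) ⟩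
    K * δ + δ * L                          ≡⟨ solve 3 (λ k l e → k :* e :+ e :* l := (k :+ l) :* e) refl K L δ ⟩
    (K + L) * δ                            ∎
    where open ℚₚ.≤-Reasoning
          open +-*-Solver

  *-cauchy : ∀ s t → IsCauchy s → IsCauchy t → IsCauchy (λ n → s n * t n)
  *-cauchy s t cs ct ε 0<ε =
    let K , N₁ , f = cauchy-bounded s cs
        L , N₂ , g = cauchy-bounded t ct
        δ , 0<δ , Aδ≤ε = scale (fromℕℚ K + fromℕℚ L) ε (0≤+ (0≤fromℕℚ K) (0≤fromℕℚ L)) 0<ε
        N₃ , h = cs δ 0<δ
        N₄ , k = ct δ 0<δ
        a = N₁ ℕ.⊔ N₂
        b = N₃ ℕ.⊔ N₄
    in a ℕ.⊔ b , λ m n a⊔b≤m a⊔b≤n →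
      let a≤m = ℕₚ.m⊔n≤o⇒m≤o a b a⊔b≤m
          a≤n = ℕₚ.m⊔n≤o⇒m≤o a b a⊔b≤n
          b≤m = ℕₚ.m⊔n≤o⇒n≤o a b a⊔b≤m
          b≤n = ℕₚ.m⊔n≤o⇒n≤o a b a⊔b≤n
      in ≤-trans (∣ac-bd∣≤ (s m) (s n) (t m) (t n) (0≤fromℕℚ K) (<⇒≤ 0<δ)
           (f m (ℕₚ.m⊔n≤o⇒m≤o N₁ N₂ a≤m)) (g n (ℕₚ.m⊔n≤o⇒n≤o N₁ N₂ a≤n))
           (h m n (ℕₚ.m⊔n≤o⇒m≤o N₃ N₄ b≤m) (ℕₚ.m⊔n≤o⇒m≤o N₃ N₄ b≤n))
           (k m n (ℕₚ.m⊔n≤o⇒n≤o N₃ N₄ b≤m) (ℕₚ.m⊔n≤o⇒n≤o N₃ N₄ b≤n))) Aδ≤ε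

  clampedInverse : ∀ η → 0ℚ < η → ℚ → ℚ
  clampedInverse η 0<η p = (1/ (η ⊔ p)) {{ℚ.>-nonZero (ℚₚ.<-≤-trans 0<η (ℚₚ.p≤p⊔q η p))}}

  clampedInverse-lipschitz : ∀ η (0<η : 0ℚ < η) → ∃[ A ] (0ℚ ≤ A × (∀ p q {δ} → η ≤ p → η ≤ q →
    ∣ p - q ∣ ≤ δ → ∣ clampedInverse η 0<η p - clampedInverse η 0<η q ∣ ≤ A * δ))
  clampedInverse-lipschitz η 0<η = E * E , 0≤* 0≤E 0≤E , bound
    where
    E = (1/ η) {{ℚ.>-nonZero 0<η}}
    0≤E : 0ℚ ≤ E
    0≤E = <⇒≤ (ℚₚ.positive⁻¹ E {{ℚₚ.1/pos⇒pos η {{ℚ.positive 0<η}}}})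
    v : ℚ → ℚ
    v = clampedInverse η 0<η
    0<⊔ : ∀ p → 0ℚ < η ⊔ p
    0<⊔ p = ℚₚ.<-≤-trans 0<η (ℚₚ.p≤p⊔q η p)
    pv : ∀ p → η ≤ p → p * v p ≡ 1ℚ
    pv p η≤p = subst (λ z → z * v p ≡ 1ℚ) (ℚₚ.p≤q⇒p⊔q≡q η≤p)
      (ℚₚ.*-inverseʳ (η ⊔ p) {{ℚ.>-nonZero (0<⊔ p)}})
    0≤v : ∀ p → 0ℚ ≤ v p
    0≤v p = <⇒≤ (ℚₚ.positive⁻¹ (v p) {{ℚₚ.1/pos⇒pos (η ⊔ p) {{ℚ.positive (0<⊔ p)}}}})
    open +-*-Solver
    v≤E : ∀ p → η ≤ p → v p ≤ E
    v≤E p η≤p = subst₂ _≤_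
      (trans (solve 3 (λ e h v → (e :* v) :* h := (h :* e) :* v) refl E η (v p))
        (trans (cong (_* v p) (ℚₚ.*-inverseʳ η {{ℚ.>-nonZero 0<η}})) (ℚₚ.*-identityˡ (v p))))
      (trans (solve 3 (λ e u v → (e :* v) :* u := e :* (u :* v)) refl E p (v p))
        (trans (cong (E *_) (pv p η≤p)) (ℚₚ.*-identityʳ E)))
      (*-monoˡ (E * v p) (0≤* 0≤E (0≤v p)) η≤p)
    diff : ∀ p q → η ≤ p → η ≤ q → v p - v q ≡ v p * v q * (q - p)
    diff p q η≤p η≤q = begin
      v p - v q                         ≡⟨ cong₂ _-_ (ℚₚ.*-identityʳ (v p)) (ℚₚ.*-identityʳ (v q)) ⟨
      v p * 1ℚ - v q * 1ℚ               ≡⟨ cong₂ (λ x y → v p * x - v q * y) (pv q η≤q) (pv p η≤p) ⟨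
      v p * (q * v q) - v q * (p * v p) ≡⟨ solve 4 (λ a b c d → a :* (c :* b) :- b :* (d :* a) := a :* b :* (c :- d)) refl (v p) (v q) q p ⟩
      v p * v q * (q - p)               ∎
      where open ≡-Reasoning
    bound : ∀ p q {δ} → η ≤ p → η ≤ q → ∣ p - q ∣ ≤ δ → ∣ v p - v q ∣ ≤ E * E * δ
    bound p q {δ} η≤p η≤q h = begin
      ∣ v p - v q ∣              ≡⟨ cong ∣_∣ (diff p q η≤p η≤q) ⟩
      ∣ v p * v q * (q - p) ∣    ≡⟨ ℚₚ.∣p*q∣≡∣p∣*∣q∣ (v p * v q) (q - p) ⟩
      ∣ v p * v q ∣ * ∣ q - p ∣  ≡⟨ cong₂ _*_ (ℚₚ.0≤p⇒∣p∣≡p (0≤* (0≤v p) (0≤v q))) (∣-∣-sym q p) ⟩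
      v p * v q * ∣ p - q ∣      ≤⟨ *-mono (ℚₚ.0≤∣p∣ (p - q)) (0≤* 0≤E 0≤E) (*-mono (0≤v q) 0≤E (v≤E p η≤p) (v≤E q η≤q)) h ⟩
      E * E * δ                  ∎
      where open ℚₚ.≤-Reasoning

  inverse-cauchy : ∀ s → IsCauchy s → ∀ η (0<η : 0ℚ < η) N → (∀ n → N ℕ.≤ n → η ≤ s n) →
    IsCauchy (λ n → clampedInverse η 0<η (s n))
  inverse-cauchy s c η 0<η N₀ η≤s ε 0<ε =
    let A , 0≤A , lip = clampedInverse-lipschitz η 0<η
        δ , 0<δ , Aδ≤ε = scale A ε 0≤A 0<ε
        N₁ , f = c δ 0<δ
    in N₀ ℕ.⊔ N₁ , λ m n N≤m N≤n → ≤-trans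
      (lip (s m) (s n) (η≤s m (ℕₚ.m⊔n≤o⇒m≤o N₀ N₁ N≤m)) (η≤s n (ℕₚ.m⊔n≤o⇒m≤o N₀ N₁ N≤n))
        (f m n (ℕₚ.m⊔n≤o⇒n≤o N₀ N₁ N≤m) (ℕₚ.m⊔n≤o⇒n≤o N₀ N₁ N≤n)))
      Aδ≤ε

-- x^j / j!
expTerm : ℚ → ℕ → ℚ
expTerm x zero    = 1ℚ
expTerm x (suc j) = expTerm x j ℚ.* (x ℚ.* 1/suc j)

-- Σ_{j < n} x^j / j!
expSum : ℚ → ℕ → ℚ
expSum x zero    = 0ℚ
expSum x (suc n) = expSum x n ℚ.+ expTerm x n

module ExpLemmas where
  open import Data.Rational using (_+_; _*_; _-_; -_; ∣_∣; _≤_; _<_)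
  open ℚₚ using (≤-trans; ≤-refl; ≤-reflexive; <⇒≤)
  open RationalLemmas
  open +-*-Solver

  0≤1/suc : ∀ n → 0ℚ ≤ 1/suc n
  0≤1/suc n = <⇒≤ (0<1/suc n)

  ∣x*1/suc∣ : ∀ p n → ∣ p * 1/suc n ∣ ≡ ∣ p ∣ * 1/suc n
  ∣x*1/suc∣ p n = trans (ℚₚ.∣p*q∣≡∣p∣*∣q∣ p (1/suc n)) (cong (∣ p ∣ *_) (ℚₚ.0≤p⇒∣p∣≡p (0≤1/suc n)))

  module Bounded (K : ℚ) (0≤K : 0ℚ ≤ K) where

    0≤term : ∀ j → 0ℚ ≤ expTerm K j
    0≤term zero    = <⇒≤ (ℚₚ.positive⁻¹ 1ℚ)
    0≤term (suc j) = 0≤* (0≤term j) (0≤* 0≤K (0≤1/suc j))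

    0≤sum : ∀ n → 0ℚ ≤ expSum K n
    0≤sum zero    = ≤-refl
    0≤sum (suc n) = 0≤+ (0≤sum n) (0≤term n)

    sum-mono : ∀ {n m} → n ℕ.≤ m → expSum K n ≤ expSum K m
    sum-mono = increasing (expSum K) {0} (λ n _ → p≤p+q (0≤term n)) ℕ.z≤n

    ∣term∣≤ : ∀ x → ∣ x ∣ ≤ K → ∀ j → ∣ expTerm x j ∣ ≤ expTerm K j
    ∣term∣≤ x x≤K zero    = ≤-refl
    ∣term∣≤ x x≤K (suc j) = begin
      ∣ expTerm x j * (x * 1/suc j) ∣      ≡⟨ ℚₚ.∣p*q∣≡∣p∣*∣q∣ (expTerm x j) (x * 1/suc j) ⟩
      ∣ expTerm x j ∣ * ∣ x * 1/suc j ∣    ≡⟨ cong (∣ expTerm x j ∣ *_) (∣x*1/suc∣ x j) ⟩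
      ∣ expTerm x j ∣ * (∣ x ∣ * 1/suc j)  ≤⟨ *-mono (0≤* (ℚₚ.0≤∣p∣ x) (0≤1/suc j)) (0≤term j) (∣term∣≤ x x≤K j) (*-monoʳ (1/suc j) (0≤1/suc j) x≤K) ⟩
      expTerm K j * (K * 1/suc j)          ∎
      where open ℚₚ.≤-Reasoning

    ∣sum-sum∣≤ : ∀ x → ∣ x ∣ ≤ K → ∀ {n m} → n ℕ.≤ m →
      ∣ expSum x m - expSum x n ∣ ≤ expSum K m - expSum K n
    ∣sum-sum∣≤ x x≤K {n} n≤m = go (ℕₚ.≤⇒≤′ n≤m)
      where
      go : ∀ {m} → n ℕ.≤′ m → ∣ expSum x m - expSum x n ∣ ≤ expSum K m - expSum K n
      go (ℕ.≤′-reflexive refl) = ≤-reflexive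
        (trans (cong ∣_∣ (ℚₚ.+-inverseʳ (expSum x n))) (sym (ℚₚ.+-inverseʳ (expSum K n))))
      go (ℕ.≤′-step {m} n≤′m) = begin
        ∣ (expSum x m + expTerm x m) - expSum x n ∣  ≡⟨ cong ∣_∣ (solve 3 (λ a b c → (a :+ b) :- c := (a :- c) :+ b) refl (expSum x m) (expTerm x m) (expSum x n)) ⟩
        ∣ (expSum x m - expSum x n) + expTerm x m ∣  ≤⟨ ℚₚ.∣p+q∣≤∣p∣+∣q∣ (expSum x m - expSum x n) (expTerm x m) ⟩
        ∣ expSum x m - expSum x n ∣ + ∣ expTerm x m ∣ ≤⟨ ℚₚ.+-mono-≤ (go n≤′m) (∣term∣≤ x x≤K m) ⟩
        (expSum K m - expSum K n) + expTerm K m      ≡⟨ solve 3 (λ a b c → (a :- c) :+ b := (a :+ b) :- c) refl (expSum K m) (expTerm K m) (expSum K n) ⟩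
        (expSum K m + expTerm K m) - expSum K n      ∎
        where open ℚₚ.≤-Reasoning

    module Pair (x y : ℚ) (x≤K : ∣ x ∣ ≤ K) (y≤K : ∣ y ∣ ≤ K) where

      term-lipschitz : ∀ j → ∣ expTerm x (suc j) - expTerm y (suc j) ∣ ≤ ∣ x - y ∣ * expTerm K j
      term-lipschitz zero = ≤-reflexive (trans
        (cong ∣_∣ (solve 2 (λ x y → con 1ℚ :* (x :* con 1ℚ) :- con 1ℚ :* (y :* con 1ℚ) := x :- y) refl x y))
        (sym (ℚₚ.*-identityʳ ∣ x - y ∣)))
      term-lipschitz (suc j) = begin
        ∣ a * (x * r) - b * (y * r) ∣  ≡⟨ cong ∣_∣ (solve 5 (λ a b x y r → a :* (x :* r) :- b :* (y :* r) := (x :* a :- y :* b) :* r) refl a b x y r) ⟩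
        ∣ (x * a - y * b) * r ∣        ≡⟨ ∣x*1/suc∣ (x * a - y * b) (suc j) ⟩
        ∣ x * a - y * b ∣ * r          ≤⟨ *-monoʳ r (0≤1/suc (suc j)) num ⟩
        (K * (e * T) + e * A) * r      ≡⟨ solve 5 (λ k e t a r → (k :* (e :* t) :+ e :* a) :* r := (e :* (t :* k :+ a)) :* r) refl K e T A r ⟩
        (e * (T * K + A)) * r          ≡⟨ cong (λ z → (e * (z + A)) * r) TK ⟩
        (e * (A * w + A)) * r          ≡⟨ solve 4 (λ e a w r → (e :* (a :* w :+ a)) :* r := (e :* a) :* ((con 1ℚ :+ w) :* r)) refl e A w r ⟩
        (e * A) * ((1ℚ + w) * r)       ≡⟨ cong (λ z → (e * A) * (z * r)) (sym (fromℕℚ-suc (suc j))) ⟩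
        (e * A) * (fromℕℚ (suc (suc j)) * r) ≡⟨ cong ((e * A) *_) (suc*1/suc (suc j)) ⟩
        (e * A) * 1ℚ                   ≡⟨ ℚₚ.*-identityʳ (e * A) ⟩
        e * A                          ∎
        where
        a = expTerm x (suc j)
        b = expTerm y (suc j)
        A = expTerm K (suc j)
        T = expTerm K j
        r = 1/suc (suc j)
        r′ = 1/suc j
        w = fromℕℚ (suc j)
        e = ∣ x - y ∣
        TK : T * K ≡ A * w
        TK = sym (trans (solve 4 (λ t k r w → (t :* (k :* r)) :* w := (t :* k) :* (w :* r)) refl T K r′ w)
          (trans (cong ((T * K) *_) (suc*1/suc j)) (ℚₚ.*-identityʳ (T * K))))
        num : ∣ x * a - y * b ∣ ≤ K * (e * T) + e * A
        num = ≤-trans (≤-reflexive (cong ∣_∣ (solve 4 (λ x a y b → x :* a :- y :* b := y :* (a :- b) :+ (x :- y) :* a) refl x a y b)))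
          (≤-trans (ℚₚ.∣p+q∣≤∣p∣+∣q∣ (y * (a - b)) ((x - y) * a))
          (ℚₚ.+-mono-≤
            (≤-trans (≤-reflexive (ℚₚ.∣p*q∣≡∣p∣*∣q∣ y (a - b)))
              (*-mono (ℚₚ.0≤∣p∣ (a - b)) 0≤K y≤K (term-lipschitz j)))
            (≤-trans (≤-reflexive (ℚₚ.∣p*q∣≡∣p∣*∣q∣ (x - y) a))
              (*-monoˡ e (ℚₚ.0≤∣p∣ (x - y)) (∣term∣≤ x x≤K (suc j))))))
        open ℚₚ.≤-Reasoning

      sum-lipschitz′ : ∀ n → ∣ expSum x (suc n) - expSum y (suc n) ∣ ≤ ∣ x - y ∣ * expSum K n
      sum-lipschitz′ zero    = ≤-reflexive (sym (ℚₚ.*-zeroʳ ∣ x - y ∣))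
      sum-lipschitz′ (suc n) = begin
        ∣ (a + t) - (b + u) ∣              ≡⟨ cong ∣_∣ (solve 4 (λ a t b u → (a :+ t) :- (b :+ u) := (a :- b) :+ (t :- u)) refl a t b u) ⟩
        ∣ (a - b) + (t - u) ∣              ≤⟨ ℚₚ.∣p+q∣≤∣p∣+∣q∣ (a - b) (t - u) ⟩
        ∣ a - b ∣ + ∣ t - u ∣              ≤⟨ ℚₚ.+-mono-≤ (sum-lipschitz′ n) (term-lipschitz n) ⟩
        e * expSum K n + e * expTerm K n   ≡⟨ ℚₚ.*-distribˡ-+ e (expSum K n) (expTerm K n) ⟨
        e * (expSum K n + expTerm K n)     ∎
        where
        a = expSum x (suc n)
        b = expSum y (suc n)
        t = expTerm x (suc n)
        u = expTerm y (suc n)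
        e = ∣ x - y ∣
        open ℚₚ.≤-Reasoning

      sum-lipschitz : ∀ n → ∣ expSum x n - expSum y n ∣ ≤ ∣ x - y ∣ * expSum K n
      sum-lipschitz zero    = ≤-reflexive (sym (ℚₚ.*-zeroʳ ∣ x - y ∣))
      sum-lipschitz (suc n) = ≤-trans (sum-lipschitz′ n)
        (*-monoˡ ∣ x - y ∣ (ℚₚ.0≤∣p∣ (x - y)) (sum-mono (ℕₚ.n≤1+n n)))

    module Tail (J : ℕ) (1≤J : 1 ℕ.≤ J) (K+K≤J : K + K ≤ fromℕℚ J) where

      K/suc≤½ : ∀ j → J ℕ.≤ j → K * 1/suc j ≤ ½
      K/suc≤½ j J≤j = begin
        K * r                    ≡⟨ solve 2 (λ k r → k :* r := con ½ :* ((k :+ k) :* r)) refl K r ⟩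
        ½ * ((K + K) * r)        ≤⟨ *-monoˡ ½ (<⇒≤ 0<½) (*-monoʳ r (0≤1/suc j) (≤-trans K+K≤J (fromℕℚ-mono (ℕₚ.m≤n⇒m≤1+n J≤j)))) ⟩
        ½ * (fromℕℚ (suc j) * r) ≡⟨ cong (½ *_) (suc*1/suc j) ⟩
        ½ * 1ℚ                   ≡⟨ ℚₚ.*-identityʳ ½ ⟩
        ½                        ∎
        where
        r = 1/suc j
        open ℚₚ.≤-Reasoning

      term-halves : ∀ j → J ℕ.≤ j → expTerm K (suc j) ≤ ½ * expTerm K j
      term-halves j J≤j = subst (expTerm K (suc j) ≤_) (ℚₚ.*-comm (expTerm K j) ½)
        (*-monoˡ (expTerm K j) (0≤term j) (K/suc≤½ j J≤j))

      upper : ℕ → ℚ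
      upper n = expSum K n + (expTerm K n + expTerm K n)

      upper-decreasing : ∀ n → J ℕ.≤ n → upper (suc n) ≤ upper n
      upper-decreasing n J≤n = begin
        (S + T) + (T′ + T′)          ≤⟨ ℚₚ.+-monoʳ-≤ (S + T) (ℚₚ.+-mono-≤ (term-halves n J≤n) (term-halves n J≤n)) ⟩
        (S + T) + (½ * T + ½ * T)    ≡⟨ solve 2 (λ s t → (s :+ t) :+ (con ½ :* t :+ con ½ :* t) := s :+ (t :+ t)) refl S T ⟩
        S + (T + T)                  ∎
        where
        S = expSum K n
        T = expTerm K n
        T′ = expTerm K (suc n)
        open ℚₚ.≤-Reasoning

      sum≤upper : ∀ n → expSum K n ≤ upper n
      sum≤upper n = p≤p+q (0≤+ (0≤term n) (0≤term n))

      sum≤B : ∀ n → J ℕ.≤ n → expSum K n ≤ upper J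
      sum≤B n J≤n = ≤-trans (sum≤upper n) (decreasing upper upper-decreasing ℕₚ.≤-refl J≤n)

      tail≤ : ∀ {n m} → J ℕ.≤ n → n ℕ.≤ m → expSum K m - expSum K n ≤ expTerm K n + expTerm K n
      tail≤ {n} {m} J≤n n≤m = p≤q+r⇒p-q≤r
        (≤-trans (sum≤upper m) (decreasing upper upper-decreasing J≤n n≤m))

      weighted : ℕ → ℚ
      weighted n = expTerm K n * fromℕℚ n

      weighted-decreasing : ∀ n → J ℕ.≤ n → weighted (suc n) ≤ weighted n
      weighted-decreasing n J≤n = begin
        expTerm K (suc n) * fromℕℚ (suc n)  ≤⟨ *-monoʳ (fromℕℚ (suc n)) (0≤fromℕℚ (suc n)) (term-halves n J≤n) ⟩
        ½ * T * fromℕℚ (suc n)              ≡⟨ cong (½ * T *_) (fromℕℚ-suc n) ⟩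
        ½ * T * (1ℚ + w)                    ≤⟨ *-monoˡ (½ * T) (0≤* (<⇒≤ 0<½) (0≤term n)) (ℚₚ.+-monoˡ-≤ w (fromℕℚ-mono (ℕₚ.≤-trans 1≤J J≤n))) ⟩
        ½ * T * (w + w)                     ≡⟨ solve 2 (λ t w → con ½ :* t :* (w :+ w) := t :* w) refl T w ⟩
        T * w                               ∎
        where
        T = expTerm K n
        w = fromℕℚ n
        open ℚₚ.≤-Reasoning

      term-small : ∀ δ → 0ℚ < δ → ∃[ N ] ∀ n → N ℕ.≤ n → expTerm K n ≤ δ
      term-small δ 0<δ =
        let N , h = archimedean⁻¹ (weighted J) δ 0<δ
        in J ℕ.⊔ suc N , λ n N≤n →
             small N h n (ℕₚ.m⊔n≤o⇒m≤o J (suc N) N≤n) (ℕₚ.m⊔n≤o⇒n≤o J (suc N) N≤n)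
        where
        small : ∀ N → weighted J ≤ fromℕℚ (suc N) * δ → ∀ n → J ℕ.≤ n → suc N ℕ.≤ n → expTerm K n ≤ δ
        small N h n@(suc n′) J≤n N<n =
          *-cancelʳ (fromℕℚ n) (0<fromℕℚ-suc n′) (begin
            expTerm K n * fromℕℚ n  ≤⟨ decreasing weighted weighted-decreasing ℕₚ.≤-refl J≤n ⟩
            weighted J              ≤⟨ h ⟩
            fromℕℚ (suc N) * δ      ≤⟨ *-monoʳ δ (<⇒≤ 0<δ) (fromℕℚ-mono N<n) ⟩
            fromℕℚ n * δ            ≡⟨ ℚₚ.*-comm (fromℕℚ n) δ ⟩
            δ * fromℕℚ n            ∎)
          where open ℚₚ.≤-Reasoning

  module Diagonal (s : ℕ → ℚ) (c : IsCauchy s) (k N₀ : ℕ)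
    (s≤K : ∀ n → N₀ ℕ.≤ n → ∣ s n ∣ ≤ fromℕℚ k) where

    open Bounded (fromℕℚ k) (0≤fromℕℚ k)

    J : ℕ
    J = suc (k ℕ.+ k)

    open Tail J (ℕ.s≤s ℕ.z≤n)
      (≤-trans (≤-reflexive (sym (fromℕℚ-+ k k))) (fromℕℚ-mono (ℕₚ.n≤1+n (k ℕ.+ k))))

    close : ∀ {ε δ} → 0ℚ < δ → upper J * δ ≤ ½ * ε → ∀ {n m} → n ℕ.≤ m → N₀ ℕ.≤ n → J ℕ.≤ n →
      expTerm (fromℕℚ k) n ≤ ½ * (½ * ε) → ∣ s m - s n ∣ ≤ δ →
      ∣ expSum (s m) m - expSum (s n) n ∣ ≤ ε
    close {ε} {δ} 0<δ Bδ≤ε/2 {n} {m} n≤m N₀≤n J≤n small s≤δ = begin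
      ∣ expSum (s m) m - expSum (s n) n ∣
        ≤⟨ triangle (expSum (s m) m) (expSum (s m) n) (expSum (s n) n) ⟩
      ∣ expSum (s m) m - expSum (s m) n ∣ + ∣ expSum (s m) n - expSum (s n) n ∣
        ≤⟨ ℚₚ.+-mono-≤ tail lip ⟩
      ½ * ε + ½ * ε
        ≡⟨ half+half ε ⟩
      ε ∎
      where
      open ℚₚ.≤-Reasoning
      sm≤K : ∣ s m ∣ ≤ fromℕℚ k
      sm≤K = s≤K m (ℕₚ.≤-trans N₀≤n n≤m)
      tail : ∣ expSum (s m) m - expSum (s m) n ∣ ≤ ½ * ε
      tail = ≤-trans (∣sum-sum∣≤ (s m) sm≤K n≤m) (≤-trans (tail≤ J≤n n≤m)
        (≤-trans (ℚₚ.+-mono-≤ small small) (≤-reflexive (half+half (½ * ε)))))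
      lip : ∣ expSum (s m) n - expSum (s n) n ∣ ≤ ½ * ε
      lip = ≤-trans (Pair.sum-lipschitz (s m) (s n) sm≤K (s≤K n N₀≤n) n)
        (≤-trans (*-mono (0≤sum n) (<⇒≤ 0<δ) s≤δ (sum≤B n J≤n))
          (≤-trans (≤-reflexive (ℚₚ.*-comm δ (upper J))) Bδ≤ε/2))

    main : ∀ ε → 0ℚ < ε → ∃[ N ] ∀ n m → N ℕ.≤ n → n ℕ.≤ m →
      ∣ expSum (s m) m - expSum (s n) n ∣ ≤ ε
    main ε 0<ε =
      let δ , 0<δ , Bδ≤ε/2 = scale (upper J) (½ * ε) (≤-trans (0≤sum J) (sum≤upper J)) (0<half 0<ε)
          N₁ , small = term-small (½ * (½ * ε)) (0<half (0<half 0<ε))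
          N₂ , f = c δ 0<δ
          P = N₀ ℕ.⊔ N₁
          Q = N₂ ℕ.⊔ J
      in P ℕ.⊔ Q , λ n m N≤n n≤m →
        let P≤n = ℕₚ.m⊔n≤o⇒m≤o P Q N≤n
            Q≤n = ℕₚ.m⊔n≤o⇒n≤o P Q N≤n
            N₂≤n = ℕₚ.m⊔n≤o⇒m≤o N₂ J Q≤n
        in close 0<δ Bδ≤ε/2 n≤m (ℕₚ.m⊔n≤o⇒m≤o N₀ N₁ P≤n) (ℕₚ.m⊔n≤o⇒n≤o N₂ J Q≤n)
             (small n (ℕₚ.m⊔n≤o⇒n≤o N₀ N₁ P≤n)) (f m n (ℕₚ.≤-trans N₂≤n n≤m) N₂≤n)

  exp-cauchy : ∀ s → IsCauchy s → IsCauchy (λ n → expSum (s n) n)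
  exp-cauchy s c =
    let k , N₀ , s≤K = cauchy-bounded s c
    in cauchy-from-ordered (λ n → expSum (s n) n) (Diagonal.main s c k N₀ s≤K)

-- Σ_{a < l ≤ a + d} 1/l
harmonic : ℕ → ℕ → ℚ
harmonic a zero    = 0ℚ
harmonic a (suc d) = harmonic a d ℚ.+ 1/suc (a ℕ.+ d)

-- The right Riemann sum with step 1/(n+1) of ∫ dt/t over [1, i′+1]:
-- Σ_{n+1 < l ≤ (i′+1)(n+1)} 1/l.
lnSum : ℕ → ℕ → ℚ
lnSum i′ n = harmonic (suc n) (i′ ℕ.* suc n)

module LnLemmas where
  open import Data.Rational using (_+_; _*_; _-_; -_; ∣_∣; _≤_; _<_)
  open ℚₚ using (≤-trans; ≤-refl; ≤-reflexive; <⇒≤)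
  open RationalLemmas
  open ExpLemmas using (0≤1/suc)
  open +-*-Solver

  harmonic-shift : ∀ a d → harmonic a (suc d) ≡ 1/suc a + harmonic (suc a) d
  harmonic-shift a zero = trans (ℚₚ.+-comm 0ℚ (1/suc (a ℕ.+ 0)))
    (cong (λ z → 1/suc z + 0ℚ) (ℕₚ.+-identityʳ a))
  harmonic-shift a (suc d) = trans (cong₂ _+_ (harmonic-shift a d) (cong 1/suc (ℕₚ.+-suc a d)))
    (ℚₚ.+-assoc (1/suc a) (harmonic (suc a) d) (1/suc (suc a ℕ.+ d)))

  harmonic-++ : ∀ a d e → harmonic a (d ℕ.+ e) ≡ harmonic a d + harmonic (a ℕ.+ d) e
  harmonic-++ a d zero = trans (cong (harmonic a) (ℕₚ.+-identityʳ d))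
    (sym (ℚₚ.+-identityʳ (harmonic a d)))
  harmonic-++ a d (suc e) = trans (cong (harmonic a) (ℕₚ.+-suc d e))
    (trans (cong₂ _+_ (harmonic-++ a d e) (cong 1/suc (sym (ℕₚ.+-assoc a d e))))
      (ℚₚ.+-assoc (harmonic a d) (harmonic (a ℕ.+ d) e) (1/suc (a ℕ.+ d ℕ.+ e))))

  0≤harmonic : ∀ a d → 0ℚ ≤ harmonic a d
  0≤harmonic a zero    = ≤-refl
  0≤harmonic a (suc d) = 0≤+ (0≤harmonic a d) (0≤1/suc (a ℕ.+ d))

  harmonic-upper : ∀ a d → harmonic a d * fromℕℚ a ≤ fromℕℚ d
  harmonic-upper a zero    = ≤-reflexive (ℚₚ.*-zeroˡ (fromℕℚ a))
  harmonic-upper a (suc d) = begin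
    (h + r) * w           ≡⟨ ℚₚ.*-distribʳ-+ w h r ⟩
    h * w + r * w         ≤⟨ ℚₚ.+-mono-≤ (harmonic-upper a d) (*-monoˡ r (0≤1/suc (a ℕ.+ d)) (fromℕℚ-mono (ℕₚ.m≤n⇒m≤1+n (ℕₚ.m≤m+n a d)))) ⟩
    fromℕℚ d + r * fromℕℚ (suc (a ℕ.+ d)) ≡⟨ cong (λ z → fromℕℚ d + z) (trans (ℚₚ.*-comm r (fromℕℚ (suc (a ℕ.+ d)))) (suc*1/suc (a ℕ.+ d))) ⟩
    fromℕℚ d + 1ℚ         ≡⟨ ℚₚ.+-comm (fromℕℚ d) 1ℚ ⟩
    1ℚ + fromℕℚ d         ≡⟨ fromℕℚ-suc d ⟨
    fromℕℚ (suc d)        ∎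
    where
    h = harmonic a d
    r = 1/suc (a ℕ.+ d)
    w = fromℕℚ a
    open ℚₚ.≤-Reasoning

  harmonic-lower : ∀ a d → fromℕℚ d ≤ harmonic a d * fromℕℚ (a ℕ.+ d)
  harmonic-lower a zero    = ≤-reflexive (sym (ℚₚ.*-zeroˡ (fromℕℚ (a ℕ.+ 0))))
  harmonic-lower a (suc d) = begin
    fromℕℚ (suc d)        ≡⟨ fromℕℚ-suc d ⟩
    1ℚ + fromℕℚ d         ≡⟨ ℚₚ.+-comm 1ℚ (fromℕℚ d) ⟩
    fromℕℚ d + 1ℚ         ≤⟨ ℚₚ.+-monoˡ-≤ 1ℚ (≤-trans (harmonic-lower a d) (*-monoˡ h (0≤harmonic a d) (fromℕℚ-mono (ℕₚ.n≤1+n (a ℕ.+ d))))) ⟩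
    h * w + 1ℚ            ≡⟨ cong (λ z → h * w + z) (trans (ℚₚ.*-comm r w) (suc*1/suc (a ℕ.+ d))) ⟨
    h * w + r * w         ≡⟨ ℚₚ.*-distribʳ-+ w h r ⟨
    (h + r) * w           ≡⟨ cong (λ z → (h + r) * fromℕℚ z) (ℕₚ.+-suc a d) ⟨
    (h + r) * fromℕℚ (a ℕ.+ suc d) ∎
    where
    h = harmonic a d
    r = 1/suc (a ℕ.+ d)
    w = fromℕℚ (suc (a ℕ.+ d))
    open ℚₚ.≤-Reasoning

  module Step (i′ n : ℕ) where
    N = suc n
    i = suc i′
    U = harmonic (i ℕ.* N) i

    step : 1/suc N + lnSum i′ (suc n) ≡ lnSum i′ n + U
    step = trans (sym (harmonic-shift N (i′ ℕ.* suc N)))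
      (trans (cong (harmonic N) eq) (harmonic-++ N (i′ ℕ.* N) i))
      where
      eq : suc (i′ ℕ.* suc N) ≡ i′ ℕ.* N ℕ.+ i
      eq = trans (cong suc (trans (ℕₚ.*-suc i′ N) (ℕₚ.+-comm i′ (i′ ℕ.* N))))
        (sym (ℕₚ.+-suc (i′ ℕ.* N) i′))

    cancel : ∀ {p q} → fromℕℚ i * p ≤ fromℕℚ i * q → p ≤ q
    cancel = *-cancelˡ (fromℕℚ i) (0<fromℕℚ-suc i′)

    U≤ : U ≤ 1/suc n
    U≤ = *-cancelˡ (fromℕℚ N) (0<fromℕℚ-suc n) (cancel (begin
      fromℕℚ i * (fromℕℚ N * U)   ≡⟨ solve 3 (λ a b u → a :* (b :* u) := u :* (a :* b)) refl (fromℕℚ i) (fromℕℚ N) U ⟩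
      U * (fromℕℚ i * fromℕℚ N)   ≡⟨ cong (U *_) (fromℕℚ-* i N) ⟨
      U * fromℕℚ (i ℕ.* N)        ≤⟨ harmonic-upper (i ℕ.* N) i ⟩
      fromℕℚ i                    ≡⟨ ℚₚ.*-identityʳ (fromℕℚ i) ⟨
      fromℕℚ i * 1ℚ               ≡⟨ cong (fromℕℚ i *_) (suc*1/suc n) ⟨
      fromℕℚ i * (fromℕℚ N * 1/suc n) ∎))
      where open ℚₚ.≤-Reasoning

    ≤U : 1/suc N ≤ U
    ≤U = *-cancelˡ (fromℕℚ (suc N)) (0<fromℕℚ-suc N) (cancel (begin
      fromℕℚ i * (fromℕℚ (suc N) * 1/suc N) ≡⟨ cong (fromℕℚ i *_) (suc*1/suc N) ⟩
      fromℕℚ i * 1ℚ                   ≡⟨ ℚₚ.*-identityʳ (fromℕℚ i) ⟩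
      fromℕℚ i                        ≤⟨ harmonic-lower (i ℕ.* N) i ⟩
      U * fromℕℚ (i ℕ.* N ℕ.+ i)      ≡⟨ cong (λ z → U * fromℕℚ z) (trans (ℕₚ.+-comm (i ℕ.* N) i) (sym (ℕₚ.*-suc i N))) ⟩
      U * fromℕℚ (i ℕ.* suc N)        ≡⟨ cong (U *_) (fromℕℚ-* i (suc N)) ⟩
      U * (fromℕℚ i * fromℕℚ (suc N)) ≡⟨ solve 3 (λ a b u → u :* (a :* b) := a :* (b :* u)) refl (fromℕℚ i) (fromℕℚ (suc N)) U ⟩
      fromℕℚ i * (fromℕℚ (suc N) * U) ∎))
      where open ℚₚ.≤-Reasoning

    lnSum-mono : lnSum i′ n ≤ lnSum i′ (suc n)
    lnSum-mono = subst₂ _≤_ (solve 2 (λ r s → (r :+ s) :- r := s) refl (1/suc N) (lnSum i′ n))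
      (solve 2 (λ r s → (r :+ s) :- r := s) refl (1/suc N) (lnSum i′ (suc n)))
      (ℚₚ.+-monoˡ-≤ (- 1/suc N) (begin
        1/suc N + lnSum i′ n          ≡⟨ ℚₚ.+-comm (1/suc N) (lnSum i′ n) ⟩
        lnSum i′ n + 1/suc N          ≤⟨ ℚₚ.+-monoʳ-≤ (lnSum i′ n) ≤U ⟩
        lnSum i′ n + U                ≡⟨ step ⟨
        1/suc N + lnSum i′ (suc n)    ∎))
      where open ℚₚ.≤-Reasoning

    upper-mono : 1/suc N + lnSum i′ (suc n) ≤ 1/suc n + lnSum i′ n
    upper-mono = begin
      1/suc N + lnSum i′ (suc n)    ≡⟨ step ⟩
      lnSum i′ n + U                ≤⟨ ℚₚ.+-monoʳ-≤ (lnSum i′ n) U≤ ⟩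
      lnSum i′ n + 1/suc n          ≡⟨ ℚₚ.+-comm (lnSum i′ n) (1/suc n) ⟩
      1/suc n + lnSum i′ n          ∎
      where open ℚₚ.≤-Reasoning

  1/suc-small : ∀ {ε N n} → 0ℚ < ε → 1ℚ ≤ fromℕℚ (suc N) * ε → N ℕ.≤ n → 1/suc n ≤ ε
  1/suc-small {ε} {N} {n} 0<ε h N≤n =
    *-cancelˡ (fromℕℚ (suc n)) (0<fromℕℚ-suc n) (begin
      fromℕℚ (suc n) * 1/suc n ≡⟨ suc*1/suc n ⟩
      1ℚ                       ≤⟨ h ⟩
      fromℕℚ (suc N) * ε       ≤⟨ *-monoʳ ε (<⇒≤ 0<ε) (fromℕℚ-mono (ℕ.s≤s N≤n)) ⟩
      fromℕℚ (suc n) * ε       ∎)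
    where open ℚₚ.≤-Reasoning

  ln-cauchy : ∀ i′ → IsCauchy (lnSum i′)
  ln-cauchy i′ = cauchy-from-ordered (lnSum i′) main
    where
    result : ∀ {ε N} → 0ℚ < ε → 1ℚ ≤ fromℕℚ (suc N) * ε →
      ∀ n m → N ℕ.≤ n → n ℕ.≤ m → ∣ lnSum i′ m - lnSum i′ n ∣ ≤ ε
    result {ε} 0<ε h n m N≤n n≤m = begin
      ∣ lnSum i′ m - lnSum i′ n ∣  ≡⟨ ℚₚ.0≤p⇒∣p∣≡p (p≤q⇒0≤q-p
                                        (increasing (lnSum i′) {0} (λ k _ → Step.lnSum-mono i′ k) ℕ.z≤n n≤m)) ⟩
      lnSum i′ m - lnSum i′ n      ≤⟨ p≤q+r⇒p-q≤r (begin
        lnSum i′ m                   ≤⟨ p≤p+q (0≤1/suc m) ⟩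
        lnSum i′ m + 1/suc m         ≡⟨ ℚₚ.+-comm (lnSum i′ m) (1/suc m) ⟩
        1/suc m + lnSum i′ m         ≤⟨ decreasing (λ k → 1/suc k + lnSum i′ k) {0} (λ k _ → Step.upper-mono i′ k) ℕ.z≤n n≤m ⟩
        1/suc n + lnSum i′ n         ≡⟨ ℚₚ.+-comm (1/suc n) (lnSum i′ n) ⟩
        lnSum i′ n + 1/suc n         ∎) ⟩
      1/suc n                      ≤⟨ 1/suc-small 0<ε h N≤n ⟩
      ε                            ∎
      where open ℚₚ.≤-Reasoning

    main : ∀ ε → 0ℚ < ε → ∃[ N ] ∀ n m → N ℕ.≤ n → n ℕ.≤ m → ∣ lnSum i′ m - lnSum i′ n ∣ ≤ ε
    main ε 0<ε =
      let N , h = archimedean⁻¹ 1ℚ ε 0<ε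
      in N , result 0<ε h

record ℝ : Set where
  constructor mkℝ
  field
    seq    : ℕ → ℚ
    cauchy : IsCauchy seq

open ℝ public

infix  4 _≈_ _<_ _≤_ _≡_[mod_] _≡?_[mod_]
infixl 6 _+_ _-_
infixl 7 _*_ _/_⟨_⟩
infix  8 -_
infixr 8 _^_ _**_

_≈_ : ℝ → ℝ → Set
x ≈ y = ∀ ε → 0ℚ ℚ.< ε → ∃[ N ] ∀ n → N ℕ.≤ n → ℚ.∣ seq x n ℚ.- seq y n ∣ ℚ.≤ ε

_<_ : ℝ → ℝ → Set
x < y = ∃[ η ] (0ℚ ℚ.< η × (∃[ N ] ∀ n → N ℕ.≤ n → seq x n ℚ.+ η ℚ.≤ seq y n))

_≤_ : ℝ → ℝ → Set
x ≤ y = ∀ ε → 0ℚ ℚ.< ε → ∃[ N ] ∀ n → N ℕ.≤ n → seq x n ℚ.≤ seq y n ℚ.+ ε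

fromℚ : ℚ → ℝ
fromℚ p = mkℝ (λ _ → p) (RationalLemmas.const-cauchy p)

fromℕ : ℕ → ℝ
fromℕ n = fromℚ (fromℕℚ n)

0ℝ 1ℝ : ℝ
0ℝ = fromℕ 0
1ℝ = fromℕ 1

_+_ : ℝ → ℝ → ℝ
x + y = mkℝ (λ n → seq x n ℚ.+ seq y n) (RationalLemmas.+-cauchy (seq x) (seq y) (cauchy x) (cauchy y))

-_ : ℝ → ℝ
- x = mkℝ (λ n → ℚ.- seq x n) (RationalLemmas.neg-cauchy (seq x) (cauchy x))

_-_ : ℝ → ℝ → ℝ
x - y = x + - y

_*_ : ℝ → ℝ → ℝ
x * y = mkℝ (λ n → seq x n ℚ.* seq y n) (RationalLemmas.*-cauchy (seq x) (seq y) (cauchy x) (cauchy y))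

∣_∣ : ℝ → ℝ
∣ x ∣ = mkℝ (λ n → ℚ.∣ seq x n ∣) (RationalLemmas.abs-cauchy (seq x) (cauchy x))

-- Positivity of x supplies η > 0 with η ≤ seq x n eventually; the reciprocal is the
-- sequence 1 / max(η, seq x n), which eventually is 1 / seq x n.
recip : (x : ℝ) → 0ℝ < x → ℝ
recip x (η , 0<η , N , h) = mkℝ (λ n → clampedInverse η 0<η (seq x n))
  (inverse-cauchy (seq x) (cauchy x) η 0<η N
    (λ n N≤n → subst (ℚ._≤ seq x n) (ℚₚ.+-identityˡ η) (h n N≤n)))
  where open RationalLemmas

_/_⟨_⟩ : (x y : ℝ) → 0ℝ < y → ℝ
x / y ⟨ 0<y ⟩ = x * recip y 0<y

_**_ : ℝ → ℕ → ℝ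
x ** zero  = 1ℝ
x ** suc n = x * x ** n

**-pos : ∀ x → 0ℝ < x → ∀ n → 0ℝ < x ** n
**-pos x 0<x zero = 1ℚ , ℚₚ.positive⁻¹ 1ℚ , 0 , λ _ _ → ℚₚ.≤-refl
**-pos x (η , 0<η , N , h) (suc n) with **-pos x (η , 0<η , N , h) n
... | θ , 0<θ , M , k = η ℚ.* θ , 0<* 0<η 0<θ , N ℕ.⊔ M , λ m N≤m →
  subst (ℚ._≤ seq x m ℚ.* seq (x ** n) m) (sym (ℚₚ.+-identityˡ (η ℚ.* θ)))
    (*-mono (ℚₚ.<⇒≤ 0<θ) (ℚₚ.≤-trans (ℚₚ.<⇒≤ 0<η) (η≤ m (ℕₚ.m⊔n≤o⇒m≤o N M N≤m)))
      (η≤ m (ℕₚ.m⊔n≤o⇒m≤o N M N≤m))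
      (subst (ℚ._≤ seq (x ** n) m) (ℚₚ.+-identityˡ θ) (k m (ℕₚ.m⊔n≤o⇒n≤o N M N≤m))))
  where
  open RationalLemmas
  η≤ : ∀ m → N ℕ.≤ m → η ℚ.≤ seq x m
  η≤ m N≤m = subst (ℚ._≤ seq x m) (ℚₚ.+-identityˡ η) (h m N≤m)

-- The power series, evaluated diagonally: the n-th approximant is Σ_{j < n} (seq x n)^j / j!.
exp : ℝ → ℝ
exp x = mkℝ (λ n → expSum (seq x n) n) (ExpLemmas.exp-cauchy (seq x) (cauchy x))

-- ln i = ∫₁ⁱ dt/t for integers i ≥ 1.
ln : (i : ℕ) → .{{ℕ.NonZero i}} → ℝ
ln (suc i′) = mkℝ (lnSum i′) (LnLemmas.ln-cauchy i′)

-- Real powers of positive integers.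
_^_ : (i : ℕ) → .{{ℕ.NonZero i}} → ℝ → ℝ
i ^ k = exp (k * ln i)

_≡_[mod_] : ℤ → ℤ → ℕ → Set
a ≡ b [mod q ] = + q ℤ∣.∣ a ℤ.- b

_≡?_[mod_] : ∀ a b q → Dec (a ≡ b [mod q ])
a ≡? b [mod q ] = + q ℤ∣.∣? a ℤ.- b

-- Σ i^k over 1 ≤ i ≤ m-1 with i ≡ b mod q; the index is i = suc j, 0 ≤ j < m-1.
powerSum : (q : ℕ) (b : ℤ) (m : ℕ) → ℝ → ℝ
powerSum q b m k =
  foldr _+_ 0ℝ (map (λ j → suc j ^ k) (filter (λ j → + suc j ≡? b [mod q ]) (upTo (m ℕ.∸ 1))))

module Coefficients (q r : ℕ) (c₁ : ℝ) where

  e^-c₁q e^-c₁r : ℝ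
  e^-c₁q = exp (- (c₁ * fromℕ q))
  e^-c₁r = exp (- (c₁ * fromℕ r))

  D : ℝ
  D = 1ℝ - e^-c₁q

  numerator : 0ℝ < D → ℝ
  numerator 0<D =
      fromℕ (r ℕ.^ 2) / D ⟨ 0<D ⟩
    + fromℕ (2 ℕ.* r ℕ.* q) * e^-c₁q / D ** 2 ⟨ **-pos D 0<D 2 ⟩
    + fromℕ (q ℕ.^ 2) * e^-c₁q * (1ℝ + e^-c₁q) / D ** 3 ⟨ **-pos D 0<D 3 ⟩

  denominator : 0ℝ < D → ℝ
  denominator 0<D =
      fromℕ r / D ⟨ 0<D ⟩
    + fromℕ q * e^-c₁q / D ** 2 ⟨ **-pos D 0<D 2 ⟩

  -- Division needs a positive divisor, so c₂ takes the positivity of 1 - e^{-c₁q} and of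
  -- its own denominator as arguments.
  c₂ : (0<D : 0ℝ < D) → 0ℝ < denominator 0<D → ℝ
  c₂ 0<D 0<den = - (c₁ * fromℚ ½) * (numerator 0<D / denominator 0<D ⟨ 0<den ⟩)

{-# OPTIONS --safe #-}

-- Write t_j = r + q j, x = k / m, δ = c₁ - x, a_j = e^{-c₁ t_j} and w_j = (1 - t_j / m)^k. Then the
-- a_j have total mass 1 over all j ≥ 0, by the equation for c₁, and so have the w_j over t_j < m, by
-- the hypothesis on k. Let A_i and W_i be the i-th moments Σ a_j t_jⁱ and Σ w_j t_jⁱ over t_j < m.
-- Since h_j = - ln w_j equals x (t_j + t_j² / 2m) up to O(t_j⁴ / m²), the tangent inequality
-- e^y ≥ 1 + y gives
--   a_j ≥ w_j (1 + h_j - c₁ t_j),  whose sum is  δ W₁ ≥ (x / 2m) W₂,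
--   w_j ≥ a_j (1 + c₁ t_j - h_j),  whose sum is  δ A₁ ≤ (x / 2m) A₂ + O(1/m²).
-- Hence 0 ≤ δ = O(1/m), so that W_i = A_i + O(1/m), and both inequalities say that
-- δ A₁ = (c₁ / 2m) A₂ + O(1/m²). The full moments are the closed forms in the statement up to a
-- common factor, which is the formula for c₂. All constants are uniform because e^{-c₁ q} ≤ 1/2.
module Submission where

import Algebra.Solver.Ring
import Algebra.Solver.Ring.AlmostCommutativeRing as ACR
import Data.Integer.Divisibility.Signed as ℤ∣
import Data.Integer.Properties as ℤₚ
import Data.List.Properties as Listₚ
import Data.Nat.DivMod as ℕ/
import Data.Nat.Divisibility as ℕ∣
import Data.Nat.Properties as ℕₚ
import Data.Rational.Properties as ℚₚ
open import Algebra.Bundles using (CommutativeRing)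
open import Algebra.Structures using (IsCommutativeRing)
open import Data.Empty using (⊥-elim)
open import Data.Fin using (Fin; zero; suc; toℕ)
open import Data.Fin.Properties using (toℕ<n)
open import Data.Integer as ℤ using (ℤ; +_)
open import Data.Integer.Solver renaming (module +-*-Solver to +-*-ℤSolver)
open import Data.List as List using ([]; _∷_; _∷ʳ_; foldr; filter; upTo)
open import Data.Maybe using (map)
open import Data.Nat as ℕ using (ℕ; zero; suc; s≤s; z≤n)
open import Data.Nat.Solver renaming (module +-*-Solver to +-*-ℕSolver)
open import Data.Product using (Σ-syntax; ∃-syntax; _×_; _,_)
open import Data.Rational as ℚ using (ℚ; 0ℚ; 1ℚ; ½)
open import Data.Rational.Solver using (module +-*-Solver)
open import Data.Sum using (_⊎_; inj₁; inj₂)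
open import Defs using (fromℕℚ; module RationalLemmas)
open import Level using (0ℓ)
open import Relation.Binary.Definitions using (WeaklyDecidable)
open import Relation.Binary.PropositionalEquality as ≡ using (_≡_)
open import Relation.Binary.Structures using (IsEquivalence)
open import Relation.Nullary using (¬_; Dec)
open import Relation.Nullary.Decidable using (True; dec⇒maybe; toWitness)

-- The order of constructive reals is undecidable and division needs a witness of positivity.
-- Inequalities are therefore mostly certified by polynomial identities: the difference of the two
-- sides is written as a sum of products of quantities known to be non-negative, and factors such as
-- `2 D`, `W₁` or `T₁` are divided out only after being bounded below by 1. The estimate runs over
-- an abstract ordered algebra whose exponential offers little more than the functional equation and
-- `1 + x ≤ exp x`; the Cauchy reals are fitted in afterwards. The order of the two tangent
-- inequalities matters: the first yields `x ≤ c ≤ 1`, which the second needs for an error that is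
-- independent of `k`. Cutting the moments off at `m` is harmless because the geometric decay beats
-- every power of `m`. Logarithms enter only through differences `ln m - ln (m - t)`, which are
-- limits of harmonic sums, so finite geometric sums replace Taylor expansion.

-- Inequalities in an ordered ℚ-algebra

record OrderedℚAlgebra : Set₁ where
  infix  4 _≈_ _≤_
  infixl 6 _+_
  infixl 7 _*_
  infix  8 -_
  field
    Carrier : Set
    _≈_ _≤_ : Carrier → Carrier → Set
    _+_ _*_ : Carrier → Carrier → Carrier
    -_      : Carrier → Carrier
    ι       : ℚ → Carrier
    isCommutativeRing : IsCommutativeRing _≈_ _+_ _*_ -_ (ι 0ℚ) (ι 1ℚ)
    ι-+    : ∀ p q → ι (p ℚ.+ q) ≈ ι p + ι q
    ι-*    : ∀ p q → ι (p ℚ.* q) ≈ ι p * ι q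
    ι-neg  : ∀ p → ι (ℚ.- p) ≈ - ι p
    ι-mono : ∀ {p q} → p ℚ.≤ q → ι p ≤ ι q
    ≤-reflexive : ∀ {x y} → x ≈ y → x ≤ y
    ≤-trans     : ∀ {x y z} → x ≤ y → y ≤ z → x ≤ z
    +-mono      : ∀ {x y u v} → x ≤ y → u ≤ v → x + u ≤ y + v
    0≤*         : ∀ {x y} → ι 0ℚ ≤ x → ι 0ℚ ≤ y → ι 0ℚ ≤ x * y
    -- Takes the place of division by `y`. The sign of `x` cannot be decided; `0 ≤ z` is what covers
    -- a negative `x`.
    *≤⇒≤        : ∀ {x y z} → ι 1ℚ ≤ y → ι 0ℚ ≤ z → x * y ≤ z → x ≤ z

  infixl 6 _-_
  _-_ : Carrier → Carrier → Carrier
  x - y = x + - y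

module OrderedProperties (A : OrderedℚAlgebra) where
  open OrderedℚAlgebra A public

  commutativeRing : CommutativeRing 0ℓ 0ℓ
  commutativeRing = record { isCommutativeRing = isCommutativeRing }

  open CommutativeRing commutativeRing public
    using (refl; sym; trans; +-cong; +-congˡ; +-congʳ; *-cong; *-congˡ; *-congʳ; -‿cong; +-comm; *-comm;
      semiring
      ; +-identityˡ; +-identityʳ; *-identityˡ; *-identityʳ; zeroˡ)

  ring = ACR.fromCommutativeRing commutativeRing

  ιHom : ℚₚ.+-*-rawRing ACR.-Raw-AlmostCommutative⟶ ring
  ιHom = record
    { ⟦_⟧ = ι ; +-homo = ι-+ ; *-homo = ι-* ; -‿homo = ι-neg ; 0-homo = refl ; 1-homo = refl }

  -- Equality in the carrier is not decidable for the reals, but the solver only has to compare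
  -- coefficients, and these are rational.
  ι-≟ : WeaklyDecidable (ACR.Induced-equivalence ιHom)
  ι-≟ p q = map (λ eq → CommutativeRing.reflexive commutativeRing (≡.cong ι eq)) (dec⇒maybe (p ℚₚ.≟ q))

  module Solver = Algebra.Solver.Ring ℚₚ.+-*-rawRing ring ιHom ι-≟

  open Solver using (solve; con; _:+_; _:*_; _:-_; :-_; _:^_; _:=_)
  open import Algebra.Properties.Semiring.Exp semiring public using (_^_)
  open import Algebra.Properties.Semiring.Sum semiring public using
    (sum; sum-cong-≋; ∑-distrib-+; *-distribˡ-sum)

  0# 1# : Carrier
  0# = ι 0ℚ
  1# = ι 1ℚ

  ≤-refl : ∀ {x} → x ≤ x
  ≤-refl = ≤-reflexive refl

  -- The form of most estimates below: `d` is assembled from quantities known to be non-negative,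
  -- and the equation is left to the ring solver.
  ≤-by : ∀ {x y d} → 0# ≤ d → x + d ≈ y → x ≤ y
  ≤-by {x} 0≤d eq = ≤-trans (≤-trans (≤-reflexive (sym (+-identityʳ x))) (+-mono ≤-refl 0≤d))
    (≤-reflexive eq)

  0≤- : ∀ {x y} → x ≤ y → 0# ≤ y - x
  0≤- {x} {y} x≤y = ≤-trans (≤-reflexive (solve 1 (λ x → con 0ℚ := x :- x) refl x)) (+-mono x≤y ≤-refl)

  0≤-⁻¹ : ∀ {x y} → 0# ≤ y - x → x ≤ y
  0≤-⁻¹ {x} {y} h = ≤-by h (solve 2 (λ x y → x :+ (y :- x) := y) refl x y)

  0≤+ : ∀ {x y} → 0# ≤ x → 0# ≤ y → 0# ≤ x + y
  0≤+ h k = ≤-trans (≤-reflexive (sym (+-identityˡ 0#))) (+-mono h k)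

  neg-mono : ∀ {x y} → x ≤ y → - y ≤ - x
  neg-mono {x} {y} h = ≤-by (0≤- h) (solve 2 (λ x y → :- y :+ (y :- x) := :- x) refl x y)

  *-monoˡ : ∀ {x y} z → 0# ≤ z → x ≤ y → z * x ≤ z * y
  *-monoˡ {x} {y} z 0≤z h = ≤-by (0≤* 0≤z (0≤- h))
    (solve 3 (λ x y z → z :* x :+ z :* (y :- x) := z :* y) refl x y z)

  *-mono : ∀ {x y u v} → 0# ≤ x → 0# ≤ v → x ≤ y → u ≤ v → x * u ≤ y * v
  *-mono {x} {y} {u} {v} 0≤x 0≤v h k = ≤-trans (*-monoˡ x 0≤x k)
    (≤-by (0≤* 0≤v (0≤- h)) (solve 3 (λ x y v → x :* v :+ v :* (y :- x) := y :* v) refl x y v))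

  0≤1 : 0# ≤ 1#
  0≤1 = ι-mono (ℚₚ.<⇒≤ (ℚₚ.positive⁻¹ 1ℚ))

  0≤^ : ∀ {x} n → 0# ≤ x → 0# ≤ x ^ n
  0≤^ zero    h = 0≤1
  0≤^ (suc n) h = 0≤* h (0≤^ n h)

  ^-mono : ∀ {x y} n → 0# ≤ x → x ≤ y → x ^ n ≤ y ^ n
  ^-mono zero    0≤x h = ≤-refl
  ^-mono (suc n) 0≤x h = *-mono 0≤x (0≤^ n (≤-trans 0≤x h)) h (^-mono n 0≤x h)

  1≤* : ∀ {x y} → 1# ≤ x → 1# ≤ y → 1# ≤ x * y
  1≤* {x} {y} h k = ≤-trans (≤-reflexive (sym (*-identityˡ 1#)))
    (*-mono 0≤1 (≤-trans 0≤1 k) h k)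

  1≤^ : ∀ {x} n → 1# ≤ x → 1# ≤ x ^ n
  1≤^ zero    h = ≤-refl
  1≤^ (suc n) h = 1≤* h (1≤^ n h)

  ≤*ˡ : ∀ {x y} → 0# ≤ x → 1# ≤ y → x ≤ y * x
  ≤*ˡ {x} {y} 0≤x 1≤y = ≤-by (0≤* (0≤- 1≤y) 0≤x)
    (solve 2 (λ x y → x :+ (y :- con 1ℚ) :* x := y :* x) refl x y)

  ^-monoʳ : ∀ {x} {m n} → 1# ≤ x → m ℕ.≤ n → x ^ m ≤ x ^ n
  ^-monoʳ {n = n} h ℕ.z≤n = 1≤^ n h
  ^-monoʳ h (ℕ.s≤s m≤n) = *-monoˡ _ (≤-trans 0≤1 h) (^-monoʳ h m≤n)

  sum-mono : ∀ {n} {f g : Fin n → Carrier} → (∀ i → f i ≤ g i) → sum f ≤ sum g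
  sum-mono {zero}  h = ≤-refl
  sum-mono {suc n} h = +-mono (h zero) (sum-mono (λ i → h (suc i)))

  -- For e = e^x and f = e^{x/2}: (f - 1)² ≥ 0 gives e ≥ 2 f - 1, so passing from x/2 to x
  -- halves the coefficient of the quadratic error.
  quadratic-doubling : ∀ {e f x} η → e ≈ f * f → 0# ≤ (f - 1#) * (f - 1#) →
    1# + ι ½ * x - η * ((ι ½ * x) * (ι ½ * x)) ≤ f → 1# + x - (ι ½ * η) * (x * x) ≤ e
  quadratic-doubling {e} {f} {x} η e≈f² 0≤sq h = ≤-trans (≤-by (0≤+ (0≤+ (0≤- h) (0≤- h)) 0≤sq)
    (solve 3 (λ x f η → con 1ℚ :+ x :- (con ½ :* η) :* (x :* x) :+
      ((f :- (con 1ℚ :+ con ½ :* x :- η :* ((con ½ :* x) :* (con ½ :* x)))) :+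
         (f :- (con 1ℚ :+ con ½ :* x :- η :* ((con ½ :* x) :* (con ½ :* x)))) :+ (f :- con 1ℚ) :*
           (f :- con 1ℚ)) := f :* f) refl x f η))
    (≤-reflexive (sym e≈f²))

-- Finite sums and sums over an arithmetic progression

module Sums (A : OrderedℚAlgebra) where
  open OrderedProperties A
  open Solver using (solve; con; _:+_; _:*_; _:-_; :-_; _:^_; _:=_)

  ∑ : ℕ → (ℕ → Carrier) → Carrier
  ∑ n f = sum {n} (λ i → f (toℕ i))

  ∑-cong : ∀ n {f g} → (∀ j → j ℕ.< n → f j ≈ g j) → ∑ n f ≈ ∑ n g
  ∑-cong n h = sum-cong-≋ (λ i → h (toℕ i) (toℕ<n i))

  ∑-mono : ∀ n {f g} → (∀ j → j ℕ.< n → f j ≤ g j) → ∑ n f ≤ ∑ n g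
  ∑-mono n h = sum-mono (λ i → h (toℕ i) (toℕ<n i))

  ∑-+ : ∀ n f g → ∑ n (λ j → f j + g j) ≈ ∑ n f + ∑ n g
  ∑-+ n f g = ∑-distrib-+ {n} (λ i → f (toℕ i)) (λ i → g (toℕ i))

  ∑-* : ∀ n a f → ∑ n (λ j → a * f j) ≈ a * ∑ n f
  ∑-* n a f = sym (*-distribˡ-sum {n} a (λ i → f (toℕ i)))

  ∑-linear : ∀ n a b f g → ∑ n (λ j → a * f j + b * g j) ≈ a * ∑ n f + b * ∑ n g
  ∑-linear n a b f g = trans (∑-+ n (λ j → a * f j) (λ j → b * g j)) (+-cong (∑-* n a f) (∑-* n b g))

  ∑-linear₃ : ∀ n a b d f g k → ∑ n (λ j → a * f j + (b * g j + d * k j)) ≈ a * ∑ n f +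
    (b * ∑ n g + d * ∑ n k)
  ∑-linear₃ n a b d f g k = trans (∑-+ n (λ j → a * f j) (λ j → b * g j + d * k j))
    (+-cong (∑-* n a f) (∑-linear n b d g k))

  ∑-linear₄ : ∀ n a b d e f g k l → ∑ n (λ j → a * f j + (b * g j + (d * k j + e * l j)))
    ≈ a * ∑ n f + (b * ∑ n g + (d * ∑ n k + e * ∑ n l))
  ∑-linear₄ n a b d e f g k l = trans (∑-+ n (λ j → a * f j) (λ j → b * g j + (d * k j + e * l j)))
    (+-cong (∑-* n a f) (∑-linear₃ n b d e g k l))

  ∑-geometric-¾ : ∀ n → ∑ n (ι (+ 3 ℚ./ 4) ^_) ≤ ι (+ 4 ℚ./ 1)
  ∑-geometric-¾ n = ≤-by (0≤* 0≤4 (0≤^ n 0≤¾)) (go n)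
    where
    ¾ = ι (+ 3 ℚ./ 4)
    4# = ι (+ 4 ℚ./ 1)
    0≤¾ : 0# ≤ ¾
    0≤¾ = ι-mono (toWitness {a? = _ ℚₚ.≤? _} _)
    0≤4 : 0# ≤ 4#
    0≤4 = ι-mono (toWitness {a? = _ ℚₚ.≤? _} _)
    -- Keeping the remainder `4 (3/4)^n` makes the induction an identity; the bound then drops it.
    go : ∀ n → ∑ n (¾ ^_) + 4# * ¾ ^ n ≈ 4#
    go zero = solve 0 (con 0ℚ :+ con (+ 4 ℚ./ 1) :* con 1ℚ := con (+ 4 ℚ./ 1)) refl
    go (suc n) = trans (+-congʳ (+-congˡ (∑-* n ¾ (¾ ^_))))
      (trans (solve 2 (λ s g → con 1ℚ :+ con (+ 3 ℚ./ 4) :* s :+ con (+ 4 ℚ./ 1) :* (con (+ 3 ℚ./ 4) :* g)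
                := con 1ℚ :+ con (+ 3 ℚ./ 4) :* (s :+ con (+ 4 ℚ./ 1) :* g)) refl (∑ n (¾ ^_)) (¾ ^ n))
        (trans (+-congˡ (*-congˡ (go n)))
          (solve 0 (con 1ℚ :+ con (+ 3 ℚ./ 4) :* con (+ 4 ℚ./ 1) := con (+ 4 ℚ./ 1)) refl)))

  ι-suc : ∀ n → ι (fromℕℚ (suc n)) ≈ 1# + ι (fromℕℚ n)
  ι-suc n = ≡.subst (λ z → ι z ≈ 1# + ι (fromℕℚ n)) (≡.sym (RationalLemmas.fromℕℚ-suc n))
    (ι-+ 1ℚ (fromℕℚ n))

  0≤ι : ∀ n → 0# ≤ ι (fromℕℚ n)
  0≤ι n = ι-mono (RationalLemmas.0≤fromℕℚ n)

  1≤ι-suc : ∀ n → 1# ≤ ι (fromℕℚ (suc n))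
  1≤ι-suc n = ι-mono (RationalLemmas.fromℕℚ-mono {1} {suc n} (ℕ.s≤s ℕ.z≤n))

  module FilteredSum {P : ℕ → Set} (P? : ∀ j → Dec (P j)) (f : ℕ → Carrier) where
    total : ℕ → Carrier
    total M = foldr _+_ 0# (List.map f (filter P? (upTo M)))

    private
      foldr-∷ʳ : ∀ xs x → foldr _+_ 0# (xs ∷ʳ x) ≈ foldr _+_ 0# xs + x
      foldr-∷ʳ []       x = +-comm x 0#
      foldr-∷ʳ (y ∷ xs) x = trans (+-congˡ (foldr-∷ʳ xs x))
        (solve 3 (λ y s x → y :+ (s :+ x) := y :+ s :+ x) refl y _ x)

      filter-∷ʳ : ∀ M → filter P? (upTo (suc M)) ≡ filter P? (upTo M) List.++ filter P? (M ∷ [])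
      filter-∷ʳ M = ≡.trans (≡.cong (filter P?) (≡.sym (Listₚ.upTo-∷ʳ M))) (Listₚ.filter-++ P? (upTo M)
        (M ∷ []))

    total-accept : ∀ {M} → P M → total (suc M) ≈ total M + f M
    total-accept {M} p rewrite filter-∷ʳ M | Listₚ.filter-accept P? {xs = []} p | Listₚ.map-++ f
      (filter P? (upTo M)) (M ∷ [])
      = foldr-∷ʳ (List.map f (filter P? (upTo M))) (f M)

    total-reject : ∀ {M} → ¬ P M → total (suc M) ≈ total M
    total-reject {M} ¬p rewrite filter-∷ʳ M | Listₚ.filter-reject P? {xs = []} ¬p | Listₚ.++-identityʳ
      (filter P? (upTo M)) = refl

    total-skip : ∀ M d → (∀ e → e ℕ.< d → ¬ P (M ℕ.+ e)) → total (M ℕ.+ d) ≈ total M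
    total-skip M zero    h rewrite ℕₚ.+-identityʳ M = refl
    total-skip M (suc d) h rewrite ℕₚ.+-suc M d =
      trans (total-reject (h d ℕₚ.≤-refl)) (total-skip M d (λ e e<d → h e (ℕₚ.m<n⇒m<1+n e<d)))

    module Progression (q′ a : ℕ) (hit : ∀ i → P (a ℕ.+ suc q′ ℕ.* i)) (before : ∀ e → e ℕ.< a → ¬ P e)
      (between : ∀ i e → e ℕ.< q′ → ¬ P (suc (a ℕ.+ suc q′ ℕ.* i) ℕ.+ e)) where

      -- The sum runs from its largest index downwards, so that `j` counts steps away from `m`.
      -- `total` grows at that same end, so the induction peels off the term `j = 0`.
      total-progression : ∀ n → total (suc (a ℕ.+ suc q′ ℕ.* n)) ≈ ∑ (suc n)
        (λ j → f (a ℕ.+ suc q′ ℕ.* (n ℕ.∸ j)))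
      total-progression zero = trans (total-accept (hit 0)) (trans (+-comm _ _) (+-congˡ
        (trans (≡.subst (λ z → total (a ℕ.+ z) ≈ total a) (≡.sym (ℕₚ.*-zeroʳ (suc q′)))
          (total-skip a 0 (λ _ ())))
          (total-skip 0 a before))))
      total-progression (suc n) = trans (total-accept (hit (suc n))) (trans (+-comm _ _) (+-congˡ
        (trans (≡.subst (λ z → total z ≈ total (suc (a ℕ.+ suc q′ ℕ.* n))) eq
          (total-skip (suc (a ℕ.+ suc q′ ℕ.* n)) q′ (between n)))
          (total-progression n))))
        where
        eq : suc (a ℕ.+ suc q′ ℕ.* n) ℕ.+ q′ ≡ a ℕ.+ suc q′ ℕ.* suc n
        eq = ≡.trans (≡.sym (ℕₚ.+-suc (a ℕ.+ suc q′ ℕ.* n) q′))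
          (≡.trans (ℕₚ.+-assoc a (suc q′ ℕ.* n) (suc q′))
          (≡.cong (a ℕ.+_) (≡.trans (ℕₚ.+-comm (suc q′ ℕ.* n) (suc q′)) (≡.sym (ℕₚ.*-suc (suc q′) n)))))

      -- `d` allows for indices above the last hit: the top of the range, `m - 1`, lies `r - 1`
      -- places above `m - r`.
      total-progression-gap : ∀ n d → d ℕ.≤ q′ → total (suc (a ℕ.+ suc q′ ℕ.* n) ℕ.+ d) ≈ ∑ (suc n)
        (λ j → f (a ℕ.+ suc q′ ℕ.* (n ℕ.∸ j)))
      total-progression-gap n d d≤q′ = trans (total-skip (suc (a ℕ.+ suc q′ ℕ.* n)) d
        (λ e e<d → between n e (ℕₚ.<-≤-trans e<d d≤q′)))
        (total-progression n)

-- Consequences of the tangent inequality for the exponential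

record Exponential (A : OrderedℚAlgebra) : Set where
  open OrderedℚAlgebra A
  field
    exp      : Carrier → Carrier
    exp-cong : ∀ {x y} → x ≈ y → exp x ≈ exp y
    exp-+    : ∀ x y → exp (x + y) ≈ exp x * exp y
    exp-0    : exp (ι 0ℚ) ≈ ι 1ℚ
    0≤exp    : ∀ x → ι 0ℚ ≤ exp x
    1+x≤exp  : ∀ x → ι 1ℚ + x ≤ exp x

module ExponentialProperties {A : OrderedℚAlgebra} (X : Exponential A) where
  open OrderedProperties A
  open Exponential X public
  open Solver using (solve; con; _:+_; _:*_; _:-_; :-_; _:^_; _:=_)

  exp-split : ∀ x y → exp x ≈ exp y * exp (x - y)
  exp-split x y = trans (exp-cong (solve 2 (λ x y → x := y :+ (x :- y)) refl x y)) (exp-+ y (x - y))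

  exp-tangent : ∀ x y → exp y * (1# + (x - y)) ≤ exp x
  exp-tangent x y = ≤-trans (*-monoˡ (exp y) (0≤exp y) (1+x≤exp (x - y)))
    (≤-reflexive (sym (exp-split x y)))

  exp-mono : ∀ {x y} → x ≤ y → exp x ≤ exp y
  exp-mono {x} {y} h = ≤-trans
    (≤-by (0≤* (0≤exp x) (0≤- h)) (solve 3 (λ e x y → e :+ e :* (y :- x) := e :* (con 1ℚ :+ (y :- x))) refl
      (exp x) x y))
    (exp-tangent y x)

  -- The tangent at `x`, evaluated at `0`: an upper bound for the exponential from an axiom that
  -- only bounds it below.
  exp-secant : ∀ x → exp x ≤ 1# + x * exp x
  exp-secant x = 0≤-⁻¹ (≤-trans (0≤- (exp-tangent 0# x))
    (≤-reflexive (trans (+-congʳ exp-0)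
      (solve 2 (λ e x → con 1ℚ :- e :* (con 1ℚ :+ (con 0ℚ :- x)) := con 1ℚ :+ x :* e :- e) refl
        (exp x) x))))

  exp-inverse : ∀ x → exp x * exp (- x) ≈ 1#
  exp-inverse x = trans (sym (exp-+ x (- x))) (trans (exp-cong (solve 1 (λ x → x :- x := con 0ℚ) refl x))
    exp-0)

-- Error constant, the root `c` and its geometric distribution

module Asymptotics {A : OrderedℚAlgebra} (X : Exponential A) where
  open OrderedProperties A
  open ExponentialProperties X
  open Sums A
  open Solver using (solve; con; _:+_; _:*_; _:-_; :-_; _:^_; _:=_)

  -- Division of `Σ i^k = m^k` by `m^k`, carried out as multiplication by `exp (- (k * y))`; the
  -- quotients are the weights of mass 1.
  ∑-normalise : ∀ n {S P k y} {e l h w : ℕ → Carrier} → S ≈ P → P ≈ exp (k * y) → S ≈ ∑ n e →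
    (∀ j → e j ≈ exp (k * l j)) → (∀ j → h j ≈ k * (y - l j)) → (∀ j → w j ≈ exp (- h j)) → ∑ n w ≈ 1#
  ∑-normalise n {S} {P} {k} {y} {e} {l} {h} {w} S≈P P≈ S≈∑ e≈ h≈ w≈ = trans (∑-cong n (λ j _ → trans
      (w≈ j) (trans (exp-cong (trans (-‿cong (h≈ j))
        (solve 3 (λ k y l → :- (k :* (y :- l)) := :- (k :* y) :+ k :* l) refl k y (l j))))
      (trans (exp-+ _ _) (*-congˡ (sym (e≈ j)))))))
    (trans (∑-* n (exp (- (k * y))) e)
      (trans (*-congˡ (trans (sym S≈∑) (trans S≈P P≈))) (trans (*-comm _ _) (exp-inverse (k * y)))))

  -- For the range `m ≤ r`, where the power sum is empty: multiplying by `exp (- x)` turns a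
  -- vanishing exponential into `1 ≈ 0`.
  exp≉0 : ∀ {x y z} → y ≈ exp x → z ≈ y → z ≈ 0# → 1# ≈ 0#
  exp≉0 {x} y≈exp z≈y z≈0 = trans (sym (exp-inverse x)) (trans (*-congʳ (trans (sym (trans z≈y y≈exp)) z≈0))
    (zeroˡ _))

  *-mono-assoc : ∀ {x z} k y → 0# ≤ k → y * x ≤ z → (k * y) * x ≤ k * z
  *-mono-assoc {x} k y 0≤k h = ≤-trans (≤-reflexive (solve 3 (λ k y x → (k :* y) :* x := k :* (y :* x)) refl
    k y x)) (*-monoˡ k 0≤k h)

  *-mono-assoc′ : ∀ {x z} k y → 0# ≤ k → z ≤ y * x → k * z ≤ (k * y) * x
  *-mono-assoc′ {x} k y 0≤k h = ≤-trans (*-monoˡ k 0≤k h)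
    (≤-reflexive (solve 3 (λ k y x → k :* (y :* x) := (k :* y) :* x) refl k y x))

  *-cancel-unit : ∀ {m ν} k → m * ν ≈ 1# → (k * ν) * m ≈ k
  *-cancel-unit {m} {ν} k eq = trans (solve 3 (λ k ν m → (k :* ν) :* m := k :* (m :* ν)) refl k ν m)
    (trans (*-congˡ eq) (solve 1 (λ k → k :* con 1ℚ := k) refl k))

  -- M comes from (j + 1)⁵ 2⁻ʲ ≤ 16⁵ (3/4)ʲ, which follows from j + 1 ≤ 16 (17/16)ʲ.
  module ErrorConstant (Q : Carrier) where

    16# 25# M Z Y C′ C : Carrier
    16# = ι (+ 16 ℚ./ 1)
    25# = ι (+ 25 ℚ./ 1)
    M = 16# ^ 5 * Q ^ 5
    -- `Z` bounds `exp (δ t_j)`, because `δ t_j ≤ 25 M ν t_j ≤ 25 M`, and `Y` is then the rate in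
    -- `w_j ≤ a_j (1 + Y ν t_j)`. `20 M` is the error of the upper estimate of `δ T₁`, `C′` that of
    -- the lower one.
    Z = exp (25# * M)
    Y = 25# * M * Z
    C′ = ι (+ 100 ℚ./ 1) * (M ^ 2 * Y) + (ι (+ 125 ℚ./ 1) * M ^ 2 + ι (+ 9 ℚ./ 1) * M)
    C = ι (+ 20 ℚ./ 1) * M + C′

  module Root (c Q R : Carrier) (1≤R : 1# ≤ R) (R≤Q : R ≤ Q)
    (root : exp (- (c * Q)) + exp (- (c * R)) ≈ 1#) where
    open ErrorConstant Q public

    E D 2# ¾ : Carrier
    E = exp (- (c * Q))
    D = 1# - E
    2# = ι (+ 2 ℚ./ 1)
    ¾ = ι (+ 3 ℚ./ 4)

    -- Σ_{j ≥ 0} D Eʲ (τ + Q j)ⁱ for i = 1, 2, where v = E / D.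
    fullMoment₁ fullMoment₂ : Carrier → Carrier → Carrier
    fullMoment₁ v τ = τ + Q * v
    fullMoment₂ v τ = τ ^ 2 + 2# * (τ * (Q * v)) + Q ^ 2 * (v * (1# + 2# * v))

    0≤R : 0# ≤ R
    0≤R = ≤-trans 0≤1 1≤R

    1≤Q : 1# ≤ Q
    1≤Q = ≤-trans 1≤R R≤Q

    0≤Q : 0# ≤ Q
    0≤Q = ≤-trans 0≤1 1≤Q

    0≤E : 0# ≤ E
    0≤E = 0≤exp _

    e^-cR≈D : exp (- (c * R)) ≈ D
    e^-cR≈D = trans (solve 2 (λ e f → f := (e :+ f) :- e) refl E (exp (- (c * R)))) (+-congʳ root)

    -- The tangent inequality turns the root equation into `2 - c (Q + R) ≤ 1`, and `Q + R ≥ 1` can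
    -- be cancelled from `- c (Q + R) ≤ 0`.
    0≤c : 0# ≤ c
    0≤c = ≤-trans (neg-mono (*≤⇒≤ { - c} {Q + R} 1≤Q+R ≤-refl -c[Q+R]≤0))
                  (≤-reflexive (solve 1 (λ c → :- :- c := c) refl c))
          ⟨≤ solve 0 (con 0ℚ := :- con 0ℚ) refl
      where
      _⟨≤_ : ∀ {x y z} → y ≤ z → x ≈ y → x ≤ z
      h ⟨≤ eq = ≤-trans (≤-reflexive eq) h
      1≤Q+R : 1# ≤ Q + R
      1≤Q+R = ≤-trans 1≤Q (≤-by 0≤R refl)
      -c[Q+R]≤0 : - c * (Q + R) ≤ 0#
      -c[Q+R]≤0 = ≤-by (0≤+ (0≤- (+-mono (1+x≤exp (- (c * Q))) (1+x≤exp (- (c * R))))) 0≤1)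
        (trans (solve 5 (λ c q r e f → :- c :* (q :+ r) :+
          (e :+ f :- (con 1ℚ :+ :- (c :* q) :+ (con 1ℚ :+ :- (c :* r))) :+ con 1ℚ)
             := e :+ f :- con 1ℚ) refl c Q R E (exp (- (c * R))))
           (trans (+-congʳ root) (solve 0 (con 1ℚ :- con 1ℚ := con 0ℚ) refl)))

    -- Since `R ≤ Q` and `c ≥ 0`, `E` is the smaller of two numbers whose sum is 1.
    E≤½ : 2# * E ≤ 1#
    E≤½ = ≤-by (0≤- (exp-mono (neg-mono (*-monoˡ c 0≤c R≤Q))))
      (trans (+-congˡ (+-congʳ e^-cR≈D))
        (solve 1 (λ e → con (+ 2 ℚ./ 1) :* e :+ ((con 1ℚ :- e) :- e) := con 1ℚ) refl E))

    E≤1 : E ≤ 1#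
    E≤1 = ≤-trans (≤-by 0≤E (solve 1 (λ e → e :+ e := con (+ 2 ℚ./ 1) :* e) refl E)) E≤½

    1≤2D : 1# ≤ 2# * D
    1≤2D = ≤-by (0≤- E≤½) (solve 1 (λ e → con 1ℚ :+ (con 1ℚ :- con (+ 2 ℚ./ 1) :* e) := con (+ 2 ℚ./ 1) :*
      (con 1ℚ :- e)) refl E)

    ½≤D : ι ½ ≤ D
    ½≤D = ≤-by (0≤* (ι-mono {0ℚ} {½} (toWitness {a? = _ ℚₚ.≤? _} _)) (0≤- 1≤2D))
      (solve 1 (λ d → con ½ :+ con ½ :* (con (+ 2 ℚ./ 1) :* d :- con 1ℚ) := d) refl D)

    0≤D : 0# ≤ D
    0≤D = 0≤- E≤1

    D≤1 : D ≤ 1#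
    D≤1 = ≤-by 0≤E (solve 1 (λ e → con 1ℚ :- e :+ e := con 1ℚ) refl E)

    -- From `D (1 + c R) ≤ exp (- (c * R)) * exp (c * R) = 1` and `2 D ≥ 1` follows `c R ≤
    -- 1`, while `R ≥ 1`.
    c≤1 : c ≤ 1#
    c≤1 = ≤-trans (≤-trans (≤*ˡ 0≤c 1≤R) (≤-reflexive (*-comm R c)))
      (*≤⇒≤ {c * R} {2# * D} {1#} 1≤2D 0≤1
        (≤-by (0≤+ (0≤- 1≤2D) (0≤+ (0≤- Dexp) (0≤- Dexp)))
         (solve 2 (λ cr d → cr :* (con (+ 2 ℚ./ 1) :* d) :+ (con (+ 2 ℚ./ 1) :* d :- con 1ℚ :+
            ((con 1ℚ :- d :* (con 1ℚ :+ cr)) :+ (con 1ℚ :- d :* (con 1ℚ :+ cr)))) := con 1ℚ) refl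
              (c * R) D)))
      where
      Dexp : D * (1# + c * R) ≤ 1#
      Dexp = ≤-trans (*-monoˡ D 0≤D (1+x≤exp (c * R)))
        (≤-reflexive (trans (*-congʳ (sym e^-cR≈D)) (trans (*-comm _ _) (exp-inverse (c * R)))))

    t s : ℕ → Carrier
    t j = R + Q * ι (fromℕℚ j)
    s j = ι (fromℕℚ (suc j))

    t≤Qs : ∀ j → t j ≤ Q * s j
    t≤Qs j = ≤-by (0≤- R≤Q) (trans (solve 3 (λ q r j → r :+ q :* j :+ (q :- r) := q :* (con 1ℚ :+ j)) refl Q
      R (ι (fromℕℚ j)))
      (*-congˡ (sym (ι-suc j))))

    1≤t : ∀ j → 1# ≤ t j
    1≤t j = ≤-trans 1≤R (≤-by (0≤* 0≤Q (0≤ι j)) refl)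

    0≤t : ∀ j → 0# ≤ t j
    0≤t j = ≤-trans 0≤1 (1≤t j)

    exp-t : ∀ j → exp (- (c * t j)) ≈ D * E ^ j
    exp-t zero = trans (exp-cong (solve 3 (λ c q r → :- (c :* (r :+ q :* con 0ℚ)) := :- (c :* r)) refl c Q
      R))
      (trans e^-cR≈D (sym (*-identityʳ D)))
    exp-t (suc j) = trans (exp-cong (trans (-‿cong (*-congˡ (+-congˡ (*-congˡ (ι-suc j)))))
        (solve 4 (λ c q r j → :- (c :* (r :+ q :* (con 1ℚ :+ j))) := :- (c :* q) :+ :- (c :* (r :+ q :* j)))
          refl c Q R (ι (fromℕℚ j)))))
      (trans (exp-+ _ _) (trans (*-congˡ (exp-t j)) (solve 3 (λ e d f → e :* (d :* f) := d :* (e :* f)) refl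
        E D (E ^ j))))

    -- `F` plays the part of the infinite sum `Σ D E^j f (τ + Q j)`, known only through its
    -- recursion under the shift by `Q`. Unrolling it `n` times leaves an exact remainder, so no
    -- infinite series has to be summed.
    ∑-telescope : ∀ {f F : Carrier → Carrier} → (∀ {x y} → x ≈ y → f x ≈ f y) → (∀ {x y} → x ≈ y → F x ≈ F
      y) →
      (∀ τ → F τ ≈ D * f τ + E * F (τ + Q)) → ∀ n τ →
      F τ ≈ ∑ n (λ j → (D * E ^ j) * f (τ + Q * ι (fromℕℚ j))) + E ^ n * F (τ + Q * ι (fromℕℚ n))
    ∑-telescope {f} {F} f-cong F-cong rec zero τ = trans
      (F-cong (solve 2 (λ t q → t := t :+ q :* con 0ℚ) refl τ Q))
      (solve 1 (λ x → x := con 0ℚ :+ con 1ℚ :* x) refl _)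
    ∑-telescope {f} {F} f-cong F-cong rec (suc n) τ = trans (rec τ)
      (trans (+-congˡ (*-congˡ (∑-telescope f-cong F-cong rec n (τ + Q))))
      (trans (solve 5 (λ a e s p x → a :+ e :* (s :+ p :* x) := a :+ e :* s :+ e :* p :* x) refl _ E _
        (E ^ n) _)
       (+-cong (+-cong (*-cong (solve 1 (λ d → d := d :* con 1ℚ) refl D)
         (f-cong (solve 2 (λ t q → t := t :+ q :* con 0ℚ) refl τ Q)))
                  (trans (sym (∑-* n E (λ j → (D * E ^ j) * f (τ + Q + Q * ι (fromℕℚ j)))))
                    (∑-cong n (λ j _ → trans (*-congˡ (*-congˡ (f-cong (shift j))))
                     (solve 4 (λ e d p x → e :* (d :* p :* x) := d :* (e :* p) :* x) refl E D (E ^ j)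
                       (f (τ + Q * ι (fromℕℚ (suc j)))))))))
         (*-congˡ (F-cong (shift n))))))
      where
      shift : ∀ j → τ + Q + Q * ι (fromℕℚ j) ≈ τ + Q * ι (fromℕℚ (suc j))
      shift j = trans (solve 3 (λ t q j → t :+ q :+ q :* j := t :+ q :* (con 1ℚ :+ j)) refl τ Q
        (ι (fromℕℚ j)))
        (+-congˡ (*-congˡ (sym (ι-suc j))))

    -- Half the fifth power of `17/16` stays below `3/4`, and `16 ρ^j` grows by `ρ^j ≥ 1` at each
    -- step, hence at least as fast as `j + 1`.
    ρ : Carrier
    ρ = ι (+ 17 ℚ./ 16)

    1≤ρ : 1# ≤ ρ
    1≤ρ = ι-mono (toWitness {a? = _ ℚₚ.≤? _} _)

    0≤ρ : 0# ≤ ρ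
    0≤ρ = ≤-trans 0≤1 1≤ρ

    0≤¾ : 0# ≤ ¾
    0≤¾ = ι-mono (toWitness {a? = _ ℚₚ.≤? _} _)

    1≤M : 1# ≤ M
    1≤M = 1≤* (1≤^ 5 (ι-mono (toWitness {a? = _ ℚₚ.≤? _} _))) (1≤^ 5 1≤Q)

    0≤M : 0# ≤ M
    0≤M = ≤-trans 0≤1 1≤M

    s≤16ρ^ : ∀ j → s j ≤ 16# * ρ ^ j
    s≤16ρ^ zero = ≤-trans (ι-mono (toWitness {a? = _ ℚₚ.≤? (+ 16 ℚ./ 1)} _))
      (≤-reflexive (solve 1 (λ x → x := x :* con 1ℚ) refl 16#))
    s≤16ρ^ (suc j) = ≤-trans (≤-reflexive (ι-suc (suc j))) (≤-trans (+-mono (1≤^ j 1≤ρ) (s≤16ρ^ j))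
      (≤-reflexive (solve 1 (λ x → x :+ con (+ 16 ℚ./ 1) :* x := con (+ 16 ℚ./ 1) :*
        (con (+ 17 ℚ./ 16) :* x)) refl (ρ ^ j))))

    E^ρ^≤¾^ : ∀ j → E ^ j * (ρ ^ j) ^ 5 ≤ ¾ ^ j
    E^ρ^≤¾^ zero = ≤-reflexive (solve 0 (con 1ℚ :* con 1ℚ :^ 5 := con 1ℚ) refl)
    E^ρ^≤¾^ (suc j) = ≤-trans (≤-reflexive (solve 3 (λ e f r → e :* f :* (con (+ 17 ℚ./ 16) :* r) :^ 5
        := (e :* con (+ 17 ℚ./ 16) :^ 5) :* (f :* r :^ 5)) refl E (E ^ j) (ρ ^ j)))
      (*-mono (0≤* 0≤E (0≤^ 5 0≤ρ)) (0≤^ j 0≤¾) Eρ⁵≤¾ (E^ρ^≤¾^ j))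
      where
      Eρ⁵≤¾ : E * ρ ^ 5 ≤ ¾
      -- `1419857/1048576` is `(17/16)^5`; once `E ≤ 1/2` is used, the comparison with `3/4` is a
      -- computation.
      Eρ⁵≤¾ = ≤-trans (≤-by (0≤* (0≤* (0≤- E≤½) (0≤^ 5 0≤ρ))
        (ι-mono {0ℚ} {½} (toWitness {a? = _ ℚₚ.≤? _} _)))
         (solve 1 (λ e → e :* con (+ 17 ℚ./ 16) :^ 5 :+ (con 1ℚ :- con (+ 2 ℚ./ 1) :* e) :* con
           (+ 17 ℚ./ 16) :^ 5 :* con ½
            := con (½ ℚ.* (+ 1419857 ℚ./ 1048576))) refl E))
        (ι-mono (toWitness {a? = _ ℚₚ.≤? (+ 3 ℚ./ 4)} _))

    -- The error terms call for the fifth power: `t^3 + t^4` from the logarithm is merged into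
    -- `t^5`, `t^2` times `t^3` occurs in the second moment of `w`, and a tail `y^2` is raised to
    -- `y^5` to gain `ν^2`.
    E^Qs⁵≤ : ∀ j → E ^ j * (Q * s j) ^ 5 ≤ M * ¾ ^ j
    E^Qs⁵≤ j = ≤-trans (*-monoˡ (E ^ j) (0≤^ j 0≤E) (^-mono 5 (0≤* 0≤Q (0≤ι (suc j)))
      (*-monoˡ Q 0≤Q (s≤16ρ^ j))))
      (≤-trans (≤-reflexive (solve 4 (λ e q r k → e :* (q :* (k :* r)) :^ 5 := k :^ 5 :* q :^ 5 :*
        (e :* r :^ 5)) refl (E ^ j) Q (ρ ^ j) 16#))
        (*-monoˡ M 0≤M (E^ρ^≤¾^ j)))

    ¾^≤1 : ∀ n → ¾ ^ n ≤ 1#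
    ¾^≤1 zero = ≤-refl
    ¾^≤1 (suc n) = ≤-trans (*-mono 0≤¾ 0≤1 (ι-mono {_} {1ℚ} (toWitness {a? = _ ℚₚ.≤? _} _)) (¾^≤1 n))
      (≤-reflexive (*-identityˡ 1#))

    -- Here u₁, u₂, u₃ are the inverses of D, D², D³, and v = E u₁.
    module ClosedForm (R² RQ Q² u₁ u₂ u₃ : Carrier) (R²≈ : R² ≈ R ^ 2) (RQ≈ : RQ ≈ 2# * (R * Q))
      (Q²≈ : Q² ≈ Q ^ 2)
      (Du₁ : D * u₁ ≈ 1#) (D²u₂ : D * (D * 1#) * u₂ ≈ 1#) (D³u₃ : D * (D * (D * 1#)) * u₃ ≈ 1#) where

      private
        v = E * u₁

      denominator numerator : Carrier
      denominator = R * u₁ + Q * E * u₂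
      numerator = R² * u₁ + RQ * E * u₂ + Q² * E * (1# + E) * u₃

      Dv≈E : D * v ≈ E
      Dv≈E = trans (solve 3 (λ d e u → d :* (e :* u) := d :* u :* e) refl D E u₁)
        (trans (*-congʳ Du₁) (*-identityˡ E))

      Du₂≈u₁ : D * u₂ ≈ u₁
      Du₂≈u₁ = trans (sym (*-identityˡ (D * u₂))) (trans (*-congʳ (sym Du₁))
        (trans (solve 3 (λ d u w → d :* u :* (d :* w) := u :* (d :* (d :* con 1ℚ) :* w)) refl D u₁ u₂)
          (trans (*-congˡ D²u₂) (solve 1 (λ u → u :* con 1ℚ := u) refl u₁))))

      u₂≈u₁² : u₂ ≈ u₁ * u₁
      u₂≈u₁² = trans (sym (*-identityˡ u₂)) (trans (*-congʳ (sym Du₁))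
        (trans (solve 3 (λ d u w → d :* u :* w := u :* (d :* w)) refl D u₁ u₂) (*-congˡ Du₂≈u₁)))

      Du₃≈u₁² : D * u₃ ≈ u₁ * u₁
      Du₃≈u₁² = trans (trans (sym (*-identityˡ (D * u₃)))
        (*-congʳ (trans (sym (*-identityˡ 1#)) (*-cong (sym Du₁) (sym Du₁)))))
        (trans (solve 3 (λ d u w → d :* u :* (d :* u) :* (d :* w) := u :* u :*
          (d :* (d :* (d :* con 1ℚ)) :* w)) refl D u₁ u₃)
          (trans (*-congˡ D³u₃) (solve 1 (λ u → u :* con 1ℚ := u) refl (u₁ * u₁))))

      u₁≈1+v : u₁ ≈ 1# + v
      u₁≈1+v = trans (solve 2 (λ e u → u := (con 1ℚ :- e) :* u :+ e :* u) refl E u₁) (+-congʳ Du₁)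

      -- `- u₁ * (2 D)` equals `-2`, so cancelling `2 D ≥ 1` gives `- u₁ ≤ 0`. The detour by
      -- negation is due to the cancellation rule, which bounds from above.
      0≤u₁ : 0# ≤ u₁
      0≤u₁ = ≤-trans (≤-trans (≤-reflexive (solve 0 (con 0ℚ := :- con 0ℚ) refl))
        (neg-mono (*≤⇒≤ { - u₁} 1≤2D ≤-refl
          (≤-by 0≤2 (trans (+-congˡ (trans (solve 0 (con (+ 2 ℚ./ 1) := con (+ 2 ℚ./ 1) :* con 1ℚ) refl)
            (*-congˡ (sym Du₁))))
             (solve 2 (λ u d → :- u :* (con (+ 2 ℚ./ 1) :* d) :+ con (+ 2 ℚ./ 1) :* (d :* u) := con 0ℚ) refl
               u₁ D))))))
        (≤-reflexive (solve 1 (λ u → :- :- u := u) refl u₁))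
        where
        0≤2 : 0# ≤ 2#
        0≤2 = ι-mono (toWitness {a? = _ ℚₚ.≤? _} _)

      -- `R u₁` alone is at least 1, since `u₁ ≈ 1 + v`. This supplies the positive divisor that
      -- `c₂` requires.
      1≤denominator : 1# ≤ denominator
      1≤denominator = ≤-trans (1≤* 1≤R (≤-by (0≤* 0≤E 0≤u₁) (sym u₁≈1+v)))
        (≤-by (0≤* (0≤* 0≤Q 0≤E) (≤-trans (0≤* 0≤u₁ 0≤u₁) (≤-reflexive (sym u₂≈u₁²)))) refl)

      -- `1/D` is the common factor by which the displayed fractions differ from the moments of the
      -- distribution `D E^j`.
      D*denominator : D * denominator ≈ fullMoment₁ v R
      D*denominator = trans (solve 6 (λ d r u q e w → d :* (r :* u :+ q :* e :* w) := r :* (d :* u) :+ q :*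
        e :* (d :* w)) refl D R u₁ Q E u₂)
        (trans (+-cong (*-congˡ Du₁) (*-congˡ Du₂≈u₁))
          (solve 4 (λ r q e u → r :* con 1ℚ :+ q :* e :* u := r :+ q :* (e :* u)) refl R Q E u₁))

      D*numerator : D * numerator ≈ fullMoment₂ v R
      D*numerator = trans (solve 8 (λ d e r s q u w z → d :* (r :* u :+ s :* e :* w :+ q :* e :*
        (con 1ℚ :+ e) :* z)
            := r :* (d :* u) :+ s :* e :* (d :* w) :+ q :* e :* (con 1ℚ :+ e) :* (d :* z)) refl D E R² RQ Q²
              u₁ u₂ u₃)
        (trans (+-cong (+-cong (*-cong R²≈ Du₁) (*-cong (*-congʳ RQ≈) Du₂≈u₁))
          (*-cong (*-congʳ (*-congʳ Q²≈)) Du₃≈u₁²))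
          (trans (solve 4 (λ r q e u → r :^ 2 :* con 1ℚ :+ con (+ 2 ℚ./ 1) :* (r :* q) :* e :* u :+ q :^ 2
            :* e :* (con 1ℚ :+ e) :* (u :* u)
                := r :^ 2 :+ con (+ 2 ℚ./ 1) :* (r :* (q :* (e :* u))) :+ q :^ 2 :*
                  (e :* u :* (u :+ e :* u))) refl R Q E u₁)
            (+-congˡ (*-congˡ (*-congˡ (trans (+-congʳ u₁≈1+v)
              (solve 1 (λ v → con 1ℚ :+ v :+ v := con 1ℚ :+ con (+ 2 ℚ./ 1) :* v) refl v)))))))

      -- Characterises `c₂` by a linear equation, so that the estimate never handles the quotient
      -- itself.
      quotient*fullMoment₁ : ∀ {w} → denominator * w ≈ 1# → - (c * ι ½) * (numerator * w) * fullMoment₁ v R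
        ≈ - (c * ι ½) * fullMoment₂ v R
      quotient*fullMoment₁ {w} eq = trans (*-congˡ (sym D*denominator))
        (trans (solve 5 (λ a n w d e → a :* (n :* w) :* (d :* e) := a :* (d :* n :* (e :* w))) refl
          (- (c * ι ½)) numerator w D denominator)
          (*-congˡ (trans (*-congˡ eq) (trans (solve 1 (λ x → x :* con 1ℚ := x) refl (D * numerator))
            D*numerator))))

    -- Two-sided estimate of `δ = c - x`

    module Estimate (v x ν : Carrier) (n : ℕ) (h w : ℕ → Carrier)
      (Dv≈E : D * v ≈ E) (0≤x : 0# ≤ x) (0≤ν : 0# ≤ ν) (ν≤1 : ν ≤ 1#)
      -- This says `m ≤ Q (n + 1)`: the `n` terms reach close to `m`, which lets the tails be paid
      -- for in powers of `ν`.
      (1≤νQs : 1# ≤ ν * (Q * s n)) (νt≤1 : ∀ j → j ℕ.< n → ν * t j ≤ 1#)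
      (w≈exp : ∀ j → w j ≈ exp (- h j)) (mass : ∑ n w ≈ 1#)
      (h-lower : ∀ j → j ℕ.< n → x * (t j + ι ½ * (ν * t j ^ 2)) ≤ h j)
      (h-upper : ∀ j → j ℕ.< n → h j ≤ x * (t j + ι ½ * (ν * t j ^ 2) + ν ^ 2 * (t j ^ 3 + t j ^ 4))) where

      T₁ T₂ : Carrier → Carrier
      T₁ = fullMoment₁ v
      T₂ = fullMoment₂ v

      a : ℕ → Carrier
      a j = D * E ^ j

      0≤w : ∀ j → 0# ≤ w j
      0≤w j = ≤-trans (0≤exp (- h j)) (≤-reflexive (sym (w≈exp j)))

      exp≤w : ∀ j → exp (- (c * t j)) * (1# + (- h j - - (c * t j))) ≤ w j
      exp≤w j = ≤-trans (exp-tangent (- h j) (- (c * t j))) (≤-reflexive (sym (w≈exp j)))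

      moment : (ℕ → Carrier) → (Carrier → Carrier) → Carrier
      moment b f = ∑ n (λ j → b j * f (t j))

      0≤v : 0# ≤ v
      0≤v = ≤-trans (≤-trans (≤-reflexive (solve 0 (con 0ℚ := :- con 0ℚ) refl))
        (neg-mono (*≤⇒≤ { - v} 1≤2D ≤-refl
          (≤-by (0≤+ 0≤E 0≤E) (trans (solve 3 (λ v d e → :- v :* (con (+ 2 ℚ./ 1) :* d) :+ (e :+ e) := con
            (+ 2 ℚ./ 1) :* (e :- d :* v)) refl v D E)
             (trans (*-congˡ (+-congˡ (-‿cong Dv≈E))) (solve 1 (λ e → con (+ 2 ℚ./ 1) :* (e :- e) := con 0ℚ)
               refl E)))))))
         (≤-reflexive (solve 1 (λ v → :- :- v := v) refl v))

      v≤1 : v ≤ 1#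
      v≤1 = *≤⇒≤ {v} 1≤2D 0≤1 (≤-trans (≤-reflexive
        (trans (solve 2 (λ v d → v :* (con (+ 2 ℚ./ 1) :* d) := con (+ 2 ℚ./ 1) :* (d :* v)) refl v D)
        (*-congˡ Dv≈E))) E≤½)

      -- The fixed-point form of `v = E / (1 - E)`; it makes `T₁` and `T₂` satisfy the recursion of
      -- `∑-telescope`.
      v≈E+Ev : E + E * v ≈ v
      v≈E+Ev = trans (+-congʳ (sym Dv≈E)) (solve 2 (λ e v → (con 1ℚ :- e) :* v :+ e :* v := v) refl E v)

      ^-cong : ∀ {x y} i → x ≈ y → x ^ i ≈ y ^ i
      ^-cong zero eq = refl
      ^-cong (suc i) eq = *-cong eq (^-cong i eq)

      T₁-cong : ∀ {x y} → x ≈ y → T₁ x ≈ T₁ y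
      T₁-cong eq = +-congʳ eq

      T₂-cong : ∀ {x y} → x ≈ y → T₂ x ≈ T₂ y
      T₂-cong eq = +-congʳ (+-cong (^-cong 2 eq) (*-congˡ (*-congʳ eq)))

      A₀ A₁ A₂ A₅ W₁ W₂ τ₀ τ₁ τ₂ : Carrier
      A₀ = moment a (λ _ → 1#)
      A₁ = moment a (λ τ → τ)
      A₂ = moment a (_^ 2)
      A₅ = moment a (_^ 5)
      W₁ = moment w (λ τ → τ)
      W₂ = moment w (_^ 2)
      τ₀ = E ^ n * 1#
      τ₁ = E ^ n * T₁ (t n)
      τ₂ = E ^ n * T₂ (t n)

      T₀-split : 1# ≈ A₀ + τ₀
      T₀-split = ∑-telescope {λ _ → 1#} {λ _ → 1#} (λ _ → refl) (λ _ → refl)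
        (λ τ → solve 1 (λ e → con 1ℚ := (con 1ℚ :- e) :* con 1ℚ :+ e :* con 1ℚ) refl E) n R

      T₁-split : T₁ R ≈ A₁ + τ₁
      T₁-split = ∑-telescope {λ τ → τ} {T₁} (λ eq → eq) T₁-cong
        (λ τ → sym (trans (solve 4 (λ e v τ q → (con 1ℚ :- e) :* τ :+ e :* (τ :+ q :+ q :* v) := τ :+ q :*
          (e :+ e :* v)) refl E v τ Q)
          (+-congˡ (*-congˡ v≈E+Ev)))) n R

      T₂-split : T₂ R ≈ A₂ + τ₂
      T₂-split = ∑-telescope {_^ 2} {T₂} (^-cong 2) T₂-cong
        (λ τ → sym (trans (solve 4 (λ e v τ q → (con 1ℚ :- e) :* τ :^ 2 :+ e :*
          ((τ :+ q) :^ 2 :+ con (+ 2 ℚ./ 1) :* ((τ :+ q) :* (q :* v))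
               :+ q :^ 2 :* (v :* (con 1ℚ :+ con (+ 2 ℚ./ 1) :* v)))
             := τ :^ 2 :+ con (+ 2 ℚ./ 1) :* (τ :* (q :* (e :+ e :* v))) :+ q :^ 2 :*
               ((e :+ e :* v) :* (con 1ℚ :+ con (+ 2 ℚ./ 1) :* v))) refl E v τ Q)
          (+-cong (+-congˡ (*-congˡ (*-congˡ (*-congˡ v≈E+Ev)))) (*-congˡ (*-congʳ v≈E+Ev))))) n R

      0≤a : ∀ j → 0# ≤ a j
      0≤a j = 0≤* 0≤D (0≤^ j 0≤E)

      0≤ι′ : ∀ {p} → {0≤p : True (0ℚ ℚₚ.≤? p)} → 0# ≤ ι p
      0≤ι′ {p} {0≤p} = ι-mono (toWitness 0≤p)

      0≤Qv : 0# ≤ Q * v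
      0≤Qv = 0≤* 0≤Q 0≤v

      0≤1+2v : 0# ≤ 1# + 2# * v
      0≤1+2v = 0≤+ 0≤1 (0≤* 0≤ι′ 0≤v)

      1≤T₁ : ∀ {τ} → 1# ≤ τ → 1# ≤ T₁ τ
      1≤T₁ 1≤τ = ≤-trans 1≤τ (≤-by 0≤Qv refl)

      T₁≤T₂ : ∀ {τ} → 1# ≤ τ → T₁ τ ≤ T₂ τ
      T₁≤T₂ {τ} 1≤τ = ≤-by (0≤+ (0≤+ (0≤* (≤-trans 0≤1 1≤τ) (0≤- 1≤τ))
        (0≤* 0≤Qv (0≤+ (≤-trans 0≤1 1≤τ) (0≤- 1≤τ)))) (0≤* (0≤^ 2 0≤Q) (0≤* 0≤v 0≤1+2v)))
        (solve 3 (λ τ q v → τ :+ q :* v :+ (τ :* (τ :- con 1ℚ) :+ (q :* v) :* (τ :+ (τ :- con 1ℚ)) :+ q :^ 2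
          :* (v :* (con 1ℚ :+ con (+ 2 ℚ./ 1) :* v)))
          := τ :^ 2 :+ con (+ 2 ℚ./ 1) :* (τ :* (q :* v)) :+ q :^ 2 :*
            (v :* (con 1ℚ :+ con (+ 2 ℚ./ 1) :* v))) refl τ Q v)

      -- `6 = 1 + 2 + 3`, one summand for each term of `T₂`, after `τ` and `Q` are raised to `y` and
      -- `v` to 1.
      T₂≤6y² : ∀ {τ y} → 0# ≤ τ → τ ≤ y → Q ≤ y → T₂ τ ≤ ι (+ 6 ℚ./ 1) * y ^ 2
      T₂≤6y² {τ} {y} 0≤τ τ≤y Q≤y = ≤-trans (+-mono (+-mono (^-mono 2 0≤τ τ≤y)
           (*-monoˡ 2# 0≤ι′ (*-mono 0≤τ (0≤* 0≤y 0≤1) τ≤y (*-mono 0≤Q 0≤1 Q≤y v≤1))))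
           (*-mono (0≤^ 2 0≤Q) (0≤* 0≤1 (0≤+ 0≤1 (0≤* 0≤ι′ 0≤1))) (^-mono 2 0≤Q Q≤y)
             (*-mono 0≤v (0≤+ 0≤1 (0≤* 0≤ι′ 0≤1)) v≤1 (+-mono ≤-refl (*-monoˡ 2# 0≤ι′ v≤1)))))
        (≤-reflexive (solve 1 (λ y → y :^ 2 :+ con (+ 2 ℚ./ 1) :* (y :* (y :* con 1ℚ)) :+ y :^ 2 :*
          (con 1ℚ :* (con 1ℚ :+ con (+ 2 ℚ./ 1) :* con 1ℚ))
          := con (+ 6 ℚ./ 1) :* y :^ 2) refl y))
        where
        0≤y = ≤-trans 0≤τ τ≤y

      6Mν² : Carrier
      6Mν² = ι (+ 6 ℚ./ 1) * (M * ν ^ 2)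

      -- For `y = Q s_n` one has `1 ≤ ν y` and `1 ≤ y`, so `y^2 ≤ (ν y)^2 * y * y^2 = ν^2 y^5`, and
      -- the factor `E^n` brings `y^5` down to `M`.
      tail-bound : E ^ n * (ι (+ 6 ℚ./ 1) * (Q * s n) ^ 2) ≤ 6Mν²
      tail-bound = ≤-trans (*-monoˡ (E ^ n) (0≤^ n 0≤E)
        (*-monoˡ _ 0≤ι′ (≤-trans (≤*ˡ (0≤^ 2 0≤y) (1≤* (1≤^ 2 1≤νQs) 1≤y)) (≤-reflexive
             (solve 2 (λ u y → (u :* y) :^ 2 :* y :* y :^ 2 := u :^ 2 :* y :^ 5) refl ν y)))))
         (≤-trans (≤-reflexive (solve 3 (λ e u y → e :* (con (+ 6 ℚ./ 1) :* (u :* y)) := con (+ 6 ℚ./ 1) :*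
           ((e :* y) :* u)) refl (E ^ n) (ν ^ 2) (y ^ 5)))
          (*-monoˡ _ 0≤ι′ (*-mono (0≤* (0≤^ n 0≤E) (0≤^ 5 0≤y)) (0≤^ 2 0≤ν)
            (≤-trans (E^Qs⁵≤ n) (≤-trans (*-monoˡ M 0≤M (¾^≤1 n))
            (≤-reflexive (solve 1 (λ x → x :* con 1ℚ := x) refl M)))) ≤-refl)))
        where
        y = Q * s n
        1≤y : 1# ≤ y
        1≤y = 1≤* 1≤Q (1≤ι-suc n)
        0≤y : 0# ≤ y
        0≤y = ≤-trans 0≤1 1≤y

      τ₂≤ : τ₂ ≤ 6Mν²
      τ₂≤ = ≤-trans (*-monoˡ (E ^ n) (0≤^ n 0≤E) (T₂≤6y² (0≤t n) (t≤Qs n) (≤-trans (≤*ˡ 0≤Q (1≤ι-suc n))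
        (≤-reflexive (*-comm _ _))))) tail-bound

      τ₁≤ : τ₁ ≤ 6Mν²
      τ₁≤ = ≤-trans (*-monoˡ (E ^ n) (0≤^ n 0≤E) (T₁≤T₂ (1≤t n))) τ₂≤

      τ₀≤ : τ₀ ≤ 6Mν²
      τ₀≤ = ≤-trans (*-monoˡ (E ^ n) (0≤^ n 0≤E) (1≤T₁ (1≤t n))) τ₁≤

      0≤T₁ : ∀ {τ} → 0# ≤ τ → 0# ≤ T₁ τ
      0≤T₁ 0≤τ = 0≤+ 0≤τ 0≤Qv

      0≤T₂ : ∀ {τ} → 0# ≤ τ → 0# ≤ T₂ τ
      0≤T₂ 0≤τ = 0≤+ (0≤+ (0≤^ 2 0≤τ) (0≤* 0≤ι′ (0≤* 0≤τ 0≤Qv))) (0≤* (0≤^ 2 0≤Q) (0≤* 0≤v 0≤1+2v))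

      0≤τ₀ : 0# ≤ τ₀
      0≤τ₀ = 0≤* (0≤^ n 0≤E) 0≤1

      0≤τ₁ : 0# ≤ τ₁
      0≤τ₁ = 0≤* (0≤^ n 0≤E) (0≤T₁ (0≤t n))

      0≤τ₂ : 0# ≤ τ₂
      0≤τ₂ = 0≤* (0≤^ n 0≤E) (0≤T₂ (0≤t n))

      0≤moment : ∀ {b f} → (∀ j → 0# ≤ b j * f (t j)) → 0# ≤ moment b f
      0≤moment {b} {f} p = ≤-trans (≤-reflexive (sym (trans (∑-* n 0# (λ _ → 0#)) (zeroˡ _))))
        (∑-mono n {λ _ → 0# * 0#} (λ j _ → ≤-trans (≤-reflexive (zeroˡ 0#)) (p j)))

      0≤W₂ : 0# ≤ W₂
      0≤W₂ = 0≤moment {w} {_^ 2} (λ j → 0≤* (0≤w j) (0≤^ 2 (0≤t j)))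

      4# : Carrier
      4# = ι (+ 4 ℚ./ 1)

      A₅≤4M : A₅ ≤ M * 4#
      A₅≤4M = ≤-trans (∑-mono n {λ j → a j * t j ^ 5} {λ j → M * ¾ ^ j}
        (λ j _ → ≤-trans (*-mono (0≤a j) (0≤^ 5 (≤-trans (0≤t j) (t≤Qs j)))
            (≤-trans (*-mono 0≤D (0≤^ j 0≤E) D≤1 ≤-refl) (≤-reflexive (*-identityˡ _)))
              (^-mono 5 (0≤t j) (t≤Qs j))) (E^Qs⁵≤ j)))
        (≤-trans (≤-reflexive (∑-* n M (¾ ^_))) (*-monoˡ M 0≤M (∑-geometric-¾ n)))

      A₂≤4M : A₂ ≤ M * 4#
      A₂≤4M = ≤-trans (∑-mono n {λ j → a j * t j ^ 2} {λ j → a j * t j ^ 5}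
        (λ j _ → *-monoˡ (a j) (0≤a j) (^-monoʳ {m = 2} {n = 5} (1≤t j) (ℕ.s≤s (ℕ.s≤s ℕ.z≤n))))) A₅≤4M

      δ ½# : Carrier
      δ = c - x
      ½# = ι ½

      0≤½ : 0# ≤ ½#
      0≤½ = 0≤ι′

      1≤W₁ : 1# ≤ W₁
      1≤W₁ = ≤-trans (≤-reflexive (sym mass)) (∑-mono n {w} {λ j → w j * t j}
        (λ j _ → ≤-trans (≤*ˡ (0≤w j) (1≤t j)) (≤-reflexive (*-comm _ _))))

      A₀≤1 : A₀ ≤ 1#
      A₀≤1 = ≤-by 0≤τ₀ (sym T₀-split)

      -- a_j ≥ w_j (1 + h_j - c t_j), summed over j.
      ½xνW₂≤δW₁ : ½# * (x * ν) * W₂ ≤ δ * W₁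
      ½xνW₂≤δW₁ = ≤-by (0≤- (≤-trans summed A₀≤1))
        (trans (+-congˡ (+-congˡ (-‿cong (+-congʳ (trans (*-identityˡ _) mass)))))
          (solve 5 (λ x c ν p q → con ½ :* (x :* ν) :* p :+
            (con 1ℚ :- (con 1ℚ :+ ((x :- c) :* q :+ con ½ :* (x :* ν) :* p))) := (c :- x) :* q) refl x c ν
            W₂ W₁))
        where
        termwise : ∀ j → j ℕ.< n → 1# * w j + ((x - c) * (w j * t j) + ½# * (x * ν) * (w j * t j ^ 2)) ≤ a j
          * 1#
        termwise j j<n = ≤-trans (≤-by (0≤* (0≤w j) (0≤- (h-lower j j<n)))
            (solve 6 (λ w x c ν t h → con 1ℚ :* w :+ ((x :- c) :* (w :* t) :+ con ½ :* (x :* ν) :*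
              (w :* t :^ 2)) :+ w :* (h :- x :* (t :+ con ½ :* (ν :* t :^ 2)))
               := w :* (con 1ℚ :+ (:- (c :* t) :- :- h))) refl (w j) x c ν (t j) (h j)))
          (≤-trans (≤-trans (≤-reflexive (*-congʳ (w≈exp j))) (exp-tangent (- (c * t j)) (- h j)))
            (≤-reflexive (trans (exp-t j) (solve 1 (λ a → a := a :* con 1ℚ) refl (a j)))))
        summed : 1# * ∑ n w + ((x - c) * W₁ + ½# * (x * ν) * W₂) ≤ A₀
        summed = ≤-trans (≤-reflexive (sym (∑-linear₃ n 1# (x - c) (½# * (x * ν)) w (λ j → w j * t j)
          (λ j → w j * t j ^ 2))))
          (∑-mono n termwise)

      -- `δ W₁` dominates a non-negative quantity, and `W₁ ≥ 1` can be cancelled. This is where `k`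
      -- is bounded in terms of `m`: it gives `x ≤ c ≤ 1`, on which the uniformity of all later
      -- errors rests.
      0≤δ : 0# ≤ δ
      0≤δ = ≤-trans (≤-trans (≤-reflexive (solve 0 (con 0ℚ := :- con 0ℚ) refl))
        (neg-mono (*≤⇒≤ { - δ} 1≤W₁ ≤-refl
         (≤-by (≤-trans (0≤* (0≤* 0≤½ (0≤* 0≤x 0≤ν)) 0≤W₂) ½xνW₂≤δW₁)
           (solve 2 (λ d w → :- d :* w :+ d :* w := con 0ℚ) refl δ W₁)))))
         (≤-reflexive (solve 1 (λ v → :- :- v := v) refl δ))

      x≤c : x ≤ c
      x≤c = 0≤-⁻¹ 0≤δ

      x≤1 : x ≤ 1#
      x≤1 = ≤-trans x≤c c≤1

      δ≤1 : δ ≤ 1#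
      δ≤1 = ≤-trans (≤-by 0≤x (solve 2 (λ c x → c :- x :+ x := c) refl c x)) c≤1

      -- w_j ≥ a_j (1 + c t_j - h_j), summed over j.
      δA₁-expansion : A₀ + (δ * A₁ + (- (½# * (x * ν)) * A₂ + - (2# * ν ^ 2) * A₅)) ≤ 1#
      δA₁-expansion = ≤-trans (≤-reflexive (trans (+-congʳ (sym (*-identityˡ A₀)))
        (sym (∑-linear₄ n 1# δ (- (½# * (x * ν))) (- (2# * ν ^ 2))
          (λ j → a j * 1#) (λ j → a j * t j) (λ j → a j * t j ^ 2) (λ j → a j * t j ^ 5)))))
        (≤-trans (∑-mono n termwise) (≤-reflexive mass))
        where
        -- With `x ≤ 1 ≤ t_j`, both error terms of the logarithm fit under one fifth moment.
        x[t³+t⁴]≤2t⁵ : ∀ j → x * (t j ^ 3 + t j ^ 4) ≤ 2# * t j ^ 5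
        x[t³+t⁴]≤2t⁵ j = ≤-trans (*-mono 0≤x (0≤+ 0≤t⁵ 0≤t⁵) x≤1
            (+-mono (^-monoʳ {m = 3} {n = 5} (1≤t j) (ℕ.s≤s (ℕ.s≤s (ℕ.s≤s ℕ.z≤n)))) (^-monoʳ {m = 4} {n = 5}
              (1≤t j) (ℕ.s≤s (ℕ.s≤s (ℕ.s≤s (ℕ.s≤s ℕ.z≤n)))))))
          (≤-reflexive (solve 1 (λ y → con 1ℚ :* (y :+ y) := con (+ 2 ℚ./ 1) :* y) refl (t j ^ 5)))
          where 0≤t⁵ = 0≤^ 5 (0≤t j)
        termwise : ∀ j → j ℕ.< n → 1# * (a j * 1#) +
          (δ * (a j * t j) + (- (½# * (x * ν)) * (a j * t j ^ 2) + - (2# * ν ^ 2) * (a j * t j ^ 5))) ≤ w j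
        termwise j j<n = ≤-trans (≤-by (0≤* (0≤a j) (0≤+ (0≤- (h-upper j j<n))
          (0≤* (0≤^ 2 0≤ν) (0≤- (x[t³+t⁴]≤2t⁵ j)))))
            (solve 6 (λ a x c ν t h → con 1ℚ :* (a :* con 1ℚ) :+ ((c :- x) :* (a :* t) :+
              (:- (con ½ :* (x :* ν)) :* (a :* t :^ 2) :+ :- (con (+ 2 ℚ./ 1) :* ν :^ 2) :* (a :* t :^ 5)))
                :+ a :* (x :* (t :+ con ½ :* (ν :* t :^ 2) :+ ν :^ 2 :* (t :^ 3 :+ t :^ 4)) :- h :+ ν :^ 2
                  :* (con (+ 2 ℚ./ 1) :* t :^ 5 :- x :* (t :^ 3 :+ t :^ 4)))
              := a :* (con 1ℚ :+ (:- h :- :- (c :* t)))) refl (a j) x c ν (t j) (h j)))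
          (≤-trans (≤-reflexive (*-congʳ (sym (exp-t j)))) (exp≤w j))

      -- The truncated moments are completed by their tails, and `x` is replaced by the larger `c`
      -- in front of `T₂`. The constant is `20 = 6 + 6 + 8`: the tails `τ₀` and `δ τ₁`, and
      -- `2 A₅ ≤ 8 M`.
      δT₁-upper : δ * T₁ R ≤ ½# * (c * ν) * T₂ R + ι (+ 20 ℚ./ 1) * (M * ν ^ 2)
      δT₁-upper = ≤-by
        (0≤+ (0≤- δA₁-expansion) (0≤+ (0≤* 0≤½ (0≤* (0≤* 0≤δ 0≤ν) (0≤T₂ 0≤R)))
          (0≤+ (0≤* 0≤½ (0≤* (0≤* 0≤x 0≤ν) 0≤τ₂)) (0≤+ (0≤- τ₀≤)
          (0≤+ (0≤* 0≤δ (0≤- τ₁≤)) (0≤+ (0≤* (0≤* 0≤ι′ (0≤* 0≤M (0≤^ 2 0≤ν))) (0≤- δ≤1))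
            (0≤* (0≤* 0≤ι′ (0≤^ 2 0≤ν)) (0≤- A₅≤4M))))))))
        (trans (+-cong (*-congˡ T₁-split) (+-cong (+-congʳ T₀-split)
          (+-congʳ (*-congˡ (*-congˡ T₂-split)))))
          (trans (solve 11 (λ c x ν M A₀ A₁ A₂ A₅ τ₀ τ₁ τ₂ → (c :- x) :* (A₁ :+ τ₁)
              :+ ((A₀ :+ τ₀ :- (A₀ :+ ((c :- x) :* A₁ :+ (:- (con ½ :* (x :* ν)) :* A₂ :+ :-
                (con (+ 2 ℚ./ 1) :* ν :^ 2) :* A₅))))
               :+ (con ½ :* ((c :- x) :* ν :* (A₂ :+ τ₂)) :+ (con ½ :* (x :* ν :* τ₂) :+
                 (con (+ 6 ℚ./ 1) :* (M :* ν :^ 2) :- τ₀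
               :+ ((c :- x) :* (con (+ 6 ℚ./ 1) :* (M :* ν :^ 2) :- τ₁) :+ (con (+ 6 ℚ./ 1) :* (M :* ν :^ 2)
                 :* (con 1ℚ :- (c :- x))
               :+ con (+ 2 ℚ./ 1) :* ν :^ 2 :* (M :* con (+ 4 ℚ./ 1) :- A₅)))))))
              := con ½ :* (c :* ν) :* (A₂ :+ τ₂) :+ con (+ 20 ℚ./ 1) :* (M :* ν :^ 2)) refl c x ν M A₀ A₁ A₂
                A₅ τ₀ τ₁ τ₂)
            (+-congʳ (*-congˡ (sym T₂-split)))))

      25Mν : Carrier
      25Mν = 25# * (M * ν)

      ν²≤ν : ν ^ 2 ≤ ν
      ν²≤ν = ≤-by (0≤* 0≤ν (0≤- ν≤1)) (solve 1 (λ ν → ν :^ 2 :+ ν :* (con 1ℚ :- ν) := ν) refl ν)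

      0≤Y : 0# ≤ Y
      0≤Y = 0≤* (0≤* 0≤ι′ 0≤M) (0≤exp _)

      T₂≤10M : T₂ R ≤ ι (+ 10 ℚ./ 1) * M
      T₂≤10M = ≤-trans (≤-reflexive T₂-split)
        (≤-trans (+-mono A₂≤4M (≤-trans τ₂≤ (*-monoˡ _ 0≤ι′ (*-monoˡ M 0≤M (≤-trans ν²≤ν ν≤1)))))
        (≤-reflexive (solve 1 (λ M → M :* con (+ 4 ℚ./ 1) :+ con (+ 6 ℚ./ 1) :* (M :* con 1ℚ) := con
          (+ 10 ℚ./ 1) :* M) refl M)))

      -- `25 = 10/2 + 20`, from the upper estimate with `c ≤ 1`, `T₂ ≤ 10 M` and `ν^2 ≤ ν`; `T₁ ≥ 1`
      -- disposes of the factor on the left.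
      δ≤25Mν : δ ≤ 25Mν
      δ≤25Mν = ≤-trans (≤-trans (≤*ˡ 0≤δ (1≤T₁ 1≤R)) (≤-reflexive (*-comm _ _))) (≤-trans δT₁-upper
        (≤-trans (+-mono (*-mono (0≤* 0≤½ (0≤* 0≤c 0≤ν)) (0≤* 0≤ι′ 0≤M)
          (*-monoˡ ½# 0≤½ (*-mono 0≤c 0≤ν c≤1 ≤-refl)) T₂≤10M)
           (*-monoˡ _ 0≤ι′ (*-monoˡ M 0≤M ν²≤ν)))
         (≤-reflexive (solve 2 (λ M ν → con ½ :* (con 1ℚ :* ν) :* (con (+ 10 ℚ./ 1) :* M) :+ con
           (+ 20 ℚ./ 1) :* (M :* ν) := con (+ 25 ℚ./ 1) :* (M :* ν)) refl M ν))))

      -- Dropping the quadratic part of `h_j` leaves `w_j ≤ a_j exp (δ t_j)`, and `exp-secant`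
      -- linearises the last factor. The exponential that remains is bounded uniformly because
      -- `ν t_j ≤ 1`.
      w-upper : ∀ j → j ℕ.< n → w j ≤ a j * (1# + Y * (ν * t j))
      w-upper j j<n = ≤-trans (≤-trans (≤-reflexive (w≈exp j))
        (exp-mono (neg-mono (≤-trans (*-monoˡ x 0≤x (≤-by (0≤* 0≤½ (0≤* 0≤ν (0≤^ 2 (0≤t j)))) refl))
        (h-lower j j<n)))))
        (≤-trans (≤-reflexive (trans (exp-split (- (x * t j)) (- (c * t j))) (*-cong (exp-t j)
            (exp-cong (solve 3 (λ x c t → :- (x :* t) :- :- (c :* t) := (c :- x) :* t) refl x c (t j))))))
         (*-monoˡ (a j) (0≤a j) (≤-trans (exp-secant (δ * t j)) (+-mono ≤-refl (≤-trans
           (*-mono (0≤* 0≤δ (0≤t j)) (0≤exp _) δt≤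
             (exp-mono (≤-trans δt≤ (≤-trans (≤-reflexive eq)
             (≤-trans (*-monoˡ _ (0≤* 0≤ι′ 0≤M) (νt≤1 j j<n))
              (≤-reflexive (solve 1 (λ x → x :* con 1ℚ := x) refl (25# * M))))))))
           (≤-reflexive (solve 5 (λ k M ν t z → k :* (M :* ν) :* t :* z := k :* M :* z :* (ν :* t)) refl 25#
             M ν (t j) Z)))))))
        where
        δt≤ : δ * t j ≤ 25Mν * t j
        δt≤ = *-mono 0≤δ (0≤t j) δ≤25Mν ≤-refl
        eq : 25Mν * t j ≈ 25# * M * (ν * t j)
        eq = solve 4 (λ k M ν t → k :* (M :* ν) :* t := k :* M :* (ν :* t)) refl 25# M ν (t j)

      -- In the tangent inequality `h_j - c t_j` is at most `ν t^2 / 2 + ν^2 t^3 + ν^2 t^4`. As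
      -- `t ≥ 1`, `ν ≤ 1` and `ν t ≤ 1`, these terms are at most `1/2`, `1` and `1` times `ν t^3`;
      -- `3` rounds the total up.
      w-lower : ∀ j → j ℕ.< n → a j * (1# - ι (+ 3 ℚ./ 1) * (ν * t j ^ 3)) ≤ w j
      w-lower j j<n = ≤-trans (*-monoˡ (a j) (0≤a j)
        (≤-by (0≤+ (0≤- (h-upper j j<n)) (0≤+ (0≤* 0≤δ 0≤tj) (0≤+ (0≤* (0≤- x≤1) 0≤B)
            (0≤+ (0≤* (0≤* 0≤½ (0≤* 0≤ν (0≤^ 2 0≤tj))) (0≤- (1≤t j))) (0≤+ (0≤* (0≤* 0≤½ 0≤ν) (0≤^ 3 0≤tj))
              (0≤+ (0≤* (0≤* 0≤ν (0≤^ 3 0≤tj)) (0≤- (νt≤1 j j<n))) (0≤* (0≤* 0≤ν (0≤^ 3 0≤tj))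
              (0≤- ν≤1))))))))
          (solve 5 (λ x c ν t h → con 1ℚ :- con (+ 3 ℚ./ 1) :* (ν :* t :^ 3) :+
              ((x :* (t :+ con ½ :* (ν :* t :^ 2) :+ ν :^ 2 :* (t :^ 3 :+ t :^ 4)) :- h) :+
                ((c :- x) :* t :+ ((con 1ℚ :- x) :* (con ½ :* (ν :* t :^ 2) :+ ν :^ 2 :* (t :^ 3 :+ t :^ 4))
               :+ (con ½ :* (ν :* t :^ 2) :* (t :- con 1ℚ) :+ (con ½ :* ν :* t :^ 3 :+
                 (ν :* t :^ 3 :* (con 1ℚ :- ν :* t) :+ ν :* t :^ 3 :* (con 1ℚ :- ν)))))))
             := con 1ℚ :+ (:- h :- :- (c :* t))) refl x c ν (t j) (h j))))
        (≤-trans (≤-reflexive (*-congʳ (sym (exp-t j)))) (exp≤w j))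
        where
        0≤tj = 0≤t j
        0≤B : 0# ≤ ½# * (ν * t j ^ 2) + ν ^ 2 * (t j ^ 3 + t j ^ 4)
        0≤B = 0≤+ (0≤* 0≤½ (0≤* 0≤ν (0≤^ 2 0≤tj))) (0≤* (0≤^ 2 0≤ν) (0≤+ (0≤^ 3 0≤tj) (0≤^ 4 0≤tj)))

      W₁-upper : W₁ ≤ 1# * A₁ + (Y * ν) * A₂
      W₁-upper = ≤-trans (∑-mono n (λ j j<n → ≤-trans (*-mono (0≤w j) (0≤t j) (w-upper j j<n) ≤-refl)
          (≤-reflexive (solve 4 (λ a y ν t → a :* (con 1ℚ :+ y :* (ν :* t)) :* t := con 1ℚ :* (a :* t) :+
            (y :* ν) :* (a :* t :^ 2)) refl (a j) Y ν (t j)))))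
        (≤-reflexive (∑-linear n 1# (Y * ν) (λ j → a j * t j) (λ j → a j * t j ^ 2)))

      W₂-lower : 1# * A₂ + (- (ι (+ 3 ℚ./ 1) * ν)) * A₅ ≤ W₂
      W₂-lower = ≤-trans (≤-reflexive (sym (∑-linear n 1# (- (ι (+ 3 ℚ./ 1) * ν)) (λ j → a j * t j ^ 2)
        (λ j → a j * t j ^ 5))))
        (∑-mono n (λ j j<n → ≤-trans (≤-reflexive
          (solve 3 (λ a ν t → con 1ℚ :* (a :* t :^ 2) :+ (:- (con (+ 3 ℚ./ 1) :* ν)) :* (a :* t :^ 5)
             := t :^ 2 :* (a :* (con 1ℚ :- con (+ 3 ℚ./ 1) :* (ν :* t :^ 3)))) refl (a j) ν (t j)))
           (≤-trans (*-monoˡ _ (0≤^ 2 (0≤t j)) (w-lower j j<n)) (≤-reflexive (*-comm _ _)))))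

      -- `125 = 25 * 10 / 2` is the price of replacing `c` by `x`, via `δ T₂ ≤ 25 M ν * 10 M`, and
      -- `9 = 6/2 + 4 * 3/2` that of the tail `τ₂` and of `A₅`.
      ½cνT₂-upper : ½# * (c * ν) * T₂ R ≤
        ½# * (x * ν) * (1# * A₂ + (- (ι (+ 3 ℚ./ 1) * ν)) * A₅) + (ι (+ 125 ℚ./ 1) * M ^ 2 + ι (+ 9 ℚ./ 1) *
          M) * ν ^ 2
      ½cνT₂-upper = ≤-by
        (0≤+ (0≤* (0≤* 0≤½ 0≤ν) (0≤- δT₂≤)) (0≤+ (0≤* 0≤½ (0≤- xντ₂≤)) (0≤* (0≤* 0≤ι′ (0≤^ 2 0≤ν))
          (0≤- xA₅≤))))
        (trans (+-congʳ (*-congˡ T₂-split))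
          (trans (+-congˡ (+-congʳ (*-congˡ (+-congˡ (-‿cong (*-congˡ T₂-split))))))
          (solve 7 (λ c x ν M A₂ A₅ τ₂ →
              con ½ :* (c :* ν) :* (A₂ :+ τ₂)
              :+ (con ½ :* ν :* (con (+ 25 ℚ./ 1) :* (M :* ν) :* (con (+ 10 ℚ./ 1) :* M) :- (c :- x) :*
                (A₂ :+ τ₂))
              :+ (con ½ :* (con (+ 6 ℚ./ 1) :* (M :* ν :^ 2) :- x :* ν :* τ₂) :+ con (+ 3 ℚ./ 2) :* ν :^ 2
                :* (M :* con (+ 4 ℚ./ 1) :- x :* A₅)))
              := con ½ :* (x :* ν) :* (con 1ℚ :* A₂ :+ (:- (con (+ 3 ℚ./ 1) :* ν)) :* A₅) :+
                (con (+ 125 ℚ./ 1) :* M :^ 2 :+ con (+ 9 ℚ./ 1) :* M) :* ν :^ 2)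
              refl c x ν M A₂ A₅ τ₂)))
        where
        δT₂≤ : δ * T₂ R ≤ 25Mν * (ι (+ 10 ℚ./ 1) * M)
        δT₂≤ = *-mono 0≤δ (0≤* 0≤ι′ 0≤M) δ≤25Mν T₂≤10M
        xντ₂≤ : x * ν * τ₂ ≤ 6Mν²
        xντ₂≤ = ≤-trans (*-mono (0≤* 0≤x 0≤ν) (0≤* 0≤ι′ (0≤* 0≤M (0≤^ 2 0≤ν))) (*-mono 0≤x 0≤1 x≤1 ν≤1) τ₂≤)
          (≤-reflexive (solve 1 (λ y → con 1ℚ :* con 1ℚ :* y := y) refl 6Mν²))
        xA₅≤ : x * A₅ ≤ M * 4#
        xA₅≤ = ≤-trans (*-mono 0≤x (0≤* 0≤M 0≤ι′) x≤1 A₅≤4M) (≤-reflexive (*-identityˡ _))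

      -- The inequality `½xνW₂≤δW₁` passes from a lower bound on `W₂` to an upper bound on `W₁`. In
      -- `δ Y ν A₂` the bounds on `δ` and `A₂` contribute `100 = 25 * 4`.
      δT₁-lower : ½# * (c * ν) * T₂ R ≤ δ * T₁ R + C′ * ν ^ 2
      δT₁-lower = ≤-trans ½cνT₂-upper (≤-trans (+-mono (≤-trans (*-monoˡ _ (0≤* 0≤½ (0≤* 0≤x 0≤ν)) W₂-lower)
          (≤-trans ½xνW₂≤δW₁ (≤-trans (*-monoˡ δ 0≤δ W₁-upper) δA₁+δYνA₂≤))) ≤-refl)
        (≤-reflexive (solve 4 (λ d k l ν → d :+ k :* ν :^ 2 :+ l :* ν :^ 2 := d :+ (k :+ l) :* ν :^ 2) refl
          (δ * T₁ R) (ι (+ 100 ℚ./ 1) * (M ^ 2 * Y)) (ι (+ 125 ℚ./ 1) * M ^ 2 + ι (+ 9 ℚ./ 1) * M) ν)))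
        where
        δA₁+δYνA₂≤ : δ * (1# * A₁ + (Y * ν) * A₂) ≤ δ * T₁ R + ι (+ 100 ℚ./ 1) * (M ^ 2 * Y) * ν ^ 2
        δA₁+δYνA₂≤ = ≤-trans (≤-reflexive (solve 4 (λ δ A y B → δ :* (con 1ℚ :* A :+ y :* B) := δ :* A :+ y
          :* (δ :* B)) refl δ A₁ (Y * ν) A₂))
          (≤-trans (+-mono (*-monoˡ δ 0≤δ (≤-by 0≤τ₁ (sym T₁-split)))
              (*-monoˡ (Y * ν) (0≤* 0≤Y 0≤ν) (*-mono 0≤δ (0≤* 0≤M 0≤ι′) δ≤25Mν A₂≤4M)))
            (≤-reflexive (solve 4 (λ d M Y ν → d :+ Y :* ν :* (con (+ 25 ℚ./ 1) :* (M :* ν) :*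
              (M :* con (+ 4 ℚ./ 1)))
               := d :+ con (+ 100 ℚ./ 1) :* (M :^ 2 :* Y) :* ν :^ 2) refl (δ * T₁ R) M Y ν)))

      module Conclusion (k m c₂ : Carrier) (0≤m : 0# ≤ m) (mν≈1 : m * ν ≈ 1#) (xm≈k : x * m ≈ k)
        (c₂T₁ : c₂ * T₁ R ≈ - (c * ½#) * T₂ R) where

        private
          y = k - (c * m + c₂)

          0≤20M : 0# ≤ ι (+ 20 ℚ./ 1) * M
          0≤20M = 0≤* 0≤ι′ 0≤M

          0≤C′ : 0# ≤ C′
          0≤C′ = 0≤+ (0≤* 0≤ι′ (0≤* (0≤^ 2 0≤M) 0≤Y)) (0≤+ (0≤* 0≤ι′ (0≤^ 2 0≤M)) (0≤* 0≤ι′ 0≤M))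

          0≤Cν : 0# ≤ C * ν
          0≤Cν = 0≤* (0≤+ 0≤20M 0≤C′) 0≤ν

          -- Multiplied by `T₁`, the error in the theorem is `m` times the quantity that the two
          -- estimates confine to multiples of `ν^2`; cancelling `T₁ ≥ 1` then leaves a multiple of
          -- `ν`.
          yT₁ : y * T₁ R ≈ m * (½# * (c * ν) * T₂ R - δ * T₁ R)
          yT₁ = trans (*-congʳ (+-congʳ (sym xm≈k)))
            (trans (solve 5 (λ x m c e T → (x :* m :- (c :* m :+ e)) :* T := (x :- c) :* m :* T :- e :* T)
            refl x m c c₂ (T₁ R))
            (trans (+-congˡ (-‿cong c₂T₁))
              (trans (solve 6 (λ x m c T T′ h → (x :- c) :* m :* T :- (:- (c :* h) :* T′) := h :* c :* T′ :*
              con 1ℚ :- m :* (c :- x) :* T) refl x m c (T₁ R) (T₂ R) ½#)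
            (trans (+-congʳ (*-congˡ (sym mν≈1)))
              (solve 7 (λ x m c T T′ h ν → h :* c :* T′ :* (m :* ν) :- m :* (c :- x) :* T := m :*
                (h :* (c :* ν) :* T′ :- (c :- x) :* T)) refl x m c (T₁ R) (T₂ R) ½# ν)))))

          mν²≈ν : ∀ K → m * (K * ν ^ 2) ≈ K * ν
          mν²≈ν K = trans (solve 3 (λ m K ν → m :* (K :* ν :^ 2) := K :* ν :* (m :* ν)) refl m K ν)
            (trans (*-congˡ mν≈1) (solve 1 (λ x → x :* con 1ℚ := x) refl (K * ν)))

        upper-bound : k - (c * m + c₂) ≤ C * ν
        upper-bound = *≤⇒≤ (1≤T₁ 1≤R) 0≤Cν (≤-trans (≤-reflexive yT₁) (≤-trans (*-monoˡ m 0≤m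
            (≤-by (0≤- δT₁-lower) (solve 3 (λ p q r → p :- q :+ (q :+ r :- p) := r) refl _ _ (C′ * ν ^ 2))))
          (≤-trans (≤-reflexive (mν²≈ν C′))
            (≤-by (0≤* 0≤20M 0≤ν) (solve 3 (λ a b ν → b :* ν :+ a :* ν := (a :+ b) :* ν) refl
            (ι (+ 20 ℚ./ 1) * M) C′ ν)))))

        lower-bound : - (k - (c * m + c₂)) ≤ C * ν
        lower-bound = *≤⇒≤ (1≤T₁ 1≤R) 0≤Cν
          (≤-trans (≤-reflexive (trans (solve 2 (λ y T → :- y :* T := :- (y :* T)) refl y (T₁ R))
          (trans (-‿cong yT₁)
              (solve 3 (λ m p q → :- (m :* (p :- q)) := m :* (q :- p)) refl m (½# * (c * ν) * T₂ R)
                (δ * T₁ R)))))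
          (≤-trans (*-monoˡ m 0≤m (≤-by (0≤- δT₁-upper)
            (solve 4 (λ p q M ν → p :- q :+ (q :+ con (+ 20 ℚ./ 1) :* (M :* ν) :- p) := con (+ 20 ℚ./ 1) :*
            M :* ν) refl _ _ M (ν ^ 2))))
          (≤-trans (≤-reflexive (mν²≈ν (ι (+ 20 ℚ./ 1) * M)))
            (≤-by (0≤* 0≤C′ 0≤ν) (solve 3 (λ a b ν → a :* ν :+ b :* ν := (a :+ b) :* ν) refl
            (ι (+ 20 ℚ./ 1) * M) C′ ν)))))

-- The Cauchy reals as an ordered ℚ-algebra

open import Defs
open import Relation.Binary.PropositionalEquality
  using (refl; sym; trans; cong; cong₂; subst; module ≡-Reasoning)

open RationalLemmas using (scale; 0<half; half+half; ∣-∣-sym; cauchy-bounded; ∣∣≤; *-monoˡ; *-monoʳ;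
  0≤+; 0≤*; p≤p+q; 0≤fromℕℚ; fromℕℚ-suc; fromℕℚ-+; fromℕℚ-*; fromℕℚ-mono; suc*1/suc)

Eventually : (ℕ → Set) → Set
Eventually P = ∃[ N ] ∀ n → N ℕ.≤ n → P n

always : ∀ {P : ℕ → Set} → (∀ n → P n) → Eventually P
always p = 0 , λ n _ → p n

map₁ : ∀ {P Q : ℕ → Set} → (∀ n → P n → Q n) → Eventually P → Eventually Q
map₁ f (N , p) = N , λ n N≤n → f n (p n N≤n)

map₂ : ∀ {P Q R : ℕ → Set} → (∀ n → P n → Q n → R n) → Eventually P → Eventually Q → Eventually R
map₂ f (N , p) (M , q) = N ℕ.⊔ M , λ n h →
  f n (p n (ℕₚ.m⊔n≤o⇒m≤o N M h)) (q n (ℕₚ.m⊔n≤o⇒n≤o N M h))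

map₄ : ∀ {P Q R S T : ℕ → Set} → (∀ n → P n → Q n → R n → S n → T n) →
  Eventually P → Eventually Q → Eventually R → Eventually S → Eventually T
map₄ f p q r s = map₂ (λ n (p , q) (r , s) → f n p q r s) (map₂ (λ _ → _,_) p q) (map₂ (λ _ → _,_) r s)

bounded : ∀ x → ∃[ K ] Eventually (λ n → ℚ.∣ seq x n ∣ ℚ.≤ fromℕℚ K)
bounded x = cauchy-bounded (seq x) (cauchy x)

pointwise-≈ : ∀ x y → (∀ n → seq x n ≡ seq y n) → x ≈ y
pointwise-≈ x y h ε 0<ε = always λ n → subst (λ z → ℚ.∣ seq x n ℚ.- z ∣ ℚ.≤ ε) (h n)
  (subst (ℚ._≤ ε) (cong ℚ.∣_∣ (sym (ℚₚ.+-inverseʳ (seq x n)))) (ℚₚ.<⇒≤ 0<ε))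

eventually-≤ : ∀ x y → Eventually (λ n → seq x n ℚ.≤ seq y n) → x ≤ y
eventually-≤ x y h ε 0<ε = map₁ (λ n h → ℚₚ.≤-trans h (RationalLemmas.p≤p+q (ℚₚ.<⇒≤ 0<ε))) h

p≤∣p∣ : ∀ p → p ℚ.≤ ℚ.∣ p ∣
p≤∣p∣ p with ℚₚ.≤-total 0ℚ p
... | inj₁ h = ℚₚ.≤-reflexive (sym (ℚₚ.0≤p⇒∣p∣≡p h))
... | inj₂ h = ℚₚ.≤-trans h (ℚₚ.0≤∣p∣ p)

0≤p² : ∀ p → 0ℚ ℚ.≤ p ℚ.* p
0≤p² p with ℚₚ.≤-total 0ℚ p
... | inj₁ 0≤p = RationalLemmas.0≤* 0≤p 0≤p
... | inj₂ p≤0 = subst (0ℚ ℚ.≤_) (solve 1 (λ p → :- p :* :- p := p :* p) refl p)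
  (RationalLemmas.0≤* (ℚₚ.neg-antimono-≤ p≤0) (ℚₚ.neg-antimono-≤ p≤0))
  where open +-*-Solver

∣p-q∣≤⇒p≤q+r : ∀ {p q r} → ℚ.∣ p ℚ.- q ∣ ℚ.≤ r → p ℚ.≤ q ℚ.+ r
∣p-q∣≤⇒p≤q+r {p} {q} {r} h = ℚₚ.≤-trans (ℚₚ.≤-reflexive (solve 2 (λ p q → p := q :+ (p :- q)) refl p q))
  (ℚₚ.+-monoʳ-≤ q (ℚₚ.≤-trans (p≤∣p∣ (p ℚ.- q)) h))
  where open +-*-Solver

≤+⇒∣-∣≤ : ∀ {p q r} → p ℚ.≤ q ℚ.+ r → q ℚ.≤ p ℚ.+ r → ℚ.∣ p ℚ.- q ∣ ℚ.≤ r
≤+⇒∣-∣≤ {p} {q} {r} h k = ∣∣≤ (RationalLemmas.p≤q+r⇒p-q≤r h)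
  (subst (ℚ._≤ r) (solve 2 (λ p q → q :- p := :- (p :- q)) refl p q) (RationalLemmas.p≤q+r⇒p-q≤r k))
  where open +-*-Solver

≈⇒≤ : ∀ {x y} → x ≈ y → x ≤ y
≈⇒≤ x≈y ε 0<ε = map₁ (λ _ → ∣p-q∣≤⇒p≤q+r) (x≈y ε 0<ε)

≤-antisym : ∀ {x y} → x ≤ y → y ≤ x → x ≈ y
≤-antisym x≤y y≤x ε 0<ε = map₂ (λ _ → ≤+⇒∣-∣≤) (x≤y ε 0<ε) (y≤x ε 0<ε)

≈-isEquivalence : IsEquivalence _≈_
≈-isEquivalence = record
  { refl  = λ {x} → pointwise-≈ x x (λ _ → refl)
  ; sym   = λ {x} {y} h ε 0<ε → map₁ (λ n → subst (ℚ._≤ ε) (∣-∣-sym (seq x n) (seq y n))) (h ε 0<ε)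
  ; trans = λ {x} {y} {z} h k ε 0<ε → map₂ (λ n p q → ℚₚ.≤-trans (RationalLemmas.triangle (seq x n)
    (seq y n) (seq z n))
      (ℚₚ.≤-trans (ℚₚ.+-mono-≤ p q) (ℚₚ.≤-reflexive (half+half ε)))) (h (½ ℚ.* ε) (0<half 0<ε))
        (k (½ ℚ.* ε) (0<half 0<ε))
  }

private
  ½+½ : ∀ {a c} b d ε → a ℚ.≤ b ℚ.+ ½ ℚ.* ε → c ℚ.≤ d ℚ.+ ½ ℚ.* ε → a ℚ.+ c ℚ.≤ b ℚ.+ d ℚ.+ ε
  ½+½ b d ε h k = ℚₚ.≤-trans (ℚₚ.+-mono-≤ h k) (ℚₚ.≤-reflexive
    (solve 3 (λ b d e → (b :+ con ½ :* e) :+ (d :+ con ½ :* e) := b :+ d :+ e) refl b d ε))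
    where open +-*-Solver

ℝ-≤-trans : ∀ {x y z} → x ≤ y → y ≤ z → x ≤ z
ℝ-≤-trans {x} {y} {z} h k ε 0<ε = map₂ (λ n p q → ℚₚ.≤-trans p (ℚₚ.≤-trans (ℚₚ.+-monoˡ-≤ (½ ℚ.* ε) q)
    (ℚₚ.≤-reflexive (trans (ℚₚ.+-assoc (seq z n) (½ ℚ.* ε) (½ ℚ.* ε)) (cong (λ e → seq z n ℚ.+ e)
      (half+half ε))))))
  (h (½ ℚ.* ε) (0<half 0<ε)) (k (½ ℚ.* ε) (0<half 0<ε))

ℝ-+-mono : ∀ {x y u v} → x ≤ y → u ≤ v → x + u ≤ y + v
ℝ-+-mono {x} {y} {u} {v} h k ε 0<ε = map₂ (λ n → ½+½ (seq y n) (seq v n) ε) (h (½ ℚ.* ε) (0<half 0<ε))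
  (k (½ ℚ.* ε) (0<half 0<ε))

ℝ-+-cong : ∀ {x y u v} → x ≈ y → u ≈ v → x + u ≈ y + v
ℝ-+-cong {x} {y} {u} {v} h k = ≤-antisym {x + u} {y + v}
  (ℝ-+-mono {x} {y} {u} {v} (≈⇒≤ {x} {y} h) (≈⇒≤ {u} {v} k))
  (ℝ-+-mono {y} {x} {v} {u} (≈⇒≤ {y} {x} (sym′ {x} {y} h)) (≈⇒≤ {v} {u} (sym′ {u} {v} k)))
  where open IsEquivalence ≈-isEquivalence renaming (sym to sym′)

ℝ-neg-cong : ∀ {x y} → x ≈ y → - x ≈ - y
ℝ-neg-cong {x} {y} h ε 0<ε = map₁ (λ n → subst (ℚ._≤ ε) (trans (∣-∣-sym (seq x n) (seq y n))
  (cong ℚ.∣_∣ (solve 2 (λ p q → q :- p := :- p :- :- q) refl (seq x n) (seq y n))))) (h ε 0<ε)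
  where open +-*-Solver

ℝ-*-cong : ∀ {x y u v} → x ≈ y → u ≈ v → x * u ≈ y * v
ℝ-*-cong {x} {y} {u} {v} h k ε 0<ε =
  let K , x≤K = bounded x
      L , v≤L = bounded v
      δ , 0<δ , Aδ≤ε = scale (fromℕℚ K ℚ.+ fromℕℚ L) ε (RationalLemmas.0≤+ (0≤fromℕℚ K) (0≤fromℕℚ L)) 0<ε
  in map₄ (λ n p q r s → ℚₚ.≤-trans (RationalLemmas.∣ac-bd∣≤ (seq x n) (seq y n) (seq u n) (seq v n)
       (0≤fromℕℚ K) (ℚₚ.<⇒≤ 0<δ) p q r s) Aδ≤ε) x≤K v≤L (h δ 0<δ) (k δ 0<δ)

-- Approximants of non-negative reals may be slightly negative, so the product is formed after
-- adding `η` to both. The extra terms are at most `(K + L + 1) η`, since `η ≤ 1`.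
ℝ-0≤* : ∀ {x y} → 0ℝ ≤ x → 0ℝ ≤ y → 0ℝ ≤ x * y
ℝ-0≤* {x} {y} h k ε 0<ε =
  let K , x≤K = bounded x
      L , y≤L = bounded y
      B = fromℕℚ K ℚ.+ fromℕℚ L ℚ.+ 1ℚ
      δ , 0<δ , Bδ≤ε = scale B ε (RationalLemmas.0≤+ (RationalLemmas.0≤+ (0≤fromℕℚ K) (0≤fromℕℚ L)) 0≤1ℚ)
        0<ε
      η = δ ℚ.⊓ 1ℚ
      0<η = ⊓-pos 0<δ
  in map₄ (λ n p q r s → begin
       0ℚ                                       ≤⟨ RationalLemmas.0≤* r s ⟩
       (seq x n ℚ.+ η) ℚ.* (seq y n ℚ.+ η)      ≡⟨ solve 3 (λ x y e → (x :+ e) :* (y :+ e) := x :* y :+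
         (x :+ y :+ e) :* e) refl (seq x n) (seq y n) η ⟩
       seq x n ℚ.* seq y n ℚ.+ (seq x n ℚ.+ seq y n ℚ.+ η) ℚ.* η
         ≤⟨ ℚₚ.+-monoʳ-≤ (seq x n ℚ.* seq y n) (RationalLemmas.*-monoʳ η (ℚₚ.<⇒≤ 0<η)
             (ℚₚ.+-mono-≤ (ℚₚ.+-mono-≤ (ℚₚ.≤-trans (p≤∣p∣ (seq x n)) p) (ℚₚ.≤-trans (p≤∣p∣ (seq y n)) q))
               (ℚₚ.p⊓q≤q δ 1ℚ))) ⟩
       seq x n ℚ.* seq y n ℚ.+ B ℚ.* η
         ≤⟨ ℚₚ.+-monoʳ-≤ (seq x n ℚ.* seq y n)
           (ℚₚ.≤-trans (*-monoˡ B (RationalLemmas.0≤+ (RationalLemmas.0≤+ (0≤fromℕℚ K) (0≤fromℕℚ L)) 0≤1ℚ)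
           (ℚₚ.p⊓q≤p δ 1ℚ)) Bδ≤ε) ⟩
       seq x n ℚ.* seq y n ℚ.+ ε                ∎)
     x≤K y≤L (h η 0<η) (k η 0<η)
  where
  open +-*-Solver
  open ℚₚ.≤-Reasoning
  0≤1ℚ = ℚₚ.<⇒≤ (ℚₚ.positive⁻¹ 1ℚ)
  ⊓-pos : ∀ {δ} → 0ℚ ℚ.< δ → 0ℚ ℚ.< δ ℚ.⊓ 1ℚ
  ⊓-pos {δ} 0<δ with ℚₚ.⊓-sel δ 1ℚ
  ... | inj₁ eq = subst (0ℚ ℚ.<_) (sym eq) 0<δ
  ... | inj₂ eq = subst (0ℚ ℚ.<_) (sym eq) (ℚₚ.positive⁻¹ 1ℚ)

-- The sign that is undecidable for a real is decidable for each rational approximant, so the case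
-- distinction is made index by index.
ℝ-*≤⇒≤ : ∀ {x y z} → 1ℝ ≤ y → 0ℝ ≤ z → x * y ≤ z → x ≤ z
ℝ-*≤⇒≤ {x} {y} {z} 1≤y 0≤z xy≤z ε 0<ε =
  let K , x≤K = bounded x
      δ , 0<δ , Aδ≤ε = scale (fromℕℚ K ℚ.+ 1ℚ) ε (RationalLemmas.0≤+ (0≤fromℕℚ K) 0≤1ℚ) 0<ε
  in map₄ (λ n p q r s → bound n 0<δ Aδ≤ε (ℚₚ.≤-trans (p≤∣p∣ (seq x n)) p) q r s) x≤K (1≤y δ 0<δ)
      (0≤z ε 0<ε) (xy≤z δ 0<δ)
  where
  open +-*-Solver
  open ℚₚ.≤-Reasoning
  0≤1ℚ = ℚₚ.<⇒≤ (ℚₚ.positive⁻¹ 1ℚ)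
  bound : ∀ n {δ K} → 0ℚ ℚ.< δ → (K ℚ.+ 1ℚ) ℚ.* δ ℚ.≤ ε → seq x n ℚ.≤ K → 1ℚ ℚ.≤ seq y n ℚ.+ δ →
    0ℚ ℚ.≤ seq z n ℚ.+ ε → seq x n ℚ.* seq y n ℚ.≤ seq z n ℚ.+ δ → seq x n ℚ.≤ seq z n ℚ.+ ε
  bound n {δ} {K} 0<δ Aδ≤ε x≤K 1≤y 0≤z xy≤z with ℚₚ.≤-total (seq x n) 0ℚ
  ... | inj₁ x≤0 = ℚₚ.≤-trans x≤0 0≤z
  ... | inj₂ 0≤x = begin
    seq x n                                     ≡⟨ ℚₚ.*-identityʳ (seq x n) ⟨
    seq x n ℚ.* 1ℚ                              ≤⟨ *-monoˡ (seq x n) 0≤x 1≤y ⟩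
    seq x n ℚ.* (seq y n ℚ.+ δ)                 ≡⟨ ℚₚ.*-distribˡ-+ (seq x n) (seq y n) δ ⟩
    seq x n ℚ.* seq y n ℚ.+ seq x n ℚ.* δ       ≤⟨ ℚₚ.+-mono-≤ xy≤z (RationalLemmas.*-monoʳ δ (ℚₚ.<⇒≤ 0<δ)
      x≤K) ⟩
    seq z n ℚ.+ δ ℚ.+ K ℚ.* δ                   ≡⟨ solve 3 (λ z d k → z :+ d :+ k :* d := z :+ (k :+ con 1ℚ)
      :* d) refl (seq z n) δ K ⟩
    seq z n ℚ.+ (K ℚ.+ 1ℚ) ℚ.* δ                ≤⟨ ℚₚ.+-monoʳ-≤ (seq z n) Aδ≤ε ⟩
    seq z n ℚ.+ ε                               ∎

ℝ-isCommutativeRing : IsCommutativeRing _≈_ _+_ _*_ -_ 0ℝ 1ℝ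
ℝ-isCommutativeRing = record
  { isRing = record
    { +-isAbelianGroup = record
      { isGroup = record
        { isMonoid = record
          { isSemigroup = record
            { isMagma = record
              { isEquivalence = ≈-isEquivalence
              ; ∙-cong = λ {x} {y} {u} {v} → ℝ-+-cong {x} {y} {u} {v} }
            ; assoc = λ x y z → pointwise-≈ (x + y + z) (x + (y + z)) (λ n → ℚₚ.+-assoc (seq x n) (seq y n)
              (seq z n)) }
          ; identity = (λ x → pointwise-≈ (0ℝ + x) x (λ n → ℚₚ.+-identityˡ (seq x n)))
                     , (λ x → pointwise-≈ (x + 0ℝ) x (λ n → ℚₚ.+-identityʳ (seq x n))) }
        ; inverse = (λ x → pointwise-≈ (- x + x) 0ℝ (λ n → ℚₚ.+-inverseˡ (seq x n)))
                  , (λ x → pointwise-≈ (x - x) 0ℝ (λ n → ℚₚ.+-inverseʳ (seq x n)))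
        ; ⁻¹-cong = λ {x} {y} → ℝ-neg-cong {x} {y} }
      ; comm = λ x y → pointwise-≈ (x + y) (y + x) (λ n → ℚₚ.+-comm (seq x n) (seq y n)) }
    ; *-cong = λ {x} {y} {u} {v} → ℝ-*-cong {x} {y} {u} {v}
    ; *-assoc = λ x y z → pointwise-≈ (x * y * z) (x * (y * z)) (λ n → ℚₚ.*-assoc (seq x n) (seq y n)
      (seq z n))
    ; *-identity = (λ x → pointwise-≈ (1ℝ * x) x (λ n → ℚₚ.*-identityˡ (seq x n)))
                 , (λ x → pointwise-≈ (x * 1ℝ) x (λ n → ℚₚ.*-identityʳ (seq x n)))
    ; distrib = (λ x y z → pointwise-≈ (x * (y + z)) (x * y + x * z) (λ n → ℚₚ.*-distribˡ-+ (seq x n)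
      (seq y n) (seq z n)))
              , (λ x y z → pointwise-≈ ((y + z) * x) (y * x + z * x) (λ n → ℚₚ.*-distribʳ-+ (seq x n)
                (seq y n) (seq z n))) }
  ; *-comm = λ x y → pointwise-≈ (x * y) (y * x) (λ n → ℚₚ.*-comm (seq x n) (seq y n))
  }

ℝ-algebra : OrderedℚAlgebra
ℝ-algebra = record
  { Carrier = ℝ ; _≈_ = _≈_ ; _≤_ = _≤_ ; _+_ = _+_ ; _*_ = _*_ ; -_ = -_ ; ι = fromℚ
  ; isCommutativeRing = ℝ-isCommutativeRing
  ; ι-+ = λ p q → pointwise-≈ (fromℚ (p ℚ.+ q)) (fromℚ p + fromℚ q) (λ _ → refl)
  ; ι-* = λ p q → pointwise-≈ (fromℚ (p ℚ.* q)) (fromℚ p * fromℚ q) (λ _ → refl)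
  ; ι-neg = λ p → pointwise-≈ (fromℚ (ℚ.- p)) (- fromℚ p) (λ _ → refl)
  ; ι-mono = λ {p} {q} p≤q → eventually-≤ (fromℚ p) (fromℚ q) (always (λ _ → p≤q))
  ; ≤-reflexive = λ {x} {y} → ≈⇒≤ {x} {y}
  ; ≤-trans = λ {x} {y} {z} → ℝ-≤-trans {x} {y} {z}
  ; +-mono = λ {x} {y} {u} {v} → ℝ-+-mono {x} {y} {u} {v}
  ; 0≤* = λ {x} {y} → ℝ-0≤* {x} {y}
  ; *≤⇒≤ = λ {x} {y} {z} → ℝ-*≤⇒≤ {x} {y} {z}
  }

-- The exponential series: functional equation and tangent inequality

sumTo : ℕ → (ℕ → ℚ) → ℚ
sumTo zero    f = 0ℚ
sumTo (suc n) f = sumTo n f ℚ.+ f n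

sumTo-cong : ∀ n {f g} → (∀ i → i ℕ.< n → f i ≡ g i) → sumTo n f ≡ sumTo n g
sumTo-cong zero    h = refl
sumTo-cong (suc n) h = cong₂ ℚ._+_ (sumTo-cong n (λ i i<n → h i (ℕₚ.m<n⇒m<1+n i<n))) (h n ℕₚ.≤-refl)

sumTo-mono : ∀ n {f g} → (∀ i → i ℕ.< n → f i ℚ.≤ g i) → sumTo n f ℚ.≤ sumTo n g
sumTo-mono zero    h = ℚₚ.≤-refl
sumTo-mono (suc n) h = ℚₚ.+-mono-≤ (sumTo-mono n (λ i i<n → h i (ℕₚ.m<n⇒m<1+n i<n))) (h n ℕₚ.≤-refl)

sumTo-+ : ∀ n f g → sumTo n (λ i → f i ℚ.+ g i) ≡ sumTo n f ℚ.+ sumTo n g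
sumTo-+ zero    f g = refl
sumTo-+ (suc n) f g = trans (cong (ℚ._+ (f n ℚ.+ g n)) (sumTo-+ n f g))
  (solve 4 (λ a b c d → (a :+ b) :+ (c :+ d) := (a :+ c) :+ (b :+ d)) refl (sumTo n f) (sumTo n g) (f n)
    (g n))
  where open +-*-Solver

sumTo-*ʳ : ∀ n f a → sumTo n (λ i → f i ℚ.* a) ≡ sumTo n f ℚ.* a
sumTo-*ʳ zero    f a = sym (ℚₚ.*-zeroˡ a)
sumTo-*ʳ (suc n) f a = trans (cong (ℚ._+ f n ℚ.* a) (sumTo-*ʳ n f a))
  (sym (ℚₚ.*-distribʳ-+ a (sumTo n f) (f n)))

sumTo-shift : ∀ n f → sumTo (suc n) f ≡ f 0 ℚ.+ sumTo n (λ i → f (suc i))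
sumTo-shift zero    f = ℚₚ.+-comm 0ℚ (f 0)
sumTo-shift (suc n) f = trans (cong (ℚ._+ f (suc n)) (sumTo-shift n f))
  (ℚₚ.+-assoc (f 0) (sumTo n (λ i → f (suc i))) (f (suc n)))

sumTo-monoˡ : ∀ {n m f} → (∀ i → 0ℚ ℚ.≤ f i) → n ℕ.≤ m → sumTo n f ℚ.≤ sumTo m f
sumTo-monoˡ {f = f} 0≤f = RationalLemmas.increasing (λ n → sumTo n f) {0} (λ n _ → RationalLemmas.p≤p+q
  (0≤f n)) z≤n

expSum≡sumTo : ∀ x n → expSum x n ≡ sumTo n (expTerm x)
expSum≡sumTo x zero    = refl
expSum≡sumTo x (suc n) = cong (ℚ._+ expTerm x n) (expSum≡sumTo x n)

suc*expTerm-suc : ∀ x n → fromℕℚ (suc n) ℚ.* expTerm x (suc n) ≡ x ℚ.* expTerm x n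
suc*expTerm-suc x n = trans (solve 4 (λ s t x r → s :* (t :* (x :* r)) := (x :* t) :* (s :* r)) refl
  (fromℕℚ (suc n)) (expTerm x n) x (1/suc n))
  (trans (cong ((x ℚ.* expTerm x n) ℚ.*_) (suc*1/suc n)) (ℚₚ.*-identityʳ _))
  where open +-*-Solver

module Addition (x y : ℚ) where
  p q : ℕ → ℚ
  p = expTerm x
  q = expTerm y

  -- Induction without binomial coefficients: the convolution is multiplied by
  -- `n + 1 = i + (n + 1 - i)`. One half of this factor lowers the index of `p`, the other that of
  -- `q`, and each leaves the previous convolution times `x` or `y`.
  binomial : ∀ n → expTerm (x ℚ.+ y) n ≡ sumTo (suc n) (λ i → p i ℚ.* q (n ℕ.∸ i))
  binomial zero    = refl
  binomial (suc n) = begin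
    expTerm (x ℚ.+ y) n ℚ.* ((x ℚ.+ y) ℚ.* 1/suc n)   ≡⟨ cong (ℚ._* ((x ℚ.+ y) ℚ.* 1/suc n)) (binomial n) ⟩
    G ℚ.* ((x ℚ.+ y) ℚ.* 1/suc n)                     ≡⟨ solve 4 (λ g x y r → g :* ((x :+ y) :* r) :=
      (g :* x :+ g :* y) :* r) refl G x y (1/suc n) ⟩
    (G ℚ.* x ℚ.+ G ℚ.* y) ℚ.* 1/suc n                 ≡⟨ cong (ℚ._* 1/suc n) (cong₂ ℚ._+_ left right) ⟨
    (sumTo (suc (suc n)) f ℚ.+ sumTo (suc (suc n)) g) ℚ.* 1/suc n ≡⟨ cong (ℚ._* 1/suc n)
      (sumTo-+ (suc (suc n)) f g) ⟨
    sumTo (suc (suc n)) (λ i → f i ℚ.+ g i) ℚ.* 1/suc n ≡⟨ cong (ℚ._* 1/suc n)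
      (sumTo-cong (suc (suc n)) split) ⟩
    sumTo (suc (suc n)) (λ i → h i ℚ.* fromℕℚ (suc n)) ℚ.* 1/suc n ≡⟨ cong (ℚ._* 1/suc n)
      (sumTo-*ʳ (suc (suc n)) h (fromℕℚ (suc n))) ⟩
    sumTo (suc (suc n)) h ℚ.* fromℕℚ (suc n) ℚ.* 1/suc n ≡⟨ ℚₚ.*-assoc (sumTo (suc (suc n)) h)
      (fromℕℚ (suc n)) (1/suc n) ⟩
    sumTo (suc (suc n)) h ℚ.* (fromℕℚ (suc n) ℚ.* 1/suc n) ≡⟨ cong (sumTo (suc (suc n)) h ℚ.*_)
      (suc*1/suc n) ⟩
    sumTo (suc (suc n)) h ℚ.* 1ℚ                      ≡⟨ ℚₚ.*-identityʳ _ ⟩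
    sumTo (suc (suc n)) h                             ∎
    where
    open ≡-Reasoning
    open +-*-Solver
    G = sumTo (suc n) (λ i → p i ℚ.* q (n ℕ.∸ i))
    f g h : ℕ → ℚ
    f i = fromℕℚ i ℚ.* p i ℚ.* q (suc n ℕ.∸ i)
    g i = p i ℚ.* (fromℕℚ (suc n ℕ.∸ i) ℚ.* q (suc n ℕ.∸ i))
    h i = p i ℚ.* q (suc n ℕ.∸ i)
    split : ∀ i → i ℕ.< suc (suc n) → f i ℚ.+ g i ≡ h i ℚ.* fromℕℚ (suc n)
    split i (s≤s i≤1+n) = trans (solve 4 (λ s t a b → s :* a :* b :+ a :* (t :* b) := a :* b :* (s :+ t))
      refl (fromℕℚ i) (fromℕℚ (suc n ℕ.∸ i)) (p i) (q (suc n ℕ.∸ i)))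
      (cong (h i ℚ.*_) (trans (sym (fromℕℚ-+ i (suc n ℕ.∸ i))) (cong fromℕℚ (ℕₚ.m+[n∸m]≡n i≤1+n))))
    left : sumTo (suc (suc n)) f ≡ G ℚ.* x
    left = trans (sumTo-shift (suc n) f) (trans (cong₂ ℚ._+_
        (trans (cong (ℚ._* q (suc n)) (ℚₚ.*-zeroˡ (p 0))) (ℚₚ.*-zeroˡ (q (suc n))))
        (sumTo-cong (suc n) (λ i _ → trans (cong (ℚ._* q (n ℕ.∸ i)) (suc*expTerm-suc x i))
          (solve 3 (λ x a b → x :* a :* b := a :* b :* x) refl x (p i) (q (n ℕ.∸ i))))))
      (trans (ℚₚ.+-identityˡ _) (sumTo-*ʳ (suc n) (λ i → p i ℚ.* q (n ℕ.∸ i)) x)))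
    right : sumTo (suc (suc n)) g ≡ G ℚ.* y
    right = trans (cong₂ ℚ._+_
        (trans (sumTo-cong (suc n) term) (sumTo-*ʳ (suc n) (λ i → p i ℚ.* q (n ℕ.∸ i)) y))
        (trans (cong (λ k → p (suc n) ℚ.* (fromℕℚ k ℚ.* q k)) (ℕₚ.n∸n≡0 n))
          (trans (cong (p (suc n) ℚ.*_) (ℚₚ.*-zeroˡ (q 0))) (ℚₚ.*-zeroʳ (p (suc n))))))
      (ℚₚ.+-identityʳ _)
      where
      term : ∀ i → i ℕ.< suc n → g i ≡ p i ℚ.* q (n ℕ.∸ i) ℚ.* y
      term i (s≤s i≤n) = trans (cong (λ k → p i ℚ.* (fromℕℚ k ℚ.* q k)) (ℕₚ.+-∸-assoc 1 i≤n))
        (trans (cong (p i ℚ.*_) (suc*expTerm-suc y (n ℕ.∸ i)))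
          (solve 3 (λ y a b → a :* (y :* b) := a :* b :* y) refl y (p i) (q (n ℕ.∸ i))))

  -- Both sides sum `p_i q_j` over the triangle `i + j < n`; passing to `n + 1` adds one
  -- antidiagonal, which is `binomial`.
  expSum-+ : ∀ n → expSum (x ℚ.+ y) n ≡ sumTo n (λ i → p i ℚ.* expSum y (n ℕ.∸ i))
  expSum-+ zero    = refl
  expSum-+ (suc n) = sym (begin
    sumTo (suc n) (λ i → p i ℚ.* expSum y (suc n ℕ.∸ i))   ≡⟨ sumTo-cong (suc n) term ⟩
    sumTo (suc n) (λ i → p i ℚ.* S i ℚ.+ p i ℚ.* q (n ℕ.∸ i)) ≡⟨ sumTo-+ (suc n) (λ i → p i ℚ.* S i)
      (λ i → p i ℚ.* q (n ℕ.∸ i)) ⟩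
    sumTo (suc n) (λ i → p i ℚ.* S i) ℚ.+ sumTo (suc n) (λ i → p i ℚ.* q (n ℕ.∸ i))
      ≡⟨ cong₂ ℚ._+_ (trans (cong (λ k → sumTo n (λ i → p i ℚ.* S i) ℚ.+ p n ℚ.* expSum y k) (ℕₚ.n∸n≡0 n))
           (trans (cong (sumTo n (λ i → p i ℚ.* S i) ℚ.+_) (ℚₚ.*-zeroʳ (p n)))
             (ℚₚ.+-identityʳ (sumTo n (λ i → p i ℚ.* S i))))) (sym (binomial n)) ⟩
    sumTo n (λ i → p i ℚ.* S i) ℚ.+ expTerm (x ℚ.+ y) n    ≡⟨ cong (ℚ._+ expTerm (x ℚ.+ y) n) (expSum-+ n) ⟨
    expSum (x ℚ.+ y) n ℚ.+ expTerm (x ℚ.+ y) n             ∎)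
    where
    open ≡-Reasoning
    S : ℕ → ℚ
    S i = expSum y (n ℕ.∸ i)
    term : ∀ i → i ℕ.< suc n → p i ℚ.* expSum y (suc n ℕ.∸ i) ≡ p i ℚ.* S i ℚ.+ p i ℚ.* q (n ℕ.∸ i)
    term i (s≤s i≤n) = trans (cong (λ k → p i ℚ.* expSum y k) (ℕₚ.+-∸-assoc 1 i≤n))
      (ℚₚ.*-distribˡ-+ (p i) (S i) (q (n ℕ.∸ i)))

sumTo-∣-∣ : ∀ n {f g h k : ℕ → ℚ} → (∀ i → i ℕ.< n → ℚ.∣ f i ℚ.- g i ∣ ℚ.≤ h i ℚ.- k i) →
  ℚ.∣ sumTo n f ℚ.- sumTo n g ∣ ℚ.≤ sumTo n h ℚ.- sumTo n k
sumTo-∣-∣ zero    b = ℚₚ.≤-refl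
sumTo-∣-∣ (suc n) {f} {g} {h} {k} b = begin
  ℚ.∣ (F ℚ.+ f n) ℚ.- (G ℚ.+ g n) ∣
    ≡⟨ cong ℚ.∣_∣ (solve 4 (λ F f G g → (F :+ f) :- (G :+ g) := (F :- G) :+ (f :- g)) refl F (f n) G (g n))
    ⟩
  ℚ.∣ (F ℚ.- G) ℚ.+ (f n ℚ.- g n) ∣        ≤⟨ ℚₚ.∣p+q∣≤∣p∣+∣q∣ (F ℚ.- G) (f n ℚ.- g n) ⟩
  ℚ.∣ F ℚ.- G ∣ ℚ.+ ℚ.∣ f n ℚ.- g n ∣      ≤⟨ ℚₚ.+-mono-≤ (sumTo-∣-∣ n (λ i i<n → b i (ℕₚ.m<n⇒m<1+n i<n)))
    (b n ℕₚ.≤-refl) ⟩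
  (H ℚ.- K) ℚ.+ (h n ℚ.- k n)              ≡⟨ solve 4 (λ F f G g → (F :- G) :+ (f :- g) := (F :+ f) :-
    (G :+ g)) refl H (h n) K (k n) ⟩
  (H ℚ.+ h n) ℚ.- (K ℚ.+ k n)              ∎
  where
  open ℚₚ.≤-Reasoning
  open +-*-Solver
  F = sumTo n f
  G = sumTo n g
  H = sumTo n h
  K = sumTo n k

module ProductBound (K : ℚ) (0≤K : 0ℚ ℚ.≤ K) where
  open ExpLemmas.Bounded K 0≤K

  -- The terms x^i y^j / (i! j!) with i, j < n ≤ i + j are dominated by those of K^i K^j / (i! j!),
  -- which in turn occur in the expansion of (K + K)^l / l! for n ≤ l < n + n.
  expSum-*-close : ∀ {x y} → ℚ.∣ x ∣ ℚ.≤ K → ℚ.∣ y ∣ ℚ.≤ K → ∀ n →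
    ℚ.∣ expSum (x ℚ.+ y) n ℚ.- expSum x n ℚ.* expSum y n ∣ ℚ.≤ expSum (K ℚ.+ K) (n ℕ.+ n) ℚ.- expSum
      (K ℚ.+ K) n
  expSum-*-close {x} {y} x≤K y≤K n = begin
    ℚ.∣ expSum (x ℚ.+ y) n ℚ.- expSum x n ℚ.* expSum y n ∣
      ≡⟨ ∣-∣-sym (expSum (x ℚ.+ y) n) (expSum x n ℚ.* expSum y n) ⟩
    ℚ.∣ expSum x n ℚ.* expSum y n ℚ.- expSum (x ℚ.+ y) n ∣
      ≡⟨ cong ℚ.∣_∣ (cong₂ ℚ._-_ (product x y) (Addition.expSum-+ x y n)) ⟩
    ℚ.∣ sumTo n (λ i → expTerm x i ℚ.* expSum y n) ℚ.- sumTo n (λ i → expTerm x i ℚ.* expSum y (n ℕ.∸ i)) ∣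
      ≤⟨ sumTo-∣-∣ n (λ i _ → term i) ⟩
    sumTo n (λ i → expTerm K i ℚ.* expSum K n) ℚ.- sumTo n (λ i → expTerm K i ℚ.* expSum K (n ℕ.∸ i))
      ≡⟨ cong (λ z → sumTo n (λ i → expTerm K i ℚ.* expSum K n) ℚ.- z) (Addition.expSum-+ K K n) ⟨
    sumTo n (λ i → expTerm K i ℚ.* expSum K n) ℚ.- expSum (K ℚ.+ K) n
      ≤⟨ ℚₚ.+-monoˡ-≤ (ℚ.- expSum (K ℚ.+ K) n) square ⟩
    expSum (K ℚ.+ K) (n ℕ.+ n) ℚ.- expSum (K ℚ.+ K) n ∎
    where
    open ℚₚ.≤-Reasoning
    product : ∀ x y → expSum x n ℚ.* expSum y n ≡ sumTo n (λ i → expTerm x i ℚ.* expSum y n)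
    product x y = trans (cong (ℚ._* expSum y n) (expSum≡sumTo x n))
      (sym (sumTo-*ʳ n (expTerm x) (expSum y n)))
    *-distribˡ-- : ∀ a b c → a ℚ.* b ℚ.- a ℚ.* c ≡ a ℚ.* (b ℚ.- c)
    *-distribˡ-- = solve 3 (λ a b c → a :* b :- a :* c := a :* (b :- c)) refl
      where open +-*-Solver
    term : ∀ i → ℚ.∣ expTerm x i ℚ.* expSum y n ℚ.- expTerm x i ℚ.* expSum y (n ℕ.∸ i) ∣
      ℚ.≤ expTerm K i ℚ.* expSum K n ℚ.- expTerm K i ℚ.* expSum K (n ℕ.∸ i)
    term i = begin
      ℚ.∣ expTerm x i ℚ.* expSum y n ℚ.- expTerm x i ℚ.* expSum y (n ℕ.∸ i) ∣
        ≡⟨ cong ℚ.∣_∣ (*-distribˡ-- (expTerm x i) (expSum y n) (expSum y (n ℕ.∸ i))) ⟩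
      ℚ.∣ expTerm x i ℚ.* (expSum y n ℚ.- expSum y (n ℕ.∸ i)) ∣
        ≡⟨ ℚₚ.∣p*q∣≡∣p∣*∣q∣ (expTerm x i) _ ⟩
      ℚ.∣ expTerm x i ∣ ℚ.* ℚ.∣ expSum y n ℚ.- expSum y (n ℕ.∸ i) ∣
        ≤⟨ RationalLemmas.*-mono (ℚₚ.0≤∣p∣ _) (0≤term i) (∣term∣≤ x x≤K i) (∣sum-sum∣≤ y y≤K (ℕₚ.m∸n≤m n i))
          ⟩
      expTerm K i ℚ.* (expSum K n ℚ.- expSum K (n ℕ.∸ i))
        ≡⟨ *-distribˡ-- (expTerm K i) (expSum K n) (expSum K (n ℕ.∸ i)) ⟨
      expTerm K i ℚ.* expSum K n ℚ.- expTerm K i ℚ.* expSum K (n ℕ.∸ i) ∎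
    square : sumTo n (λ i → expTerm K i ℚ.* expSum K n) ℚ.≤ expSum (K ℚ.+ K) (n ℕ.+ n)
    square = begin
      sumTo n (λ i → expTerm K i ℚ.* expSum K n)
        ≤⟨ sumTo-mono n (λ i i<n → *-monoˡ (expTerm K i) (0≤term i) (sum-mono (n≤n+n∸i i i<n))) ⟩
      sumTo n (λ i → expTerm K i ℚ.* expSum K (n ℕ.+ n ℕ.∸ i))
        ≤⟨ sumTo-monoˡ (λ i → RationalLemmas.0≤* (0≤term i) (0≤sum (n ℕ.+ n ℕ.∸ i))) (ℕₚ.m≤m+n n n) ⟩
      sumTo (n ℕ.+ n) (λ i → expTerm K i ℚ.* expSum K (n ℕ.+ n ℕ.∸ i))
        ≡⟨ Addition.expSum-+ K K (n ℕ.+ n) ⟨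
      expSum (K ℚ.+ K) (n ℕ.+ n) ∎
      where
      n≤n+n∸i : ∀ i → i ℕ.< n → n ℕ.≤ n ℕ.+ n ℕ.∸ i
      n≤n+n∸i i i<n = ℕₚ.≤-trans (ℕₚ.m≤m+n n (n ℕ.∸ i)) (ℕₚ.≤-reflexive (sym (ℕₚ.+-∸-assoc n (ℕₚ.<⇒≤ i<n))))

twice≤ : ∀ k → fromℕℚ k ℚ.+ fromℕℚ k ℚ.≤ fromℕℚ (suc (k ℕ.+ k))
twice≤ k = ℚₚ.≤-trans (ℚₚ.≤-reflexive (sym (fromℕℚ-+ k k))) (fromℕℚ-mono (ℕₚ.n≤1+n (k ℕ.+ k)))

ℝ-exp-cong : ∀ {x y} → x ≈ y → exp x ≈ exp y
ℝ-exp-cong {x} {y} x≈y ε 0<ε =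
  let k , x≤k = bounded x
      l , y≤l = bounded y
      K = k ℕ.⊔ l
      J = suc (K ℕ.+ K)
      open ExpLemmas.Bounded (fromℕℚ K) (0≤fromℕℚ K)
      open Tail J (s≤s z≤n) (twice≤ K)
      δ , 0<δ , Bδ≤ε = scale (upper J) ε (ℚₚ.≤-trans (0≤sum J) (sum≤upper J)) 0<ε
  in map₄ (λ n p q r J≤n → ℚₚ.≤-trans
         (Pair.sum-lipschitz (seq x n) (seq y n) (ℚₚ.≤-trans p (fromℕℚ-mono (ℕₚ.m≤m⊔n k l)))
           (ℚₚ.≤-trans q (fromℕℚ-mono (ℕₚ.m≤n⊔m k l))) n)
         (ℚₚ.≤-trans (RationalLemmas.*-mono (0≤sum n) (ℚₚ.<⇒≤ 0<δ) r (sum≤B n J≤n))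
           (ℚₚ.≤-trans (ℚₚ.≤-reflexive (ℚₚ.*-comm δ (upper J))) Bδ≤ε)))
       x≤k y≤l (x≈y δ 0<δ) (J , λ n J≤n → J≤n)

-- At index `n` the defect is at most the part of the series for `2 K` between `n` and `2 n`, hence
-- at most twice its `n`-th term once the terms halve, that is from `J` on.
ℝ-exp-+ : ∀ x y → exp (x + y) ≈ exp x * exp y
ℝ-exp-+ x y ε 0<ε =
  let k , x≤k = bounded x
      l , y≤l = bounded y
      K = k ℕ.⊔ l
      J = suc ((K ℕ.+ K) ℕ.+ (K ℕ.+ K))
      0≤2K = 0≤+ (0≤fromℕℚ K) (0≤fromℕℚ K)
      open ExpLemmas.Bounded (fromℕℚ K ℚ.+ fromℕℚ K) 0≤2K
      open Tail J (s≤s z≤n) (subst (λ z → z ℚ.+ z ℚ.≤ fromℕℚ J) (fromℕℚ-+ K K) (twice≤ (K ℕ.+ K)))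
      N , small = term-small (½ ℚ.* ε) (0<half 0<ε)
  in map₄ (λ n p q J≤n N≤n → ℚₚ.≤-trans
         (ProductBound.expSum-*-close (fromℕℚ K) (0≤fromℕℚ K) (ℚₚ.≤-trans p (fromℕℚ-mono (ℕₚ.m≤m⊔n k l)))
           (ℚₚ.≤-trans q (fromℕℚ-mono (ℕₚ.m≤n⊔m k l))) n)
         (ℚₚ.≤-trans (tail≤ J≤n (ℕₚ.m≤m+n n n))
           (ℚₚ.≤-trans (ℚₚ.+-mono-≤ (small n N≤n) (small n N≤n)) (ℚₚ.≤-reflexive (half+half ε)))))
       x≤k y≤l (J , λ n J≤n → J≤n) (N , λ n N≤n → N≤n)

expSum-0 : ∀ n → expSum 0ℚ (suc n) ≡ 1ℚ
expSum-0 zero    = refl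
expSum-0 (suc n) = trans (cong₂ ℚ._+_ (expSum-0 n)
  (trans (cong (expTerm 0ℚ n ℚ.*_) (ℚₚ.*-zeroˡ (1/suc n))) (ℚₚ.*-zeroʳ (expTerm 0ℚ n)))) refl

ℝ-exp-0 : exp 0ℝ ≈ 1ℝ
ℝ-exp-0 ε 0<ε = 1 , λ { (suc n) _ → subst (λ z → ℚ.∣ z ℚ.- 1ℚ ∣ ℚ.≤ ε) (sym (expSum-0 n)) (ℚₚ.<⇒≤ 0<ε) }

0≤square : ∀ x → 0ℝ ≤ x * x
0≤square x = eventually-≤ 0ℝ (x * x) (always (λ n → 0≤p² (seq x n)))

-- For `|x| ≤ 1/2` the terms halve from index 1 on, so the series beyond `1 + x` is at most twice
-- its next term `x^2 / 2`.
exp-small : ∀ x → Eventually (λ n → ℚ.∣ seq x n ∣ ℚ.≤ ½) → 1ℝ + x - x * x ≤ exp x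
exp-small x x≤½ = eventually-≤ (1ℝ + x - x * x) (exp x) (map₂ bound x≤½ (2 , λ n 2≤n → 2≤n))
  where
  open +-*-Solver
  open ℚₚ.≤-Reasoning
  ∣p∣²≡p² : ∀ p → ℚ.∣ p ∣ ℚ.* ℚ.∣ p ∣ ≡ p ℚ.* p
  ∣p∣²≡p² p with ℚₚ.∣p∣≡p∨∣p∣≡-p p
  ... | inj₁ eq = cong₂ ℚ._*_ eq eq
  ... | inj₂ eq = trans (cong₂ ℚ._*_ eq eq) (solve 1 (λ p → :- p :* :- p := p :* p) refl p)
  bound : ∀ n → ℚ.∣ seq x n ∣ ℚ.≤ ½ → 2 ℕ.≤ n → 1ℚ ℚ.+ seq x n ℚ.- seq x n ℚ.* seq x n ℚ.≤ expSum (seq x n)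
    n
  bound n p≤½ 2≤n = begin
    1ℚ ℚ.+ p ℚ.- p ℚ.* p                           ≡⟨ cong₂ ℚ._-_ (two p) (∣p∣²≡p² p) ⟨
    expSum p 2 ℚ.- K ℚ.* K                         ≤⟨ RationalLemmas.p≤q+r⇒p-q≤r (begin
      expSum p 2                                     ≤⟨ ∣p-q∣≤⇒p≤q+r {expSum p 2} {expSum p n}
        (subst (ℚ._≤ K ℚ.* K) (∣-∣-sym (expSum p n) (expSum p 2)) tail) ⟩
      expSum p n ℚ.+ K ℚ.* K                         ≡⟨ ℚₚ.+-comm (expSum p n) (K ℚ.* K) ⟩
      K ℚ.* K ℚ.+ expSum p n                         ∎) ⟩
    expSum p n                                     ∎
    where
    p = seq x n
    K = ℚ.∣ p ∣
    open ExpLemmas.Bounded K (ℚₚ.0≤∣p∣ p)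
    open Tail 1 (s≤s z≤n) (ℚₚ.+-mono-≤ p≤½ p≤½)
    two : ∀ p → expSum p 2 ≡ 1ℚ ℚ.+ p
    two = solve 1 (λ p → con 0ℚ :+ con 1ℚ :+ con 1ℚ :* (p :* con 1ℚ) := con 1ℚ :+ p) refl
    tail : ℚ.∣ expSum p n ℚ.- expSum p 2 ∣ ℚ.≤ K ℚ.* K
    tail = begin
      ℚ.∣ expSum p n ℚ.- expSum p 2 ∣ ≤⟨ ∣sum-sum∣≤ p ℚₚ.≤-refl 2≤n ⟩
      expSum K n ℚ.- expSum K 2       ≤⟨ tail≤ (s≤s z≤n) 2≤n ⟩
      expTerm K 2 ℚ.+ expTerm K 2     ≡⟨ solve 1 (λ k → con 1ℚ :* (k :* con 1ℚ) :* (k :* con ½) :+ con 1ℚ :*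
        (k :* con 1ℚ) :* (k :* con ½) := k :* k) refl K ⟩
      K ℚ.* K                         ∎

½^ : ℕ → ℚ
½^ zero    = 1ℚ
½^ (suc i) = ½ ℚ.* ½^ i

0<½^ : ∀ i → 0ℚ ℚ.< ½^ i
0<½^ zero    = ℚₚ.positive⁻¹ 1ℚ
0<½^ (suc i) = 0<half (0<½^ i)

½^*i≤1 : ∀ i → ½^ i ℚ.* fromℕℚ i ℚ.≤ 1ℚ
½^*i≤1 zero = toWitness {a? = _ ℚₚ.≤? 1ℚ} _
½^*i≤1 (suc i) = begin
  ½ ℚ.* ½^ i ℚ.* fromℕℚ (suc i)                  ≡⟨ cong (½ ℚ.* ½^ i ℚ.*_) (fromℕℚ-suc i) ⟩
  ½ ℚ.* ½^ i ℚ.* (1ℚ ℚ.+ fromℕℚ i)               ≡⟨ solve 2 (λ h i → con ½ :* h :* (con 1ℚ :+ i) := con ½ :*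
    h :+ con ½ :* (h :* i)) refl (½^ i) (fromℕℚ i) ⟩
  ½ ℚ.* ½^ i ℚ.+ ½ ℚ.* (½^ i ℚ.* fromℕℚ i)       ≤⟨ ℚₚ.+-mono-≤ (*-monoˡ ½ 0≤½ (½^≤1 i))
    (*-monoˡ ½ 0≤½ (½^*i≤1 i)) ⟩
  ½ ℚ.* 1ℚ ℚ.+ ½ ℚ.* 1ℚ                          ≡⟨ half+half 1ℚ ⟩
  1ℚ                                             ∎
  where
  open ℚₚ.≤-Reasoning
  open +-*-Solver
  0≤½ = ℚₚ.<⇒≤ RationalLemmas.0<½
  ½^≤1 : ∀ i → ½^ i ℚ.≤ 1ℚ
  ½^≤1 zero    = ℚₚ.≤-refl
  ½^≤1 (suc i) = ℚₚ.≤-trans (*-monoˡ ½ 0≤½ (½^≤1 i)) (toWitness {a? = _ ℚₚ.≤? 1ℚ} _)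

½^-scale : ∀ A ε → 0ℚ ℚ.< ε → ∃[ i ] ½^ i ℚ.* A ℚ.≤ ε
½^-scale A ε 0<ε =
  let n , h = RationalLemmas.archimedean⁻¹ A ε 0<ε
  in suc n , (begin
    ½^ (suc n) ℚ.* A                          ≤⟨ *-monoˡ (½^ (suc n)) (ℚₚ.<⇒≤ (0<½^ (suc n))) h ⟩
    ½^ (suc n) ℚ.* (fromℕℚ (suc n) ℚ.* ε)     ≡⟨ ℚₚ.*-assoc (½^ (suc n)) (fromℕℚ (suc n)) ε ⟨
    ½^ (suc n) ℚ.* fromℕℚ (suc n) ℚ.* ε       ≤⟨ *-monoʳ ε (ℚₚ.<⇒≤ 0<ε) (½^*i≤1 (suc n)) ⟩
    1ℚ ℚ.* ε                                  ≡⟨ ℚₚ.*-identityˡ ε ⟩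
    ε                                         ∎)
  where open ℚₚ.≤-Reasoning

exp-halve : ∀ x → exp x ≈ exp (fromℚ ½ * x) * exp (fromℚ ½ * x)
exp-halve x = IsEquivalence.trans ≈-isEquivalence {exp x} {exp (h + h)} {exp h * exp h}
  (ℝ-exp-cong {x} {h + h} (pointwise-≈ x (h + h) (λ n → sym (half+half (seq x n))))) (ℝ-exp-+ h h)
  where
  h = fromℚ ½ * x

0≤exp : ∀ x → 0ℝ ≤ exp x
0≤exp x = ℝ-≤-trans {0ℝ} {exp h * exp h} {exp x} (0≤square (exp h))
  (≈⇒≤ {exp h * exp h} {exp x} (IsEquivalence.sym ≈-isEquivalence {exp x} {exp h * exp h} (exp-halve x)))
  where
  h = fromℚ ½ * x

-- The small case applies to `x / 2^i`, and each of the `i` doublings halves the coefficient of the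
-- quadratic error.
exp-quadratic : ∀ i x → Eventually (λ n → ℚ.∣ ½^ i ℚ.* seq x n ∣ ℚ.≤ ½) → 1ℝ + x - fromℚ (½^ i) * (x * x) ≤
  exp x
exp-quadratic zero x h = ℝ-≤-trans {1ℝ + x - 1ℝ * (x * x)} {1ℝ + x - x * x} {exp x}
  (≈⇒≤ {1ℝ + x - 1ℝ * (x * x)} {1ℝ + x - x * x}
    (pointwise-≈ (1ℝ + x - 1ℝ * (x * x)) (1ℝ + x - x * x) (λ n → cong (λ z → 1ℚ ℚ.+ seq x n ℚ.- z)
      (ℚₚ.*-identityˡ _))))
  (exp-small x (map₁ (λ n → subst (λ z → ℚ.∣ z ∣ ℚ.≤ ½) (ℚₚ.*-identityˡ (seq x n))) h))
exp-quadratic (suc i) x h = OrderedProperties.quadratic-doubling ℝ-algebra {exp x} {exp (fromℚ ½ * x)} {x}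
  (fromℚ (½^ i)) (exp-halve x)
  (0≤square (exp (fromℚ ½ * x) - 1ℝ))
  (exp-quadratic i (fromℚ ½ * x) (map₁ (λ n → subst (λ z → ℚ.∣ z ∣ ℚ.≤ ½)
    (solve 2 (λ a b → con ½ :* a :* b := a :* (con ½ :* b)) refl (½^ i) (seq x n))) h))
  where open +-*-Solver

-- For negative `x` the series alternates and resists comparison term by term, so the inequality is
-- reached as the limit of `exp-quadratic` for growing `i`. Taking `η = min (1/2, ε/2)` serves both
-- the smallness condition and the error.
1+x≤exp : ∀ x → 1ℝ + x ≤ exp x
1+x≤exp x ε 0<ε =
  let K , x≤K = bounded x
      k = fromℕℚ (suc K)
      ε′ = ½ ℚ.* ε
      η = ½ ℚ.⊓ ε′
      i , h = ½^-scale (k ℚ.* k) η (⊓-pos (0<half 0<ε))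
      0≤½^ = ℚₚ.<⇒≤ (0<½^ i)
      0≤k = 0≤fromℕℚ (suc K)
      1≤k = fromℕℚ-mono {1} {suc K} (s≤s z≤n)
      x≤k = map₁ (λ n h → ℚₚ.≤-trans h (fromℕℚ-mono (ℕₚ.n≤1+n K))) x≤K
      small = map₁ (λ n h′ → begin
        ℚ.∣ ½^ i ℚ.* seq x n ∣          ≡⟨ ℚₚ.∣p*q∣≡∣p∣*∣q∣ (½^ i) (seq x n) ⟩
        ℚ.∣ ½^ i ∣ ℚ.* ℚ.∣ seq x n ∣    ≡⟨ cong (ℚ._* ℚ.∣ seq x n ∣) (ℚₚ.0≤p⇒∣p∣≡p 0≤½^) ⟩
        ½^ i ℚ.* ℚ.∣ seq x n ∣          ≤⟨ *-monoˡ (½^ i) 0≤½^ h′ ⟩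
        ½^ i ℚ.* k                      ≡⟨ cong (½^ i ℚ.*_) (ℚₚ.*-identityʳ k) ⟨
        ½^ i ℚ.* (k ℚ.* 1ℚ)             ≤⟨ *-monoˡ (½^ i) 0≤½^ (*-monoˡ k 0≤k 1≤k) ⟩
        ½^ i ℚ.* (k ℚ.* k)              ≤⟨ h ⟩
        η                               ≤⟨ ℚₚ.p⊓q≤p ½ ε′ ⟩
        ½                               ∎) x≤k
  in map₂ (λ n p q → begin
       1ℚ ℚ.+ seq x n
         ≡⟨ solve 2 (λ u v → u := u :- v :+ v) refl (1ℚ ℚ.+ seq x n) (½^ i ℚ.* (seq x n ℚ.* seq x n)) ⟩
       1ℚ ℚ.+ seq x n ℚ.- ½^ i ℚ.* (seq x n ℚ.* seq x n) ℚ.+ ½^ i ℚ.* (seq x n ℚ.* seq x n)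
         ≤⟨ ℚₚ.+-mono-≤ p (begin
              ½^ i ℚ.* (seq x n ℚ.* seq x n)    ≤⟨ *-monoˡ (½^ i) 0≤½^ (begin
                seq x n ℚ.* seq x n               ≤⟨ p≤∣p∣ (seq x n ℚ.* seq x n) ⟩
                ℚ.∣ seq x n ℚ.* seq x n ∣         ≡⟨ ℚₚ.∣p*q∣≡∣p∣*∣q∣ (seq x n) (seq x n) ⟩
                ℚ.∣ seq x n ∣ ℚ.* ℚ.∣ seq x n ∣   ≤⟨ RationalLemmas.*-mono (ℚₚ.0≤∣p∣ (seq x n)) 0≤k q q ⟩
                k ℚ.* k                           ∎) ⟩
              ½^ i ℚ.* (k ℚ.* k)                ≤⟨ h ⟩
              η                                 ≤⟨ ℚₚ.p⊓q≤q ½ ε′ ⟩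
              ε′                                ∎) ⟩
       expSum (seq x n) n ℚ.+ ε′ ℚ.+ ε′         ≡⟨ trans (ℚₚ.+-assoc (expSum (seq x n) n) ε′ ε′)
         (cong (expSum (seq x n) n ℚ.+_) (half+half ε)) ⟩
       expSum (seq x n) n ℚ.+ ε                 ∎)
     (exp-quadratic i x small ε′ (0<half 0<ε)) x≤k
  where
  open ℚₚ.≤-Reasoning
  open +-*-Solver
  ⊓-pos : ∀ {δ} → 0ℚ ℚ.< δ → 0ℚ ℚ.< ½ ℚ.⊓ δ
  ⊓-pos {δ} 0<δ with ℚₚ.⊓-sel ½ δ
  ... | inj₁ eq = subst (0ℚ ℚ.<_) (sym eq) RationalLemmas.0<½
  ... | inj₂ eq = subst (0ℚ ℚ.<_) (sym eq) 0<δ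

ℝ-exponential : Exponential ℝ-algebra
ℝ-exponential = record
  { exp = exp
  ; exp-cong = λ {x} {y} → ℝ-exp-cong {x} {y}
  ; exp-+ = ℝ-exp-+
  ; exp-0 = ℝ-exp-0
  ; 0≤exp = 0≤exp
  ; 1+x≤exp = 1+x≤exp
  }

-- Differences of logarithms as harmonic sums

1/suc-antitone : ∀ {m n} → n ℕ.≤ m → 1/suc m ℚ.≤ 1/suc n
1/suc-antitone {n = n} = LnLemmas.1/suc-small (RationalLemmas.0<1/suc n)
  (ℚₚ.≤-reflexive (sym (suc*1/suc n)))

-- Both bounds compare 1/l, for l = M - e with e ≤ d, with the truncated geometric series
-- Σ eⁱ/M^{i+1}; here M = a + d and μ = 1/M.
module HarmonicBounds where
  open +-*-Solver
  open ℚₚ.≤-Reasoning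

  private
    reindex : ∀ a d {μ} → fromℕℚ (a ℕ.+ suc d) ℚ.* μ ≡ 1ℚ → fromℕℚ (suc a ℕ.+ d) ℚ.* μ ≡ 1ℚ
    reindex a d {μ} = subst (λ z → fromℕℚ z ℚ.* μ ≡ 1ℚ) (ℕₚ.+-suc a d)

    aμ : ∀ a d {μ} → fromℕℚ (a ℕ.+ d) ℚ.* μ ≡ 1ℚ → fromℕℚ a ℚ.* μ ≡ 1ℚ ℚ.- fromℕℚ d ℚ.* μ
    aμ a d {μ} eq = trans (solve 3 (λ a d u → a :* u := (a :+ d) :* u :- d :* u) refl (fromℕℚ a) (fromℕℚ d)
      μ)
      (cong (ℚ._- fromℕℚ d ℚ.* μ) (trans (cong (ℚ._* μ) (sym (fromℕℚ-+ a d))) eq))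

  term-lower : ∀ a d {μ} → fromℕℚ (suc a ℕ.+ d) ℚ.* μ ≡ 1ℚ → μ ℚ.+ fromℕℚ d ℚ.* (μ ℚ.* μ) ℚ.≤ 1/suc a
  term-lower a d {μ} eq = RationalLemmas.*-cancelˡ A (RationalLemmas.0<fromℕℚ-suc a) (begin
    A ℚ.* (μ ℚ.+ D ℚ.* (μ ℚ.* μ))               ≡⟨ solve 3 (λ a d u → a :* (u :+ d :* (u :* u)) := (a :* u)
      :* (con 1ℚ :+ d :* u)) refl A D μ ⟩
    (A ℚ.* μ) ℚ.* (1ℚ ℚ.+ D ℚ.* μ)              ≡⟨ cong (ℚ._* (1ℚ ℚ.+ D ℚ.* μ)) (aμ (suc a) d eq) ⟩
    (1ℚ ℚ.- D ℚ.* μ) ℚ.* (1ℚ ℚ.+ D ℚ.* μ)       ≤⟨ p≤p+q (0≤p² (D ℚ.* μ)) ⟩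
    (1ℚ ℚ.- D ℚ.* μ) ℚ.* (1ℚ ℚ.+ D ℚ.* μ) ℚ.+ D ℚ.* μ ℚ.* (D ℚ.* μ)
      ≡⟨ solve 1 (λ z → (con 1ℚ :- z) :* (con 1ℚ :+ z) :+ z :* z := con 1ℚ) refl (D ℚ.* μ) ⟩
    1ℚ                                          ≡⟨ suc*1/suc a ⟨
    A ℚ.* 1/suc a                               ∎)
    where
    A = fromℕℚ (suc a)
    D = fromℕℚ d

  term-upper : ∀ a d {μ} → fromℕℚ (suc a ℕ.+ d) ℚ.* μ ≡ 1ℚ →
    1/suc a ≡ μ ℚ.+ fromℕℚ d ℚ.* (μ ℚ.* μ) ℚ.+ fromℕℚ d ℚ.* fromℕℚ d ℚ.* (μ ℚ.* μ ℚ.* μ)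
      ℚ.+ fromℕℚ d ℚ.* fromℕℚ d ℚ.* fromℕℚ d ℚ.* (μ ℚ.* μ ℚ.* μ) ℚ.* 1/suc a
  term-upper a d {μ} eq = trans (sym (trans (cong (ℚ._* ρ) (trans (ℚₚ.*-comm ρ A) (suc*1/suc a)))
    (ℚₚ.*-identityˡ ρ)))
    (trans (cong (λ z → ρ ℚ.* z ℚ.* ρ) A≡)
    (trans (solve 4 (λ r a d u → r :* (a :* (a :* u :* (con 1ℚ :+ d :* u :+ d :* u :* (d :* u)) :+ d :* u :*
      (d :* u) :* (d :* u))) :* r
              := (r :* a) :* (r :* a) :* (u :+ d :* (u :* u) :+ d :* d :* (u :* u :* u)) :+ (r :* a) :*
                (d :* d :* d :* (u :* u :* u) :* r)) refl ρ A D μ)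
      (trans (cong (λ z → z ℚ.* z ℚ.* (μ ℚ.+ D ℚ.* (μ ℚ.* μ) ℚ.+ D ℚ.* D ℚ.* (μ ℚ.* μ ℚ.* μ)) ℚ.+ z ℚ.*
        (D ℚ.* D ℚ.* D ℚ.* (μ ℚ.* μ ℚ.* μ) ℚ.* ρ))
          (trans (ℚₚ.*-comm ρ A) (suc*1/suc a)))
        (solve 2 (λ p q → con 1ℚ :* con 1ℚ :* p :+ con 1ℚ :* q := p :+ q) refl
          (μ ℚ.+ D ℚ.* (μ ℚ.* μ) ℚ.+ D ℚ.* D ℚ.* (μ ℚ.* μ ℚ.* μ)) (D ℚ.* D ℚ.* D ℚ.* (μ ℚ.* μ ℚ.* μ) ℚ.*
            ρ)))))
    where
    A = fromℕℚ (suc a)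
    D = fromℕℚ d
    ρ = 1/suc a
    z = D ℚ.* μ
    -- Since `A μ = 1 - z`, the bracket is `(1 - z)(1 + z + z^2) + z^3 = 1`, a geometric sum with
    -- its remainder.
    A≡ : A ≡ A ℚ.* (A ℚ.* μ ℚ.* (1ℚ ℚ.+ z ℚ.+ z ℚ.* z) ℚ.+ z ℚ.* z ℚ.* z)
    A≡ = trans (sym (ℚₚ.*-identityʳ A)) (cong (A ℚ.*_)
      (sym (trans (cong (λ y → y ℚ.* (1ℚ ℚ.+ z ℚ.+ z ℚ.* z) ℚ.+ z ℚ.* z ℚ.* z) (aμ (suc a) d eq))
      (solve 1 (λ z → (con 1ℚ :- z) :* (con 1ℚ :+ z :+ z :* z) :+ z :* z :* z := con 1ℚ) refl z))))

  -- The closed form of `Σ (μ + e μ^2)` over `0 ≤ e < d`.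
  lower : ℚ → ℚ → ℚ
  lower d μ = d ℚ.* μ ℚ.+ ½ ℚ.* (d ℚ.* (d ℚ.- 1ℚ) ℚ.* (μ ℚ.* μ))

  -- Power sums over `e < d` are rounded up: `Σ e ≤ d^2 / 2`, `Σ e^2 ≤ d^3`, `Σ e^3 ≤ d^4`. `κ`
  -- bounds each `1/l` in the remainder.
  upper : ℚ → ℚ → ℚ → ℚ
  upper κ d μ = d ℚ.* μ ℚ.+ ½ ℚ.* (d ℚ.* d ℚ.* (μ ℚ.* μ)) ℚ.+ d ℚ.* d ℚ.* d ℚ.* (μ ℚ.* μ ℚ.* μ)
    ℚ.+ d ℚ.* d ℚ.* d ℚ.* d ℚ.* (μ ℚ.* μ ℚ.* μ) ℚ.* κ

  -- The induction removes the smallest denominator, so that `a + d`, and with it `μ`, stays fixed.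
  lower≤harmonic : ∀ a d {μ} → fromℕℚ (a ℕ.+ d) ℚ.* μ ≡ 1ℚ → lower (fromℕℚ d) μ ℚ.≤ harmonic a d
  lower≤harmonic a zero {μ} eq = ℚₚ.≤-reflexive
    (solve 1 (λ u → con 0ℚ :* u :+ con ½ :* (con 0ℚ :* (con 0ℚ :- con 1ℚ) :* (u :* u)) := con 0ℚ) refl μ)
  lower≤harmonic a (suc d) {μ} eq = begin
    lower (fromℕℚ (suc d)) μ                    ≡⟨ cong (λ z → lower z μ) (fromℕℚ-suc d) ⟩
    lower (1ℚ ℚ.+ D) μ                          ≡⟨ solve 2 (λ d u → (con 1ℚ :+ d) :* u :+ con ½ :*
      ((con 1ℚ :+ d) :* ((con 1ℚ :+ d) :- con 1ℚ) :* (u :* u))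
                                                     := (u :+ d :* (u :* u)) :+
                                                       (d :* u :+ con ½ :* (d :* (d :- con 1ℚ) :*
                                                       (u :* u)))) refl D μ ⟩
    (μ ℚ.+ D ℚ.* (μ ℚ.* μ)) ℚ.+ lower D μ       ≤⟨ ℚₚ.+-mono-≤ (term-lower a d eq′)
      (lower≤harmonic (suc a) d eq′) ⟩
    1/suc a ℚ.+ harmonic (suc a) d              ≡⟨ LnLemmas.harmonic-shift a d ⟨
    harmonic a (suc d)                          ∎
    where
    D = fromℕℚ d
    eq′ = reindex a d eq

  harmonic≤upper : ∀ n a d {μ} → n ℕ.≤ a → 0ℚ ℚ.≤ μ → fromℕℚ (a ℕ.+ d) ℚ.* μ ≡ 1ℚ → harmonic a d ℚ.≤ upper
    (1/suc n) (fromℕℚ d) μ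
  harmonic≤upper n a zero {μ} n≤a 0≤μ eq = ℚₚ.≤-reflexive
    (solve 2 (λ u k → con 0ℚ := con 0ℚ :* u :+ con ½ :* (con 0ℚ :* con 0ℚ :* (u :* u))
    :+ con 0ℚ :* con 0ℚ :* con 0ℚ :* (u :* u :* u) :+ con 0ℚ :* con 0ℚ :* con 0ℚ :* con 0ℚ :* (u :* u :* u)
      :* k) refl μ (1/suc n))
  harmonic≤upper n a (suc d) {μ} n≤a 0≤μ eq = begin
    harmonic a (suc d)                          ≡⟨ LnLemmas.harmonic-shift a d ⟩
    1/suc a ℚ.+ harmonic (suc a) d              ≤⟨ ℚₚ.+-mono-≤ term (harmonic≤upper n (suc a) d
      (ℕₚ.m≤n⇒m≤1+n n≤a) 0≤μ eq′) ⟩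
    (μ ℚ.+ D ℚ.* (μ ℚ.* μ) ℚ.+ D ℚ.* D ℚ.* μ³ ℚ.+ D ℚ.* D ℚ.* D ℚ.* μ³ ℚ.* κ) ℚ.+ upper κ D μ
      -- The polynomial added here is the slack that the rounded power sums gain from `d` to
      -- `d + 1`.
      ≤⟨ p≤p+q (0≤+ (0≤+ (0≤* (ℚₚ.<⇒≤ RationalLemmas.0<½) (0≤* 0≤μ 0≤μ))
        (0≤* (0≤+ (0≤+ (0≤+ 0≤D² 0≤D²) (0≤* 0≤3 0≤D)) 0≤1) 0≤μ³))
           (0≤* (0≤* (0≤+ (0≤+ (0≤+ (0≤* 0≤3 (0≤* 0≤D² 0≤D)) (0≤* 0≤6 0≤D²)) (0≤* 0≤4 0≤D)) 0≤1) 0≤μ³) 0≤κ))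
             ⟩
    _ ≡⟨ solve 3 (λ d u k → (u :+ d :* (u :* u) :+ d :* d :* (u :* u :* u) :+ d :* d :* d :* (u :* u :* u)
      :* k)
            :+ (d :* u :+ con ½ :* (d :* d :* (u :* u)) :+ d :* d :* d :* (u :* u :* u) :+ d :* d :* d :* d
              :* (u :* u :* u) :* k)
            :+ (con ½ :* (u :* u) :+ (d :* d :+ d :* d :+ con 3ℚ :* d :+ con 1ℚ) :* (u :* u :* u)
              :+ (con 3ℚ :* (d :* d :* d) :+ con 6ℚ :* (d :* d) :+ con 4ℚ :* d :+ con 1ℚ) :* (u :* u :* u)
                :* k)
            := (con 1ℚ :+ d) :* u :+ con ½ :* ((con 1ℚ :+ d) :* (con 1ℚ :+ d) :* (u :* u)) :+ (con 1ℚ :+ d)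
              :* (con 1ℚ :+ d) :* (con 1ℚ :+ d) :* (u :* u :* u)
              :+ (con 1ℚ :+ d) :* (con 1ℚ :+ d) :* (con 1ℚ :+ d) :* (con 1ℚ :+ d) :* (u :* u :* u) :* k)
                refl D μ κ ⟩
    upper κ (1ℚ ℚ.+ D) μ                        ≡⟨ cong (λ z → upper κ z μ) (fromℕℚ-suc d) ⟨
    upper κ (fromℕℚ (suc d)) μ                  ∎
    where
    D = fromℕℚ d
    κ = 1/suc n
    3ℚ = + 3 ℚ./ 1
    4ℚ = + 4 ℚ./ 1
    6ℚ = + 6 ℚ./ 1
    0≤3 = toWitness {a? = 0ℚ ℚₚ.≤? 3ℚ} _
    0≤4 = toWitness {a? = 0ℚ ℚₚ.≤? 4ℚ} _
    0≤6 = toWitness {a? = 0ℚ ℚₚ.≤? 6ℚ} _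
    0≤1 = toWitness {a? = 0ℚ ℚₚ.≤? 1ℚ} _
    μ³ = μ ℚ.* μ ℚ.* μ
    0≤D = 0≤fromℕℚ d
    0≤D² = 0≤* 0≤D 0≤D
    0≤μ³ = 0≤* (0≤* 0≤μ 0≤μ) 0≤μ
    0≤κ = ExpLemmas.0≤1/suc n
    eq′ = reindex a d eq
    term : 1/suc a ℚ.≤ μ ℚ.+ D ℚ.* (μ ℚ.* μ) ℚ.+ D ℚ.* D ℚ.* μ³ ℚ.+ D ℚ.* D ℚ.* D ℚ.* μ³ ℚ.* κ
    term = ℚₚ.≤-trans (ℚₚ.≤-reflexive (term-upper a d eq′))
      (ℚₚ.+-monoʳ-≤ (μ ℚ.+ D ℚ.* (μ ℚ.* μ) ℚ.+ D ℚ.* D ℚ.* μ³)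
      (*-monoˡ (D ℚ.* D ℚ.* D ℚ.* μ³) (0≤* (0≤* 0≤D² 0≤D) 0≤μ³) (1/suc-antitone n≤a)))

-- ln m - ln p for m = p + t, with ν = 1/m.
module LnDifference (p′ t : ℕ) where
  open +-*-Solver
  open ℚₚ.≤-Reasoning

  private
    m′ = p′ ℕ.+ t
    ν = 1/suc m′
    T = fromℕℚ t

    difference : ∀ n → lnSum m′ n ℚ.- lnSum p′ n ≡ harmonic (suc p′ ℕ.* suc n) (t ℕ.* suc n)
    difference n = trans (cong (ℚ._- lnSum p′ n)
      (trans (cong (harmonic (suc n)) (ℕₚ.*-distribʳ-+ (suc n) p′ t))
        (LnLemmas.harmonic-++ (suc n) (p′ ℕ.* suc n) (t ℕ.* suc n))))
      (solve 2 (λ x y → (x :+ y) :- x := y) refl (lnSum p′ n) (harmonic (suc p′ ℕ.* suc n) (t ℕ.* suc n)))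

    Mμ : ∀ n → fromℕℚ (suc p′ ℕ.* suc n ℕ.+ t ℕ.* suc n) ℚ.* (ν ℚ.* 1/suc n) ≡ 1ℚ
    Mμ n = trans (cong (ℚ._* (ν ℚ.* 1/suc n))
      (trans (cong fromℕℚ (sym (ℕₚ.*-distribʳ-+ (suc n) (suc p′) t))) (fromℕℚ-* (suc m′) (suc n))))
      (trans (solve 4 (λ a b c d → (a :* b) :* (c :* d) := (a :* c) :* (b :* d)) refl (fromℕℚ (suc m′))
        (fromℕℚ (suc n)) ν (1/suc n))
        (cong₂ ℚ._*_ (suc*1/suc m′) (suc*1/suc n)))

    dμ : ∀ n → fromℕℚ (t ℕ.* suc n) ≡ T ℚ.* fromℕℚ (suc n)
    dμ n = fromℕℚ-* t (suc n)

  -- Here `M = m (n + 1)`, `d = t (n + 1)` and `μ = ν / (n + 1)`. The subtracted term comes from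
  -- `d (d - 1)` in place of `d^2` and vanishes as `n` grows.
  lnSum-lower : ∀ n → ν ℚ.* (T ℚ.+ ½ ℚ.* (ν ℚ.* (T ℚ.* T))) ℚ.- ½ ℚ.* (T ℚ.* (ν ℚ.* ν)) ℚ.* 1/suc n ℚ.≤
    lnSum m′ n ℚ.- lnSum p′ n
  lnSum-lower n = begin
    ν ℚ.* (T ℚ.+ ½ ℚ.* (ν ℚ.* (T ℚ.* T))) ℚ.- ½ ℚ.* (T ℚ.* (ν ℚ.* ν)) ℚ.* κ
      ≡⟨ solve 3 (λ v t k → v :* (t :+ con ½ :* (v :* (t :* t))) :- con ½ :* (t :* (v :* v)) :* k
           := t :* con 1ℚ :* v :+ con ½ :* (t :* con 1ℚ :* (t :* con 1ℚ :* (v :* v)) :- t :* con 1ℚ :*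
             (v :* v) :* k)) refl ν T κ ⟩
    T ℚ.* 1ℚ ℚ.* ν ℚ.+ ½ ℚ.* (T ℚ.* 1ℚ ℚ.* (T ℚ.* 1ℚ ℚ.* (ν ℚ.* ν)) ℚ.- T ℚ.* 1ℚ ℚ.* (ν ℚ.* ν) ℚ.* κ)
      ≡⟨ cong (λ z → T ℚ.* z ℚ.* ν ℚ.+ ½ ℚ.* (T ℚ.* z ℚ.* (T ℚ.* z ℚ.* (ν ℚ.* ν)) ℚ.- T ℚ.* z ℚ.* (ν ℚ.* ν)
        ℚ.* κ)) (suc*1/suc n) ⟨
    T ℚ.* (N ℚ.* κ) ℚ.* ν ℚ.+ ½ ℚ.* (T ℚ.* (N ℚ.* κ) ℚ.* (T ℚ.* (N ℚ.* κ) ℚ.* (ν ℚ.* ν)) ℚ.- T ℚ.* (N ℚ.* κ)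
      ℚ.* (ν ℚ.* ν) ℚ.* κ)
      ≡⟨ solve 4 (λ v t k N → t :* (N :* k) :* v :+ con ½ :* (t :* (N :* k) :* (t :* (N :* k) :* (v :* v))
        :- t :* (N :* k) :* (v :* v) :* k)
           := (t :* N) :* (v :* k) :+ con ½ :* ((t :* N) :* ((t :* N) :- con 1ℚ) :* ((v :* k) :* (v :* k))))
             refl ν T κ N ⟩
    HarmonicBounds.lower (T ℚ.* N) (ν ℚ.* κ)      ≡⟨ cong (λ z → HarmonicBounds.lower z (ν ℚ.* κ)) (dμ n) ⟨
    HarmonicBounds.lower (fromℕℚ (t ℕ.* suc n)) (ν ℚ.* κ) ≤⟨ HarmonicBounds.lower≤harmonic
      (suc p′ ℕ.* suc n) (t ℕ.* suc n) (Mμ n) ⟩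
    harmonic (suc p′ ℕ.* suc n) (t ℕ.* suc n)     ≡⟨ difference n ⟨
    lnSum m′ n ℚ.- lnSum p′ n                     ∎
    where
    κ = 1/suc n
    N = fromℕℚ (suc n)

  -- The term `t^4` stems from bounding `1/l` in the remainder by `1/(n + 1)`. This holds for every
  -- `p ≥ 1`, so the estimate stays uniform even when `t` is close to `m`.
  lnSum-upper : ∀ n → lnSum m′ n ℚ.- lnSum p′ n ℚ.≤
    ν ℚ.* (T ℚ.+ ½ ℚ.* (ν ℚ.* (T ℚ.* T)) ℚ.+ ν ℚ.* ν ℚ.* (T ℚ.* T ℚ.* T ℚ.+ T ℚ.* T ℚ.* T ℚ.* T))
  lnSum-upper n = begin
    lnSum m′ n ℚ.- lnSum p′ n                     ≡⟨ difference n ⟩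
    harmonic (suc p′ ℕ.* suc n) (t ℕ.* suc n)
      ≤⟨ HarmonicBounds.harmonic≤upper n (suc p′ ℕ.* suc n) (t ℕ.* suc n) (ℕₚ.≤-trans (ℕₚ.n≤1+n n)
        (ℕₚ.m≤m+n (suc n) (p′ ℕ.* suc n)))
           (0≤* (ExpLemmas.0≤1/suc m′) (ExpLemmas.0≤1/suc n)) (Mμ n) ⟩
    HarmonicBounds.upper κ (fromℕℚ (t ℕ.* suc n)) (ν ℚ.* κ)
      ≡⟨ cong (λ z → HarmonicBounds.upper κ z (ν ℚ.* κ)) (dμ n) ⟩
    HarmonicBounds.upper κ (T ℚ.* N) (ν ℚ.* κ)
      ≡⟨ solve 4 (λ v t k N → (t :* N) :* (v :* k) :+ con ½ :* ((t :* N) :* (t :* N) :*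
        ((v :* k) :* (v :* k)))
             :+ (t :* N) :* (t :* N) :* (t :* N) :* ((v :* k) :* (v :* k) :* (v :* k)) :+ (t :* N) :*
               (t :* N) :* (t :* N) :* (t :* N) :* ((v :* k) :* (v :* k) :* (v :* k)) :* k
           := (N :* k) :* (v :* t) :+ (N :* k) :* (N :* k) :* (con ½ :* (v :* v :* (t :* t)))
             :+ (N :* k) :* (N :* k) :* (N :* k) :* (v :* v :* v :* (t :* t :* t)) :+ (N :* k) :* (N :* k)
               :* (N :* k) :* (N :* k) :* (v :* v :* v :* (t :* t :* t :* t)))
           refl ν T κ N ⟩
    P (N ℚ.* κ)                                   ≡⟨ cong P (suc*1/suc n) ⟩
    P 1ℚ
      ≡⟨ solve 2 (λ v t → con 1ℚ :* (v :* t) :+ con 1ℚ :* con 1ℚ :* (con ½ :* (v :* v :* (t :* t)))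
             :+ con 1ℚ :* con 1ℚ :* con 1ℚ :* (v :* v :* v :* (t :* t :* t)) :+ con 1ℚ :* con 1ℚ :* con 1ℚ
               :* con 1ℚ :* (v :* v :* v :* (t :* t :* t :* t))
           := v :* (t :+ con ½ :* (v :* (t :* t)) :+ v :* v :* (t :* t :* t :+ t :* t :* t :* t))) refl ν T
             ⟩
    ν ℚ.* (T ℚ.+ ½ ℚ.* (ν ℚ.* (T ℚ.* T)) ℚ.+ ν ℚ.* ν ℚ.* (T ℚ.* T ℚ.* T ℚ.+ T ℚ.* T ℚ.* T ℚ.* T)) ∎
    where
    κ = 1/suc n
    N = fromℕℚ (suc n)
    P : ℚ → ℚ
    P z = z ℚ.* (ν ℚ.* T) ℚ.+ z ℚ.* z ℚ.* (½ ℚ.* (ν ℚ.* ν ℚ.* (T ℚ.* T)))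
      ℚ.+ z ℚ.* z ℚ.* z ℚ.* (ν ℚ.* ν ℚ.* ν ℚ.* (T ℚ.* T ℚ.* T)) ℚ.+ z ℚ.* z ℚ.* z ℚ.* z ℚ.*
        (ν ℚ.* ν ℚ.* ν ℚ.* (T ℚ.* T ℚ.* T ℚ.* T))

  ln-lower : fromℚ (ν ℚ.* (T ℚ.+ ½ ℚ.* (ν ℚ.* (T ℚ.* T)))) ≤ ln (suc m′) - ln (suc p′)
  ln-lower ε 0<ε =
    let N , h = RationalLemmas.archimedean⁻¹ B ε 0<ε
    in N , λ n N≤n → ℚₚ.≤-trans (ℚₚ.≤-reflexive (solve 2 (λ x y → x := (x :- y) :+ y) refl _
        (B ℚ.* 1/suc n)))
      (ℚₚ.+-mono-≤ (lnSum-lower n) (begin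
        B ℚ.* 1/suc n                             ≤⟨ *-monoˡ B 0≤B (1/suc-antitone N≤n) ⟩
        B ℚ.* 1/suc N                             ≤⟨ *-monoʳ (1/suc N) (ExpLemmas.0≤1/suc N) h ⟩
        fromℕℚ (suc N) ℚ.* ε ℚ.* 1/suc N          ≡⟨ solve 3 (λ a e b → a :* e :* b := a :* b :* e) refl
          (fromℕℚ (suc N)) ε (1/suc N) ⟩
        fromℕℚ (suc N) ℚ.* 1/suc N ℚ.* ε          ≡⟨ trans (cong (ℚ._* ε) (suc*1/suc N)) (ℚₚ.*-identityˡ ε)
          ⟩
        ε                                         ∎))
    where
    B = ½ ℚ.* (T ℚ.* (ν ℚ.* ν))
    0≤ν = ExpLemmas.0≤1/suc m′
    0≤B = 0≤* (ℚₚ.<⇒≤ RationalLemmas.0<½) (0≤* (0≤fromℕℚ t) (0≤* 0≤ν 0≤ν))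

  ln-upper : ln (suc m′) - ln (suc p′) ≤
    fromℚ (ν ℚ.* (T ℚ.+ ½ ℚ.* (ν ℚ.* (T ℚ.* T)) ℚ.+ ν ℚ.* ν ℚ.* (T ℚ.* T ℚ.* T ℚ.+ T ℚ.* T ℚ.* T ℚ.* T)))
  ln-upper = eventually-≤ (ln (suc m′) - ln (suc p′)) (fromℚ _) (always lnSum-upper)

-- Reciprocals, strict positivity and absolute values

recip-inverse : ∀ x (0<x : 0ℝ < x) → x * recip x 0<x ≈ 1ℝ
recip-inverse x (η , 0<η , N , h) ε 0<ε = N , λ n N≤n →
  subst (λ z → ℚ.∣ z ℚ.- 1ℚ ∣ ℚ.≤ ε) (sym (inverse (seq x n) (subst (ℚ._≤ seq x n) (ℚₚ.+-identityˡ η)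
    (h n N≤n)))) (ℚₚ.<⇒≤ 0<ε)
  where
  inverse : ∀ p → η ℚ.≤ p → p ℚ.* RationalLemmas.clampedInverse η 0<η p ≡ 1ℚ
  inverse p η≤p = subst (λ z → z ℚ.* RationalLemmas.clampedInverse η 0<η p ≡ 1ℚ) (ℚₚ.p≤q⇒p⊔q≡q η≤p)
    (ℚₚ.*-inverseʳ (η ℚ.⊔ p) {{ℚ.>-nonZero (ℚₚ.<-≤-trans 0<η (ℚₚ.p≤p⊔q η p))}})

-- The algebra delivers non-strict bounds, while division asks for a witness; half of `p` absorbs
-- the tolerance in `≤`.
≥⇒0< : ∀ {p x} → 0ℚ ℚ.< p → fromℚ p ≤ x → 0ℝ < x
≥⇒0< {p} {x} 0<p p≤x =
  let N , h = p≤x (½ ℚ.* p) (RationalLemmas.0<half 0<p)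
  in ½ ℚ.* p , RationalLemmas.0<half 0<p , N , λ n N≤n → begin
    0ℚ ℚ.+ ½ ℚ.* p                       ≡⟨ solve 1 (λ p → con 0ℚ :+ con ½ :* p := p :+ :- (con ½ :* p))
      refl p ⟩
    p ℚ.+ ℚ.- (½ ℚ.* p)                  ≤⟨ ℚₚ.+-monoˡ-≤ (ℚ.- (½ ℚ.* p)) (h n N≤n) ⟩
    seq x n ℚ.+ ½ ℚ.* p ℚ.+ ℚ.- (½ ℚ.* p) ≡⟨ solve 2 (λ x p → x :+ p :+ :- p := x) refl (seq x n) (½ ℚ.* p)
      ⟩
    seq x n                              ∎
  where
  open ℚₚ.≤-Reasoning
  open +-*-Solver

<⇒≤ : ∀ {x y} → x < y → x ≤ y
<⇒≤ {x} {y} (η , 0<η , h) = eventually-≤ x y (map₁ (λ n p → ℚₚ.≤-trans (RationalLemmas.p≤p+q (ℚₚ.<⇒≤ 0<η))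
  p) h)

∣x∣≤ : ∀ {x y} → x ≤ y → - x ≤ y → ∣ x ∣ ≤ y
∣x∣≤ h k ε 0<ε = map₂ (λ _ → RationalLemmas.∣∣≤) (h ε 0<ε) (k ε 0<ε)

1≉0 : ¬ (1ℝ ≈ 0ℝ)
1≉0 h with h ½ RationalLemmas.0<½
... | N , p with p N ℕₚ.≤-refl
... | ℚ.*≤* (ℤ.+≤+ (s≤s ()))

const-mono : ∀ {x y} → (∀ n → seq x n ℚ.≤ seq y n) → x ≤ y
const-mono {x} {y} h = eventually-≤ x y (always h)

-- Residue classes and application to the power sum

-- Here `r` is one less than in the theorem. Outside the degenerate range, Euclidean division of the
-- theorem's `m - r - 1` by `q` yields the least admissible base `1 + a` and the number `n` of steps
-- from it up to `m - r`.
split-modulus : ∀ q′ r m → m ℕ.≤ suc r ⊎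
  (∃[ a ] ∃[ n ] (a ℕ.≤ q′ × m ≡ suc (r ℕ.+ suc (a ℕ.+ suc q′ ℕ.* n))))
split-modulus q′ r m with ℕₚ.≤-<-connex m (suc r)
... | inj₁ m≤r = inj₁ m≤r
... | inj₂ r<m with ℕₚ.m≤n⇒∃[o]m+o≡n r<m
... | d , refl = inj₂ (d ℕ/.% suc q′ , d ℕ/./ suc q′ , ℕₚ.≤-pred (ℕ/.m%n<n d (suc q′)) ,
  cong suc (trans (sym (ℕₚ.+-suc r d)) (cong (λ z → r ℕ.+ suc z) (trans (ℕ/.m≡m%n+[m/n]*n d (suc q′))
    (cong (d ℕ/.% suc q′ ℕ.+_) (ℕₚ.*-comm (d ℕ/./ suc q′) (suc q′)))))))

module Residues (q : ℕ) where
  open +-*-ℤSolver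

  difference : ∀ {x y z} → x ≡ y [mod q ] → y ≡ z [mod q ] → x ≡ z [mod q ]
  difference {x} {y} {z} h k = subst (+ q ℤ∣.∣_) (solve 3 (λ x y z → (x :- y) :+ (y :- z) := x :- z) refl x
    y z) (ℤ∣.∣m∣n⇒∣m+n h k)

  multiple : ∀ x i → (x ℤ.+ + q ℤ.* i) ≡ x [mod q ]
  multiple x i = subst (+ q ℤ∣.∣_) (solve 2 (λ x y → y := (x :+ y) :- x) refl x (+ q ℤ.* i))
    (ℤ∣.∣m⇒∣m*n i ℤ∣.∣-refl)

  symmetric : ∀ {x y} → x ≡ y [mod q ] → y ≡ x [mod q ]
  symmetric {x} {y} h = subst (+ q ℤ∣.∣_) (solve 2 (λ x y → :- (x :- y) := y :- x) refl x y) (ℤ∣.∣m⇒∣-m h)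

  shift : ∀ z {x y} → x ≡ y [mod q ] → (z ℤ.+ x) ≡ (z ℤ.+ y) [mod q ]
  shift z {x} {y} h = subst (+ q ℤ∣.∣_) (solve 3 (λ x y z → x :- y := (z :+ x) :- (z :+ y)) refl x y z) h

  distinct : ∀ x e → 0 ℕ.< e → e ℕ.< q → ¬ (+ (x ℕ.+ e) ≡ + x [mod q ])
  distinct x (suc e) _ e<q h = ℕₚ.<⇒≱ e<q
    (ℕ∣.∣⇒≤ (ℤ∣.∣⇒∣ᵤ (subst (+ q ℤ∣.∣_) (solve 2 (λ x e → (x :+ e) :- x := e) refl (+ x) (+ suc e)) h)))

-- With `m = suc m′`, the bases are `1 + a + q (n - j) = m - t_j` for `0 ≤ j ≤ n`, so the estimate
-- is applied with `n + 1` terms.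
module Solution (q′ r′ a n m′ : ℕ) (m′≡ : m′ ≡ r′ ℕ.+ suc (a ℕ.+ suc q′ ℕ.* n)) (r′≤q′ : r′ ℕ.≤ q′)
  (a≤q′ : a ℕ.≤ q′)
  (b : ℤ) (k c : ℝ) (0<k : 0ℝ < k) (sum≈power : powerSum (suc q′) b (suc m′) k ≈ suc m′ ^ k)
  (residue : b ≡ + suc m′ ℤ.- + suc r′ [mod suc q′ ])
  (root : Coefficients.e^-c₁q (suc q′) (suc r′) c + Coefficients.e^-c₁r (suc q′) (suc r′) c ≈ 1ℝ) where

  open Coefficients (suc q′) (suc r′) c

  private
    Q R ν : ℝ
    Q = fromℕ (suc q′)
    R = fromℕ (suc r′)
    ν = fromℚ (1/suc m′)

  l h w : ℕ → ℝ
  l j = ln (suc (a ℕ.+ suc q′ ℕ.* (n ℕ.∸ j)))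
  h j = k * (ln (suc m′) - l j)
  w j = exp (- h j)

  1≤R : 1ℝ ≤ R
  1≤R = const-mono {1ℝ} {R} (λ _ → fromℕℚ-mono {1} {suc r′} (s≤s z≤n))

  R≤Q : R ≤ Q
  R≤Q = const-mono {R} {Q} (λ _ → fromℕℚ-mono (s≤s r′≤q′))

  open Asymptotics.Root ℝ-exponential c Q R 1≤R R≤Q root using (t; s; ½≤D; module ClosedForm; module
    Estimate)

  0<D : 0ℝ < D
  0<D = ≥⇒0< {½} {D} RationalLemmas.0<½ ½≤D

  private
    fromℕ-square : ∀ i → fromℕ (i ℕ.^ 2) ≈ fromℕ i * (fromℕ i * 1ℝ)
    fromℕ-square i = pointwise-≈ (fromℕ (i ℕ.^ 2)) (fromℕ i * (fromℕ i * 1ℝ))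
      (λ _ → trans (fromℕℚ-* i (i ℕ.* 1)) (cong (fromℕℚ i ℚ.*_) (fromℕℚ-* i 1)))

    fromℕ-2rq : fromℕ (2 ℕ.* suc r′ ℕ.* suc q′) ≈ fromℕ 2 * (R * Q)
    fromℕ-2rq = pointwise-≈ (fromℕ (2 ℕ.* suc r′ ℕ.* suc q′)) (fromℕ 2 * (R * Q)) (λ _ →
      trans (cong fromℕℚ (ℕₚ.*-assoc 2 (suc r′) (suc q′))) (trans (fromℕℚ-* 2 (suc r′ ℕ.* suc q′))
        (cong (fromℕℚ 2 ℚ.*_) (fromℕℚ-* (suc r′) (suc q′)))))

  module CF = ClosedForm (fromℕ (suc r′ ℕ.^ 2)) (fromℕ (2 ℕ.* suc r′ ℕ.* suc q′)) (fromℕ (suc q′ ℕ.^ 2))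
    (recip D 0<D) (recip (D ** 2) (**-pos D 0<D 2)) (recip (D ** 3) (**-pos D 0<D 3))
    (fromℕ-square (suc r′)) fromℕ-2rq (fromℕ-square (suc q′))
    (recip-inverse D 0<D) (recip-inverse (D ** 2) (**-pos D 0<D 2))
      (recip-inverse (D ** 3) (**-pos D 0<D 3))

  0<denominator : 0ℝ < denominator 0<D
  0<denominator = ≥⇒0< {1ℚ} {denominator 0<D} (ℚₚ.positive⁻¹ 1ℚ) CF.1≤denominator

  module _ where
    open Residues (suc q′)

    P : ℕ → Set
    P j = + suc j ≡ b [mod suc q′ ]

    b≡1+a : b ≡ + suc a [mod suc q′ ]
    b≡1+a = difference {b} {+ suc m′ ℤ.- + suc r′} {+ suc a} residue
      (subst (_≡ + suc a [mod suc q′ ]) (trans (cong (λ z → + suc a ℤ.+ z) (sym (ℤₚ.pos-* (suc q′) n)))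
          (trans (solve 2 (λ u y → y := (u :+ y) :- u) refl (+ (suc r′)) (+ suc (a ℕ.+ suc q′ ℕ.* n)))
            (cong (λ z → + suc z ℤ.- + suc r′) (sym m′≡))))
        (multiple (+ suc a) (+ n)))
      where
      open +-*-ℤSolver

    P⇒ : ∀ {j} → P j → + suc j ≡ + suc a [mod suc q′ ]
    P⇒ {j} p = difference {+ suc j} {b} {+ suc a} p b≡1+a

    a+qi : ∀ i → + suc (a ℕ.+ suc q′ ℕ.* i) ≡ + suc a [mod suc q′ ]
    a+qi i = subst (_≡ + suc a [mod suc q′ ]) (cong (λ z → + suc a ℤ.+ z) (sym (ℤₚ.pos-* (suc q′) i)))
      (multiple (+ suc a) (+ i))

    hit : ∀ i → P (a ℕ.+ suc q′ ℕ.* i)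
    hit i = difference {+ suc (a ℕ.+ suc q′ ℕ.* i)} {+ suc a} {b} (a+qi i) (symmetric {b} {+ suc a} b≡1+a)

    before : ∀ e → e ℕ.< a → ¬ P e
    before e e<a p = distinct (suc e) (a ℕ.∸ e) (ℕₚ.m<n⇒0<n∸m e<a) (s≤s (ℕₚ.≤-trans (ℕₚ.m∸n≤m a e) a≤q′))
      (subst (λ z → + suc z ≡ + suc e [mod suc q′ ]) (sym (ℕₚ.m+[n∸m]≡n (ℕₚ.<⇒≤ e<a)))
        (symmetric {+ suc e} {+ suc a} (P⇒ p)))

    between : ∀ i e → e ℕ.< q′ → ¬ P (suc (a ℕ.+ suc q′ ℕ.* i) ℕ.+ e)
    between i e e<q′ p = distinct y (suc e) (s≤s z≤n) (s≤s e<q′)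
      (subst (_≡ + y [mod suc q′ ]) (cong +_ (sym (ℕₚ.+-suc y e)))
        (difference {+ suc (y ℕ.+ e)} {+ suc a} {+ y} (P⇒ p) (symmetric {+ y} {+ suc a} (a+qi i))))
      where y = suc (a ℕ.+ suc q′ ℕ.* i)

  open Sums ℝ-algebra using (∑)
  open OrderedProperties ℝ-algebra using () renaming (_^_ to _^′_)

  powerSum≈∑ : powerSum (suc q′) b (suc m′) k ≈ ∑ (suc n) (λ j → suc (a ℕ.+ suc q′ ℕ.* (n ℕ.∸ j)) ^ k)
  powerSum≈∑ = subst (λ z → FS.total z ≈ ∑ (suc n) (λ j → suc (a ℕ.+ suc q′ ℕ.* (n ℕ.∸ j)) ^ k))
    (trans (ℕₚ.+-comm (suc (a ℕ.+ suc q′ ℕ.* n)) r′) (sym m′≡))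
      (FS.Progression.total-progression-gap q′ a hit before between n r′ r′≤q′)
    where
    module FS = Sums.FilteredSum ℝ-algebra (λ j → + suc j ≡? b [mod suc q′ ]) (λ j → suc j ^ k)

  w≈exp = λ j → pointwise-≈ (w j) (exp (- h j)) (λ _ → refl)

  mass = Asymptotics.∑-normalise ℝ-exponential (suc n) {powerSum (suc q′) b (suc m′) k} {suc m′ ^ k} {k}
    {ln (suc m′)} {λ j → suc (a ℕ.+ suc q′ ℕ.* (n ℕ.∸ j)) ^ k} {l} {h} {w}
    sum≈power (pointwise-≈ (suc m′ ^ k) (exp (k * ln (suc m′))) (λ _ → refl)) powerSum≈∑
    (λ j → pointwise-≈ (suc (a ℕ.+ suc q′ ℕ.* (n ℕ.∸ j)) ^ k) (exp (k * l j)) (λ _ → refl))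
    (λ j → pointwise-≈ (h j) (k * (ln (suc m′) - l j)) (λ _ → refl)) w≈exp

  τ : ℕ → ℕ
  τ j = suc r′ ℕ.+ suc q′ ℕ.* j

  τ≡ : ∀ j → fromℕℚ (τ j) ≡ fromℕℚ (suc r′) ℚ.+ fromℕℚ (suc q′) ℚ.* fromℕℚ j
  τ≡ j = trans (fromℕℚ-+ (suc r′) (suc q′ ℕ.* j)) (cong (fromℕℚ (suc r′) ℚ.+_) (fromℕℚ-* (suc q′) j))

  index+τ≡m′ : ∀ {j} → j ℕ.< suc n → (a ℕ.+ suc q′ ℕ.* (n ℕ.∸ j)) ℕ.+ τ j ≡ m′
  index+τ≡m′ {j} (s≤s j≤n) = trans (solve 5 (λ a u y v j → a :+ u :* y :+ (con 1 :+ v :+ u :* j) := v :+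
    (con 1 :+ (a :+ u :* (y :+ j)))) refl a (suc q′) (n ℕ.∸ j) r′ j)
    (trans (cong (λ z → r′ ℕ.+ suc (a ℕ.+ suc q′ ℕ.* z)) (ℕₚ.m∸n+n≡m j≤n)) (sym m′≡))
    where open +-*-ℕSolver

  open +-*-Solver

  ln-lower′ : ∀ j → j ℕ.< suc n → ν * (t j + fromℚ ½ * (ν * t j ^′ 2)) ≤ ln (suc m′) - l j
  ln-lower′ j j<n = ℝ-≤-trans {ν * (t j + fromℚ ½ * (ν * t j ^′ 2))} {fromℚ (F (1/suc m′) (fromℕℚ (τ j)))}
    {ln (suc m′) - l j}
    (≈⇒≤ {ν * (t j + fromℚ ½ * (ν * t j ^′ 2))} {fromℚ (F (1/suc m′) (fromℕℚ (τ j)))}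
      (pointwise-≈ (ν * (t j + fromℚ ½ * (ν * t j ^′ 2))) (fromℚ (F (1/suc m′) (fromℕℚ (τ j)))) (λ _ →
        trans (solve 2 (λ v t → v :* (t :+ con ½ :* (v :* (t :* (t :* con 1ℚ)))) := v :*
          (t :+ con ½ :* (v :* (t :* t)))) refl (1/suc m′) (fromℕℚ (suc r′) ℚ.+ fromℕℚ (suc q′) ℚ.* fromℕℚ
          j))
          (cong (F (1/suc m′)) (sym (τ≡ j))))))
    (subst (λ z → fromℚ (F (1/suc z) (fromℕℚ (τ j))) ≤ ln (suc z) - l j) (index+τ≡m′ j<n)
      (LnDifference.ln-lower (a ℕ.+ suc q′ ℕ.* (n ℕ.∸ j)) (τ j)))
    where
    F : ℚ → ℚ → ℚ
    F v T = v ℚ.* (T ℚ.+ ½ ℚ.* (v ℚ.* (T ℚ.* T)))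

  ln-upper′ : ∀ j → j ℕ.< suc n → ln (suc m′) - l j ≤ ν * (t j + fromℚ ½ * (ν * t j ^′ 2) + ν ^′ 2 *
    (t j ^′ 3 + t j ^′ 4))
  ln-upper′ j j<n = ℝ-≤-trans {ln (suc m′) - l j} {fromℚ (F (1/suc m′) (fromℕℚ (τ j)))} {G}
    (subst (λ z → ln (suc z) - l j ≤ fromℚ (F (1/suc z) (fromℕℚ (τ j)))) (index+τ≡m′ j<n)
      (LnDifference.ln-upper (a ℕ.+ suc q′ ℕ.* (n ℕ.∸ j)) (τ j)))
    (≈⇒≤ {fromℚ (F (1/suc m′) (fromℕℚ (τ j)))} {G}
      (pointwise-≈ (fromℚ (F (1/suc m′) (fromℕℚ (τ j)))) G (λ _ → trans (cong (F (1/suc m′)) (τ≡ j))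
        (solve 2 (λ v t → v :* (t :+ con ½ :* (v :* (t :* t)) :+ v :* v :*
          (t :* t :* t :+ t :* t :* t :* t))
           := v :* (t :+ con ½ :* (v :* (t :* (t :* con 1ℚ))) :+ v :* (v :* con 1ℚ) :*
             (t :* (t :* (t :* con 1ℚ)) :+ t :* (t :* (t :* (t :* con 1ℚ))))))
           refl (1/suc m′) (fromℕℚ (suc r′) ℚ.+ fromℕℚ (suc q′) ℚ.* fromℕℚ j)))))
    where
    G = ν * (t j + fromℚ ½ * (ν * t j ^′ 2) + ν ^′ 2 * (t j ^′ 3 + t j ^′ 4))
    F : ℚ → ℚ → ℚ
    F v T = v ℚ.* (T ℚ.+ ½ ℚ.* (v ℚ.* (T ℚ.* T)) ℚ.+ v ℚ.* v ℚ.* (T ℚ.* T ℚ.* T ℚ.+ T ℚ.* T ℚ.* T ℚ.* T))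

  0≤k : 0ℝ ≤ k
  0≤k = <⇒≤ {0ℝ} {k} 0<k

  0≤ν : 0ℝ ≤ ν
  0≤ν = const-mono {0ℝ} {ν} (λ _ → ExpLemmas.0≤1/suc m′)

  νm≡1 : 1/suc m′ ℚ.* fromℕℚ (suc m′) ≡ 1ℚ
  νm≡1 = trans (ℚₚ.*-comm (1/suc m′) (fromℕℚ (suc m′))) (suc*1/suc m′)

  1≤νQs : 1ℝ ≤ ν * (Q * s (suc n))
  1≤νQs = const-mono {1ℝ} {ν * (Q * s (suc n))} (λ _ → begin
    1ℚ                                          ≡⟨ νm≡1 ⟨
    1/suc m′ ℚ.* fromℕℚ (suc m′)                       ≤⟨ RationalLemmas.*-monoˡ (1/suc m′)
      (ExpLemmas.0≤1/suc m′) (fromℕℚ-mono m≤) ⟩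
    1/suc m′ ℚ.* fromℕℚ (suc q′ ℕ.* suc (suc n))     ≡⟨ cong (1/suc m′ ℚ.*_)
      (fromℕℚ-* (suc q′) (suc (suc n))) ⟩
    1/suc m′ ℚ.* (fromℕℚ (suc q′) ℚ.* fromℕℚ (suc (suc n))) ∎)
    where
    open ℚₚ.≤-Reasoning
    -- `m = r + (1 + a) + q n`, where `r ≤ q` and `1 + a ≤ q`.
    m≤ : suc m′ ℕ.≤ suc q′ ℕ.* suc (suc n)
    m≤ = ℕₚ.≤-trans (ℕₚ.≤-reflexive (cong suc m′≡))
      (ℕₚ.≤-trans (ℕₚ.+-mono-≤ (s≤s r′≤q′) (ℕₚ.+-monoˡ-≤ (suc q′ ℕ.* n) (s≤s a≤q′)))
      (ℕₚ.≤-reflexive (sym (trans (ℕₚ.*-suc (suc q′) (suc n)) (cong (suc q′ ℕ.+_) (ℕₚ.*-suc (suc q′) n))))))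

  νt≤1 : ∀ j → j ℕ.< suc n → ν * t j ≤ 1ℝ
  νt≤1 j j<n = const-mono {ν * t j} {1ℝ} (λ _ → begin
    1/suc m′ ℚ.* (fromℕℚ (suc r′) ℚ.+ fromℕℚ (suc q′) ℚ.* fromℕℚ j) ≡⟨ cong (1/suc m′ ℚ.*_) (τ≡ j) ⟨
    1/suc m′ ℚ.* fromℕℚ (τ j)                   ≤⟨ RationalLemmas.*-monoˡ (1/suc m′) (ExpLemmas.0≤1/suc m′)
      (fromℕℚ-mono τ≤m) ⟩
    1/suc m′ ℚ.* fromℕℚ (suc m′)                       ≡⟨ νm≡1 ⟩
    1ℚ                                          ∎)
    where
    open ℚₚ.≤-Reasoning
    τ≤m : τ j ℕ.≤ suc m′
    τ≤m = ℕₚ.≤-trans (ℕₚ.m≤n+m (τ j) _) (ℕₚ.≤-trans (ℕₚ.≤-reflexive (index+τ≡m′ j<n)) (ℕₚ.n≤1+n m′))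

  0≤kν : 0ℝ ≤ k * ν
  0≤kν = ℝ-0≤* {k} {ν} 0≤k 0≤ν

  ν≤1 : ν ≤ 1ℝ
  ν≤1 = const-mono {ν} {1ℝ} (λ _ → 1/suc-antitone {m′} {0} z≤n)

  h-lower = λ j j<n → Asymptotics.*-mono-assoc ℝ-exponential {t j + fromℚ ½ * (ν * t j ^′ 2)}
    {ln (suc m′) - l j} k ν 0≤k (ln-lower′ j j<n)

  h-upper = λ j j<n → Asymptotics.*-mono-assoc′ ℝ-exponential {t j + fromℚ ½ * (ν * t j ^′ 2) + ν ^′ 2 *
    (t j ^′ 3 + t j ^′ 4)} {ln (suc m′) - l j}
    k ν 0≤k (ln-upper′ j j<n)

  module Est = Estimate (e^-c₁q * recip D 0<D) (k * ν) ν (suc n) h w CF.Dv≈E 0≤kν 0≤ν ν≤1 1≤νQs νt≤1 w≈exp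
    mass h-lower h-upper

  mν≈1 : fromℕ (suc m′) * ν ≈ 1ℝ
  mν≈1 = pointwise-≈ (fromℕ (suc m′) * ν) 1ℝ (λ _ → suc*1/suc m′)

  0≤m : 0ℝ ≤ fromℕ (suc m′)
  0≤m = const-mono {0ℝ} {fromℕ (suc m′)} (λ _ → 0≤fromℕℚ (suc m′))

  kνm≈k = Asymptotics.*-cancel-unit ℝ-exponential {fromℕ (suc m′)} {ν} k mν≈1

  c₂*fullMoment₁ = CF.quotient*fullMoment₁ {recip (denominator 0<D) 0<denominator}
    (recip-inverse (denominator 0<D) 0<denominator)

  module Con = Est.Conclusion k (fromℕ (suc m′)) (c₂ 0<D 0<denominator) 0≤m mν≈1 kνm≈k c₂*fullMoment₁

  conclusion : Σ[ 0<D ∈ 0ℝ < D ] Σ[ 0<den ∈ 0ℝ < denominator 0<D ]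
    ∣ k - (c * fromℕ (suc m′) + c₂ 0<D 0<den) ∣ ≤ Asymptotics.ErrorConstant.C ℝ-exponential Q * fromℚ
      (1/suc m′)
  conclusion = 0<D , 0<denominator ,
    ∣x∣≤ {k - (c * fromℕ (suc m′) + c₂ 0<D 0<denominator)} {Asymptotics.ErrorConstant.C ℝ-exponential Q *
      fromℚ (1/suc m′)} Con.upper-bound Con.lower-bound

-- The range `m ≤ r`

module Degenerate (q r d m : ℕ) .{{_ : ℕ.NonZero m}} (m+d≡r : m ℕ.+ d ≡ r) (r≤q : r ℕ.≤ q) (b : ℤ) (k : ℝ)
  (residue : b ≡ + m ℤ.- + r [mod q ]) where
  open Residues q

  private
    module FS = Sums.FilteredSum ℝ-algebra (λ j → + suc j ≡? b [mod q ]) (λ j → suc j ^ k)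

  -- As `d = r - m`, an admissible index `i < m` would make `d + i` divisible by `q`, although
  -- `0 < d + i < r ≤ q`.
  miss : ∀ e → e ℕ.< m ℕ.∸ 1 → ¬ (+ suc e ≡ b [mod q ])
  miss e e<m-1 p = distinct 0 (d ℕ.+ suc e) (ℕₚ.m≤n⇒m≤o+n d (s≤s z≤n))
    (ℕₚ.<-≤-trans (ℕₚ.+-monoʳ-< d 1+e<m) (subst (ℕ._≤ q) (trans (sym m+d≡r) (ℕₚ.+-comm m d)) r≤q))
    (subst ((+ d ℤ.+ + suc e) ≡_[mod q ]) d+[m-r]≡0
      (shift (+ d) {+ suc e} {+ m ℤ.- + r} (difference {+ suc e} {b} {+ m ℤ.- + r} p residue)))
    where
    1+e<m : suc e ℕ.< m
    1+e<m = subst (suc (suc e) ℕ.≤_) (ℕₚ.suc-pred m) (s≤s e<m-1)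
    d+[m-r]≡0 : + d ℤ.+ (+ m ℤ.- + r) ≡ + 0
    d+[m-r]≡0 = trans (cong (λ z → + d ℤ.+ (+ m ℤ.- + z)) (sym m+d≡r))
      (solve 2 (λ d m → d :+ (m :- (m :+ d)) := con (+ 0)) refl (+ d) (+ m))
      where open +-*-ℤSolver

  no-solution : ¬ (powerSum q b m k ≈ m ^ k)
  no-solution sum≈power = 1≉0 (Asymptotics.exp≉0 ℝ-exponential {k * ln m} {m ^ k} {powerSum q b m k}
    (pointwise-≈ (m ^ k) (exp (k * ln m)) (λ _ → refl)) sum≈power (FS.total-skip 0 (m ℕ.∸ 1) miss))

theorem1p1 :
  (q : ℕ) → 1 ℕ.≤ q →
  Σ[ C ∈ ℝ ]
    ((b : ℤ) (m : ℕ) .{{_ : ℕ.NonZero m}} (k : ℝ) (r : ℕ) (c₁ : ℝ) →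
     let open Coefficients q r c₁ in
     0ℝ < k →
     powerSum q b m k ≈ m ^ k →
     1 ℕ.≤ r → r ℕ.≤ q →
     b ≡ + m ℤ.- + r [mod q ] →
     e^-c₁q + e^-c₁r ≈ 1ℝ →
     Σ[ 0<D ∈ 0ℝ < D ] Σ[ 0<den ∈ 0ℝ < denominator 0<D ]
       ∣ k - (c₁ * fromℕ m + c₂ 0<D 0<den) ∣ ≤ C * fromℚ (+ 1 ℚ./ m))
theorem1p1 (suc q′) _ = Asymptotics.ErrorConstant.C ℝ-exponential (fromℕ (suc q′)) , λ
  { b m k (suc r′) c₁ 0<k sum≈power _ (s≤s r′≤q′) residue root → bound b m k r′ c₁ 0<k sum≈power r′≤q′
    residue root (split-modulus q′ r′ m) }
  where
  bound : (b : ℤ) (m : ℕ) .{{_ : ℕ.NonZero m}} (k : ℝ) (r′ : ℕ) (c₁ : ℝ) →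
    let open Coefficients (suc q′) (suc r′) c₁ in
    0ℝ < k → powerSum (suc q′) b m k ≈ m ^ k → r′ ℕ.≤ q′ →
    b ≡ + m ℤ.- + suc r′ [mod suc q′ ] → e^-c₁q + e^-c₁r ≈ 1ℝ →
    m ℕ.≤ suc r′ ⊎ (∃[ a ] ∃[ n ] (a ℕ.≤ q′ × m ≡ suc (r′ ℕ.+ suc (a ℕ.+ suc q′ ℕ.* n)))) →
    Σ[ 0<D ∈ 0ℝ < D ] Σ[ 0<den ∈ 0ℝ < denominator 0<D ]
      ∣ k - (c₁ * fromℕ m + c₂ 0<D 0<den) ∣ ≤ Asymptotics.ErrorConstant.C ℝ-exponential (fromℕ (suc q′)) *
        fromℚ (+ 1 ℚ./ m)
  -- The power sum is empty here while `m^k` is an exponential, so the equation cannot hold.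
  bound b m k r′ c₁ 0<k sum≈power r′≤q′ residue root (inj₁ m≤r) =
    ⊥-elim (Degenerate.no-solution (suc q′) (suc r′) (suc r′ ℕ.∸ m) m (ℕₚ.m+[n∸m]≡n m≤r) (s≤s r′≤q′) b k
      residue sum≈power)
  bound b _ k r′ c₁ 0<k sum≈power r′≤q′ residue root (inj₂ (a , n , a≤q′ , refl)) =
    Solution.conclusion q′ r′ a n _ refl r′≤q′ a≤q′ b k c₁ 0<k sum≈power residue root
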